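{- For every even integer $k\ge 4$ and every integer $\ell\ge 2$ there is a constant $C=C(k,\ell)$ such that for all sufficiently large $n$, $$\mathrm{ex}(n,T_{k,\ell})\le C\, n^{\frac32+\frac{\ell}{k}}(\log n)^2.$$
   Context: $\mathrm{ex}(n,F)$ is the maximum number of edges in an $n$-vertex graph with no subgraph isomorphic to $F$; $\log$ is base 2. For even $k\ge 4$ and $\ell\ge 2$, the quadrangulated torus $T_{k,\ell}$ has vertex set $\{x_{i,j}:1\le i\le k,\ 1\le j\le \ell\}$ (all distinct) and edge set $\{x_{i,j}x_{i+1,j}:1\le i\le k,\ 1\le j\le\ell\}\cup\{x_{i,j+1}x_{i+1,j}:1\le i\le k,\ 1\le j\le \ell,\ i\text{ odd}\}\cup\{x_{i,j}x_{i+1,j+1}:1\le i\le k,\ 1\le j\le\ell,\ i\text{ even}\}$, where both coordinates are cyclic: $x_{k+1,j}=x_{1,j}$ for all $j$ and $x_{i,\ell+1}=x_{i,1}$ for all $i$. -}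

module Defs where

open import Data.Fin.Base using (Fin; zero; suc; toℕ; combine; finToFun; funToFin)
open import Data.Fin.Properties as Fin
  using (any?; all?; combine-injectiveˡ; remQuot-combine; finToFun-funToFin; toℕ-fromℕ<; toℕ<n)
  renaming (_≟_ to _≟ᶠ_; _<?_ to _<ᶠ?_)
import Data.Fin.Base as Fin using (_<_; remQuot)
import Data.Integer.Base as ℤ
open import Data.List.Base using (List; length; filter; map; allFin; cartesianProduct)
open import Data.List.Extrema.Nat using (max; argmax-sel; xs≤max)
open import Data.List.Membership.Propositional using (_∈_)
open import Data.List.Membership.Propositional.Properties
  using (∈-map⁺; ∈-map⁻; ∈-filter⁺; ∈-filter⁻; ∈-allFin)
open import Data.List.Properties using (filter-≐)
open import Data.List.Relation.Unary.All using (lookup)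
open import Data.Nat.Base as ℕ using (ℕ; z≤n; s≤s)
open import Data.Nat.Divisibility using (_∣_; _∤_; _∣?_)
open import Data.Nat.DivMod using (_%_; _mod_; m<n⇒m%n≡m; n%n≡0; m%n<n)
import Data.Nat.Properties as ℕ
open import Data.Product.Base using (∃; ∃₂; Σ-syntax; ∃-syntax; _×_; _,_; proj₁; proj₂)
open import Data.Rational.Unnormalised.Base as ℚᵘ using (ℚᵘ; 0ℚᵘ; ↥_; ↧ₙ_)
open import Data.Sum.Base using (_⊎_; inj₁; inj₂; swap)
open import Function.Base using (_∘_; _$_)
open import Function.Definitions using (Injective)
open import Level using (0ℓ)
open import Relation.Binary.Core using (Rel)
open import Relation.Binary.Definitions using (Decidable; Symmetric; Irreflexive)
open import Relation.Binary.PropositionalEquality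
open import Relation.Nullary using (¬_; Dec; yes; no; ¬?; contradiction; _×-dec_; _⊎-dec_; _→-dec_)
open import Relation.Nullary.Decidable using (map′)
open import Relation.Unary using (Pred)
import Algebra.Definitions.RawSemiring ℚᵘ.+-*-rawSemiring as Power

------------------------------------------------------------------------
-- Finite simple graphs

record Graph (n : ℕ) : Set₁ where
  field
    Adj        : Rel (Fin n) 0ℓ
    Adj?       : Decidable Adj
    Adj-sym    : Symmetric Adj
    Adj-irrefl : Irreflexive _≡_ Adj

open Graph public using (Adj; Adj?)

Edge : ∀ {n} → Graph n → Pred (Fin n × Fin n) 0ℓ
Edge G (u , v) = u Fin.< v × Adj G u v

Edge? : ∀ {n} (G : Graph n) (e : Fin n × Fin n) → Dec (Edge G e)
Edge? G (u , v) = (u <ᶠ? v) ×-dec Adj? G u v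

∣E_∣ : ∀ {n} → Graph n → ℕ
∣E_∣ {n} G = length (filter (Edge? G) (cartesianProduct (allFin n) (allFin n)))

infix 4 _⊑_ _⊑?_

-- G has a subgraph (not necessarily induced) isomorphic to F.
_⊑_ : ∀ {m n} → Graph m → Graph n → Set
_⊑_ {m} {n} F G =
  Σ[ f ∈ (Fin m → Fin n) ]
    Injective _≡_ _≡_ f × (∀ u v → Adj F u v → Adj G (f u) (f v))

_⊑?_ : ∀ {m n} (F : Graph m) (G : Graph n) → Dec (F ⊑ G)
_⊑?_ {m} {n} F G = map′ to from (any? λ c → copy? (finToFun c))
  where
  Copy : (Fin m → Fin n) → Set
  Copy f = (∀ u v → f u ≡ f v → u ≡ v) × (∀ u v → Adj F u v → Adj G (f u) (f v))

  copy? : ∀ f → Dec (Copy f)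
  copy? f = (all? λ u → all? λ v → (f u ≟ᶠ f v) →-dec (u ≟ᶠ v))
      ×-dec (all? λ u → all? λ v → Adj? F u v →-dec Adj? G (f u) (f v))

  to : (∃ λ (c : Fin (n ℕ.^ m)) → Copy (finToFun c)) → F ⊑ G
  to (c , inj , hom) = finToFun c , (λ {u} {v} → inj u v) , hom

  from : F ⊑ G → ∃ λ (c : Fin (n ℕ.^ m)) → Copy (finToFun c)
  from (f , inj , hom) = funToFin f
    , (λ u v eq → inj (trans (sym (f≗ u)) (trans eq (f≗ v))))
    , (λ u v uv → subst₂ (Adj G) (sym (f≗ u)) (sym (f≗ v)) (hom u v uv))
    where f≗ = finToFun-funToFin f

------------------------------------------------------------------------
-- Extremal numbers

-- Reads a number below 2 ^ (n * n) as a 0-1 matrix and makes u, v adjacent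
-- when u ≢ v and both the (u , v) and (v , u) entries are 1.
decode : ∀ {n} → Fin (2 ℕ.^ (n ℕ.* n)) → Graph n
decode {n} c = record
  { Adj        = λ u v → u ≢ v × bit u v ≡ suc zero × bit v u ≡ suc zero
  ; Adj?       = λ u v → ¬? (u ≟ᶠ v) ×-dec (bit u v ≟ᶠ suc zero) ×-dec (bit v u ≟ᶠ suc zero)
  ; Adj-sym    = λ (u≢v , uv , vu) → u≢v ∘ sym , vu , uv
  ; Adj-irrefl = λ u≡v (u≢v , _) → u≢v u≡v
  }
  where
  bit : Fin n → Fin n → Fin 2
  bit u v = finToFun c (combine u v)

-- Every graph on Fin n occurs in this list, up to logical equivalence of its
-- adjacency relation (see decode-surjective).
allGraphs : ∀ n → List (Graph n)
allGraphs n = map (decode {n}) (allFin (2 ℕ.^ (n ℕ.* n)))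

freeGraphs : ∀ {m} n → Graph m → List (Graph n)
freeGraphs n F = filter (λ G → ¬? (F ⊑? G)) (allGraphs n)

-- The maximum of the empty list is taken to be 0; ex-upper and ex-attained
-- below characterise this number.
ex : ∀ {m} → ℕ → Graph m → ℕ
ex n F = max 0 (map ∣E_∣ (freeGraphs n F))

decode-surjective : ∀ {n} (G : Graph n) → ∃[ c ]
  (∀ u v → Adj G u v → Adj (decode {n} c) u v) × (∀ u v → Adj (decode {n} c) u v → Adj G u v)
decode-surjective {n} G = funToFin bits , to , from
  where
  bit : ∀ {A : Set} → Dec A → Fin 2
  bit (yes _) = suc zero
  bit (no  _) = zero

  bit-1 : ∀ {A : Set} (A? : Dec A) → A → bit A? ≡ suc zero
  bit-1 (yes _) _ = refl
  bit-1 (no ¬a) a = contradiction a ¬a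

  bit-1⁻ : ∀ {A : Set} (A? : Dec A) → bit A? ≡ suc zero → A
  bit-1⁻ (yes a) _ = a

  entry : Fin n × Fin n → Fin 2
  entry (u , v) = bit (Adj? G u v)

  bits : Fin (n ℕ.* n) → Fin 2
  bits i = entry (Fin.remQuot n i)

  bits≡ : ∀ u v → finToFun (funToFin bits) (combine u v) ≡ bit (Adj? G u v)
  bits≡ u v = trans (finToFun-funToFin bits (combine u v)) (cong entry (remQuot-combine u v))

  to : ∀ u v → Adj G u v → Adj (decode {n} (funToFin bits)) u v
  to u v uv = (λ u≡v → Graph.Adj-irrefl G u≡v uv)
    , trans (bits≡ u v) (bit-1 (Adj? G u v) uv)
    , trans (bits≡ v u) (bit-1 (Adj? G v u) (Graph.Adj-sym G uv))

  from : ∀ u v → Adj (decode {n} (funToFin bits)) u v → Adj G u v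
  from u v (_ , uv , _) = bit-1⁻ (Adj? G u v) (trans (sym (bits≡ u v)) uv)

ex-upper : ∀ {m n} (F : Graph m) (G : Graph n) → ¬ F ⊑ G → ∣E G ∣ ℕ.≤ ex n F
ex-upper {n = n} F G F⋢G with decode-surjective G
... | c , to , from = subst (ℕ._≤ ex n F) (sym ∣E∣≡) (lookup (xs≤max 0 _) member)
  where
  ∣E∣≡ : ∣E G ∣ ≡ ∣E decode {n} c ∣
  ∣E∣≡ = cong length $ filter-≐ (Edge? G) (Edge? (decode {n} c))
    ((λ (u<v , uv) → u<v , to _ _ uv) , (λ (u<v , uv) → u<v , from _ _ uv))
    (cartesianProduct (allFin n) (allFin n))

  free : ¬ F ⊑ decode {n} c
  free (f , inj , hom) = F⋢G (f , inj , λ u v uv → from _ _ (hom u v uv))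

  member : ∣E decode {n} c ∣ ∈ map ∣E_∣ (freeGraphs n F)
  member = ∈-map⁺ ∣E_∣ (∈-filter⁺ (λ H → ¬? (F ⊑? H)) (∈-map⁺ (decode {n}) (∈-allFin c)) free)

ex-attained : ∀ {m n} (F : Graph m) (H : Graph n) → ¬ F ⊑ H →
              Σ[ G ∈ Graph n ] (¬ F ⊑ G × ∣E G ∣ ≡ ex n F)
ex-attained {n = n} F H F⋢H
  with argmax-sel (λ x → x) 0 (map ∣E_∣ (freeGraphs n F))
... | inj₁ ex≡0 = H , F⋢H
    , ℕ.≤-antisym (ex-upper F H F⋢H) (subst (ℕ._≤ ∣E H ∣) (sym ex≡0) z≤n)
... | inj₂ ex∈ with ∈-map⁻ ∣E_∣ ex∈
... | G , G∈ , ex≡ = G , proj₂ (∈-filter⁻ (λ K → ¬? (F ⊑? K)) {xs = allGraphs n} G∈) , sym ex≡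

------------------------------------------------------------------------
-- The quadrangulated torus

-- The cyclic successor on Fin n.
next : ∀ {n} → Fin n → Fin n
next {n} i = _mod_ (ℕ.suc (toℕ i)) n {{Fin.nonZeroIndex i}}

x : ∀ {k ℓ} → Fin k → Fin ℓ → Fin (k ℕ.* ℓ)
x = combine

-- Indices start from 0 here, so the first coordinate in the usual numbering from 1 is
-- suc (toℕ i), and it is the parity of that number which matters.
TorusEdge : ∀ k ℓ → Rel (Fin (k ℕ.* ℓ)) 0ℓ
TorusEdge k ℓ u v = ∃₂ λ (i : Fin k) (j : Fin ℓ) →
    (u ≡ x i j × v ≡ x (next i) j)
  ⊎ (2 ∤ ℕ.suc (toℕ i) × u ≡ x i (next j) × v ≡ x (next i) j)
  ⊎ (2 ∣ ℕ.suc (toℕ i) × u ≡ x i j × v ≡ x (next i) (next j))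

TorusEdge? : ∀ k ℓ → Decidable (TorusEdge k ℓ)
TorusEdge? k ℓ u v = any? λ i → any? λ j →
        ((u ≟ᶠ x i j) ×-dec (v ≟ᶠ x (next i) j))
  ⊎-dec (¬? (2 ∣? ℕ.suc (toℕ i)) ×-dec (u ≟ᶠ x i (next j)) ×-dec (v ≟ᶠ x (next i) j))
  ⊎-dec ((2 ∣? ℕ.suc (toℕ i)) ×-dec (u ≟ᶠ x i j) ×-dec (v ≟ᶠ x (next i) (next j)))

next-≢ : ∀ {n} → 2 ℕ.≤ n → (i : Fin n) → i ≢ next i
next-≢ {n} 2≤n i i≡next with ℕ.m≤n⇒m<n∨m≡n (toℕ<n i)
... | inj₁ 1+i<n = ℕ.1+n≢n (sym (trans toℕ≡ (m<n⇒m%n≡m 1+i<n)))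
  where
  instance _ = Fin.nonZeroIndex i
  toℕ≡ : toℕ i ≡ ℕ.suc (toℕ i) % n
  toℕ≡ = trans (cong toℕ i≡next) (toℕ-fromℕ< (m%n<n (ℕ.suc (toℕ i)) n))
... | inj₂ 1+i≡n = ℕ.<⇒≱ 2≤n (ℕ.≤-reflexive (trans (sym 1+i≡n) (cong ℕ.suc toℕ≡0)))
  where
  instance _ = Fin.nonZeroIndex i
  toℕ≡0 : toℕ i ≡ 0
  toℕ≡0 = trans (cong toℕ i≡next) (trans (toℕ-fromℕ< (m%n<n (ℕ.suc (toℕ i)) n))
            (trans (cong (_% n) 1+i≡n) (n%n≡0 n)))

-- The assumption on k is used only to see that there are no loops.
torus : ∀ k ℓ → 4 ℕ.≤ k → Graph (k ℕ.* ℓ)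
torus k ℓ 4≤k = record
  { Adj        = λ u v → TorusEdge k ℓ u v ⊎ TorusEdge k ℓ v u
  ; Adj?       = λ u v → TorusEdge? k ℓ u v ⊎-dec TorusEdge? k ℓ v u
  ; Adj-sym    = swap
  ; Adj-irrefl = λ { refl (inj₁ e) → loopless e ; refl (inj₂ e) → loopless e }
  }
  where
  apart : ∀ {u} (i : Fin k) (j j′ : Fin ℓ) → u ≡ x i j → ¬ u ≡ x (next i) j′
  apart i j j′ refl eq =
    next-≢ (ℕ.≤-trans (s≤s (s≤s z≤n)) 4≤k) i (combine-injectiveˡ i j (next i) j′ eq)

  loopless : ∀ {u} → ¬ TorusEdge k ℓ u u
  loopless (i , j , inj₁ (p , q))            = apart i j j p q
  loopless (i , j , inj₂ (inj₁ (_ , p , q))) = apart i (next j) j p q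
  loopless (i , j , inj₂ (inj₂ (_ , p , q))) = apart i j (next j) p q

------------------------------------------------------------------------
-- Nonnegative real numbers

-- A real r ≥ 0 is given by a set of rationals ≥ r whose infimum is r.
-- (The infimum need not be a member, even when it is rational.)
Real : Set₁
Real = Pred ℚᵘ 0ℓ

infix  4 _≼_
infixl 7 _·_

_≼_ : ℚᵘ → Real → Set
q ≼ r = ∀ p → r p → q ℚᵘ.≤ p

-- The infimum of the products of the upper bounds of r and s is r · s,
-- since both are nonnegative.
_·_ : Real → Real → Real
(r · s) p = ∃₂ λ a b → r a × s b × a ℚᵘ.* b ℚᵘ.≤ p

-- This is c for c ≥ 0.
⟦_⟧ : ℚᵘ → Real
⟦ c ⟧ p = 0ℚᵘ ℚᵘ.≤ p × c ℚᵘ.≤ p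

fromℕ : ℕ → ℚᵘ
fromℕ n = ℤ.+ n ℚᵘ./ 1

-- n ^ e for n ≥ 1: if e = a / b, then n ^ e ≤ p iff n ^ a ≤ p ^ b for p ≥ 0.
pow : ℕ → ℚᵘ → Real
pow n e p = 0ℚᵘ ℚᵘ.≤ p × bound (↥ e)
  where
  bound : ℤ.ℤ → Set
  bound (ℤ.+ a)      = fromℕ (n ℕ.^ a) ℚᵘ.≤ p Power.^ (↧ₙ e)
  bound (ℤ.-[1+ a ]) = fromℕ 1 ℚᵘ.≤ fromℕ (n ℕ.^ ℕ.suc a) ℚᵘ.* p Power.^ (↧ₙ e)

-- The base 2 logarithm of n ≥ 1: log n ≤ a / b iff n ^ b ≤ 2 ^ a.
log : ℕ → Real
log n p = 0ℚᵘ ℚᵘ.≤ p × n ℕ.^ ↧ₙ p ℕ.≤ 2 ℕ.^ ℤ.∣ ↥ p ∣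

{-# OPTIONS --safe #-}

-- Let A be the edges of a bipartite subgraph with at least a quarter of the e edges of G. Call two
-- ℓ-tuples p, q of vertices on opposite sides adjacent if p₀ q₀ p₁ q₁ … is a closed walk of G. A torus
-- is a closed walk of length k = 2 m in this auxiliary graph whose tuples have distinct entries
-- altogether. Keep only the tuples in which any two cyclically consecutive entries have codegree at
-- least K, for some K of order e² / n³, and let the walk choose a uniformly random neighbour in the
-- auxiliary graph in every step. Let T j be the total return probability after 2 j steps.
--
-- Few closed walks of length 2 ℓ in G use two consecutive vertices of one side with codegree below K:
-- bounding this one entry of the codegree matrix by K opens the walk up, and the opened walks number
-- at most n³ / e² times the closed ones.
-- Testing with the degrees, T m ≥ 4 ^ - m. Conversely, the next tuple has a given entry in a given
-- place with probability at most 1 / K, because the remaining entries are independent. Writing the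
-- weight of the closed walks in which two given entries coincide as an inner product, the
-- Cauchy–Schwarz inequality shows that it is log-convex in the distance of these entries, hence
-- largest for tuples at distance 2, where it is at most T (m - 1) / K. So if there is no torus, then
-- K T m ≤ c T (m - 1). Since T is log-convex, T (m - 1) ^ m ≤ T 0 * T m ^ (m - 1), and it follows
-- that K ^ m ≤ (4 c) ^ m * T 0, where T 0 counts the tuples, which are 2 n ^ ℓ in number.
module Submission where

-- The degree of a tuple in the auxiliary graph is the product of the codegrees of its cyclically
-- consecutive entries. A uniform step therefore chooses the entries of the next tuple
-- independently, each from one common neighbourhood. Given the threshold, prescribing an entry
-- costs a factor K, however irregular the degrees of G are. Everything stays in the natural
-- numbers: a transition probability becomes `a` times a vertex weight `w`, which is `L` divided by
-- the degree on tuples that pass the threshold and 0 on the others. With R = n ! and L = R ^ ℓ the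
-- division is exact, and the return weight after 2 j steps carries the factor (L * L) ^ j. The
-- obstacle is that entries may coincide at every even distance, whereas the factor K can be gained
-- directly only when one arc between them has length 2, both tuples then being random steps from
-- the same tuple. Log-convexity carries the gain over to the other distances. As K is of order e² /
-- n³ and k = 2 m, the final inequality K ^ m ≤ C n ^ ℓ says that e ^ (2 m) is at most a constant
-- times n ^ (3 m + ℓ), which is the exponent 3 / 2 + ℓ / k.

module Combinatorics where

  open import Defs
    using (Graph; module Graph; Adj; Adj?; Edge; Edge?; ∣E_∣; _⊑_; _⊑?_; allGraphs; freeGraphs; ex;
      next; TorusEdge; torus)
  open import Data.Bool.Base using (Bool; false; if_then_else_; not; true)
  open import Data.Bool.Properties using (not-involutive)
    renaming (_≟_ to _≟ᵇ_)
  open import Data.Fin.Base using (Fin; combine; fromℕ; inject₁; remQuot; suc; toℕ; zero)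
  open import Data.Fin.Induction using (<-weakInduction)
  open import Data.Fin.Permutation using (Permutation′; permutation)
  open import Data.Fin.Properties
    using (combine-remQuot; remQuot-combine; toℕ-fromℕ; toℕ-fromℕ<; toℕ-injective; toℕ-inject₁;
      toℕ<n)
    renaming (_≟_ to _≟ᶠ_)
  open import Data.Fin.Relation.Unary.Top using (view; ‵fromℕ; ‵inject₁)
  open import Data.List.Base
    using (List; []; _++_; _∷_; allFin; cartesianProduct; cartesianProductWith; filter; length;
      map; tabulate)
  open import Data.List.Extrema.Nat using (argmax-sel)
  open import Data.List.Membership.Propositional using (_∈_)
  open import Data.List.Membership.Propositional.Properties
    using (∈-allFin; ∈-cartesianProductWith⁺; ∈-cartesianProduct⁺; ∈-filter⁻; ∈-map⁻)
  open import Data.List.Relation.Unary.Any using (here; there)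
  open import Data.Nat.Base
    using (>-nonZero; >-nonZero⁻¹; NonZero; _!; _*_; _+_; _<_; _^_; _≤_; suc; s≤s; zero; z≤n; ℕ)
  open import Data.Nat.DivMod using (_%_; _/_; m%n<n; m/n*n≤m; m<n⇒m%n≡m; m≡m%n+[m/n]*n; n%n≡0)
  open import Data.Nat.Divisibility
    using (_∣_; _∤_; divides; m∣m*n; m≤n⇒m!∣n!; ∣-trans; ∣1⇒≡1; ∣m+n∣m⇒∣n)
  open import Data.Nat.Properties
  open import Data.Nat.Tactic.RingSolver using (solve-∀)
  open import Data.Product.Base using (_,_; _×_; proj₁; proj₂; ∃; Σ-syntax)
  open import Data.Sum.Base using (inj₁; inj₂)
  open import Data.Vec.Base using (Vec; []; _∷_; _∷ʳ_; lookup)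
  open import Function.Base using (_∘_; id)
  open import Function.Definitions using (Injective)
  open import Relation.Binary.Definitions using (tri<; tri>; tri≈)
  open import Relation.Binary.PropositionalEquality
  open import Relation.Nullary using (Dec; _×-dec_; contradiction; does; no; yes; ¬?; ¬_)
  open import Algebra.Properties.CommutativeMonoid.Sum *-1-commutativeMonoid using ()
    renaming (sum to ∏; sum-cong-≗ to ∏-cong; sum-permute to ∏-permute; ∑-distrib-+ to ∏-*)
  open import Algebra.Properties.CommutativeSemigroup *-commutativeSemigroup using (x∙yz≈y∙xz)

  private
    variable
      A B C : Set

  -- Log-convex sequences

  ^-*-distrib : ∀ x y j → (x * y) ^ j ≡ x ^ j * y ^ j
  ^-*-distrib x y zero    = refl
  ^-*-distrib x y (suc j) = trans (cong (x * y *_) (^-*-distrib x y j)) (interchange x y (x ^ j) (y ^ j))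
    where
    interchange : ∀ a b c d → a * b * (c * d) ≡ a * c * (b * d)
    interchange = solve-∀

  square-cancel-≤ : ∀ {x y} → x * x ≤ y * y → x ≤ y
  square-cancel-≤ {x} {y} xx≤yy with ≤-<-connex x y
  ... | inj₁ x≤y = x≤y
  ... | inj₂ y<x = contradiction xx≤yy (<⇒≱ (*-mono-< y<x y<x))

  -- For y > 0 multiply by y and use c * y * y ≤ c * x * z ≤ d * y * z. A lower bound on one
  -- quotient of a log-convex sequence is thereby passed on to the next quotient.
  ratio-step : ∀ c d x y z → c * x ≤ d * y → y * y ≤ x * z → c * y ≤ d * z
  ratio-step c d x zero    z _ _ = subst (_≤ d * z) (sym (*-zeroʳ c)) z≤n
  ratio-step c d x y@(suc _) z cx≤dy yy≤xz = *-cancelʳ-≤ (c * y) (d * z) y (begin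
    c * y * y    ≡⟨ *-assoc c y y ⟩
    c * (y * y)  ≤⟨ *-monoʳ-≤ c yy≤xz ⟩
    c * (x * z)  ≡⟨ *-assoc c x z ⟨
    c * x * z    ≤⟨ *-monoˡ-≤ z cx≤dy ⟩
    d * y * z    ≡⟨ swap d y z ⟩
    d * z * y    ∎)
    where
    open ≤-Reasoning
    swap : ∀ a b c → a * b * c ≡ a * c * b
    swap = solve-∀

  module LogConvex (s : ℕ → ℕ) (convex : ∀ j → s (suc j) * s (suc j) ≤ s j * s (suc (suc j))) where

    open ≤-Reasoning

    ratio-increasing : ∀ c d → c * s 0 ≤ d * s 1 → ∀ j → c * s j ≤ d * s (suc j)
    ratio-increasing c d base zero    = base
    ratio-increasing c d base (suc j) =
      ratio-step c d (s j) (s (suc j)) (s (suc (suc j))) (ratio-increasing c d base j) (convex j)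

    growth : ∀ c d → c * s 0 ≤ d * s 1 → ∀ j → c ^ j * s 0 ≤ d ^ j * s j
    growth c d base zero    = ≤-refl
    growth c d base (suc j) = begin
      c * c ^ j * s 0        ≡⟨ *-assoc c (c ^ j) (s 0) ⟩
      c * (c ^ j * s 0)      ≤⟨ *-monoʳ-≤ c (growth c d base j) ⟩
      c * (d ^ j * s j)      ≡⟨ swap c (d ^ j) (s j) ⟩
      d ^ j * (c * s j)      ≤⟨ *-monoʳ-≤ (d ^ j) (ratio-increasing c d base j) ⟩
      d ^ j * (d * s (suc j)) ≡⟨ assoc′ (d ^ j) d (s (suc j)) ⟩
      d * d ^ j * s (suc j)  ∎
      where
      swap : ∀ a b c → a * (b * c) ≡ b * (a * c)
      swap = solve-∀
      assoc′ : ∀ a b c → a * (b * c) ≡ b * a * c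
      assoc′ = solve-∀

    -- Interpolation between 0 and j + 1, with the roots cleared. Convexity raised to the power j +
    -- 1, combined with the induction hypothesis, leaves a surplus factor `t ^ j` on both sides,
    -- which cancels for t > 0.
    chord : ∀ j → s j ^ suc j ≤ s 0 * s (suc j) ^ j
    chord zero    = ≤-refl
    chord (suc j) = go (s (suc j)) (convex j) (chord j)
      where
      go : ∀ t → t * t ≤ s j * s (suc (suc j)) → s j ^ suc j ≤ s 0 * t ^ j →
           t ^ suc (suc j) ≤ s 0 * s (suc (suc j)) ^ suc j
      go zero      _  _  = z≤n
      go t@(suc _) tt ih = *-cancelˡ-≤ (t ^ j) {{m^n≢0 t j}} (begin
        t ^ j * t ^ suc (suc j)                     ≡⟨ reorder t (t ^ j) ⟩
        t * t * (t ^ j * t ^ j)                     ≡⟨ cong (t * t *_) (^-*-distrib t t j) ⟨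
        (t * t) ^ suc j                             ≤⟨ ^-monoˡ-≤ (suc j) tt ⟩
        (s j * s (suc (suc j))) ^ suc j             ≡⟨ ^-*-distrib (s j) (s (suc (suc j))) (suc j) ⟩
        s j ^ suc j * s (suc (suc j)) ^ suc j       ≤⟨ *-monoˡ-≤ _ ih ⟩
        s 0 * t ^ j * s (suc (suc j)) ^ suc j       ≡⟨ reorder′ (s 0) (t ^ j) _ ⟩
        t ^ j * (s 0 * s (suc (suc j)) ^ suc j)     ∎)
        where
        reorder : ∀ t p → p * (t * (t * p)) ≡ t * t * (p * p)
        reorder = solve-∀
        reorder′ : ∀ a b c → a * b * c ≡ b * (a * c)
        reorder′ = solve-∀

  -- A log-convex sequence on an antidiagonal is bounded by its values at the ends.
  module Antidiagonal (Γ : ℕ → ℕ → ℕ)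
    (convex : ∀ a b → Γ (suc a) (suc b) * Γ (suc a) (suc b) ≤ Γ a (suc (suc b)) * Γ (suc (suc a)) b) where

    -- One weak ascent forces all further ones by `ratio-step` with both factors 1, so the values
    -- keep growing until the second index is 0.
    climb : ∀ b a → Γ a (suc b) ≤ Γ (suc a) b → Γ (suc a) b ≤ Γ (suc a + b) 0
    climb zero    a _  = ≤-reflexive (cong (λ t → Γ (suc t) 0) (sym (+-identityʳ a)))
    climb (suc b) a up = ≤-trans step
      (≤-trans (climb b (suc a) step) (≤-reflexive (cong (λ t → Γ (suc t) 0) (sym (+-suc a b)))))
      where
      step : Γ (suc a) (suc b) ≤ Γ (suc (suc a)) b
      step = subst₂ _≤_ (*-identityˡ _) (*-identityˡ _)
        (ratio-step 1 1 (Γ a (suc (suc b))) (Γ (suc a) (suc b)) (Γ (suc (suc a)) b)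
          (subst₂ _≤_ (sym (*-identityˡ _)) (sym (*-identityˡ _)) up) (convex a b))

    bounded : ∀ {B} a b → Γ 0 (a + b) ≤ B → Γ (a + b) 0 ≤ B → Γ a b ≤ B
    bounded zero    b left right = left
    bounded {B} (suc a) b left right with ≤-total (Γ a (suc b)) (Γ (suc a) b)
    ... | inj₁ up   = ≤-trans (climb b a up) right
    ... | inj₂ down = ≤-trans down (bounded a (suc b)
          (subst (λ t → Γ 0 t ≤ B) (sym (+-suc a b)) left)
          (subst (λ t → Γ t 0 ≤ B) (sym (+-suc a b)) right))

  -- Finite sums

  ∑ : List A → (A → ℕ) → ℕ
  ∑ []       f = 0
  ∑ (x ∷ xs) f = f x + ∑ xs f

  ∑-cong : (xs : List A) {f g : A → ℕ} → (∀ x → f x ≡ g x) → ∑ xs f ≡ ∑ xs g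
  ∑-cong []       f≗g = refl
  ∑-cong (x ∷ xs) f≗g = cong₂ _+_ (f≗g x) (∑-cong xs f≗g)

  ∑-mono : (xs : List A) {f g : A → ℕ} → (∀ x → f x ≤ g x) → ∑ xs f ≤ ∑ xs g
  ∑-mono []       f≤g = z≤n
  ∑-mono (x ∷ xs) f≤g = +-mono-≤ (f≤g x) (∑-mono xs f≤g)

  ∑-zero : (xs : List A) → ∑ xs (λ _ → 0) ≡ 0
  ∑-zero []       = refl
  ∑-zero (x ∷ xs) = ∑-zero xs

  ∑-const : (xs : List A) (c : ℕ) → ∑ xs (λ _ → c) ≡ length xs * c
  ∑-const []       c = refl
  ∑-const (x ∷ xs) c = cong (c +_) (∑-const xs c)

  ∑-one : (xs : List A) → ∑ xs (λ _ → 1) ≡ length xs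
  ∑-one xs = trans (∑-const xs 1) (*-identityʳ (length xs))

  ∑-+ : (xs : List A) (f g : A → ℕ) → ∑ xs (λ x → f x + g x) ≡ ∑ xs f + ∑ xs g
  ∑-+ []       f g = refl
  ∑-+ (x ∷ xs) f g =
    trans (cong (f x + g x +_) (∑-+ xs f g)) (interchange (f x) (g x) (∑ xs f) (∑ xs g))
    where
    interchange : ∀ a b c d → a + b + (c + d) ≡ a + c + (b + d)
    interchange = solve-∀

  ∑-*ˡ : (xs : List A) (c : ℕ) (f : A → ℕ) → ∑ xs (λ x → c * f x) ≡ c * ∑ xs f
  ∑-*ˡ []       c f = sym (*-zeroʳ c)
  ∑-*ˡ (x ∷ xs) c f =
    trans (cong (c * f x +_) (∑-*ˡ xs c f)) (sym (*-distribˡ-+ c (f x) (∑ xs f)))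

  ∑-*ʳ : (xs : List A) (c : ℕ) (f : A → ℕ) → ∑ xs (λ x → f x * c) ≡ ∑ xs f * c
  ∑-*ʳ xs c f =
    trans (∑-cong xs (λ x → *-comm (f x) c)) (trans (∑-*ˡ xs c f) (*-comm c (∑ xs f)))

  ∑-swap : (xs : List A) (ys : List B) (f : A → B → ℕ) →
           ∑ xs (λ x → ∑ ys (λ y → f x y)) ≡ ∑ ys (λ y → ∑ xs (λ x → f x y))
  ∑-swap []       ys f = sym (∑-zero ys)
  ∑-swap (x ∷ xs) ys f =
    trans (cong (∑ ys (f x) +_) (∑-swap xs ys f)) (sym (∑-+ ys (f x) (λ y → ∑ xs (λ x′ → f x′ y))))

  ∑-++ : (xs ys : List A) (f : A → ℕ) → ∑ (xs ++ ys) f ≡ ∑ xs f + ∑ ys f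
  ∑-++ []       ys f = refl
  ∑-++ (x ∷ xs) ys f = trans (cong (f x +_) (∑-++ xs ys f)) (sym (+-assoc (f x) (∑ xs f) (∑ ys f)))

  ∑-map : (h : A → B) (xs : List A) (f : B → ℕ) → ∑ (map h xs) f ≡ ∑ xs (f ∘ h)
  ∑-map h []       f = refl
  ∑-map h (x ∷ xs) f = cong (f (h x) +_) (∑-map h xs f)

  ∑-cartesianProductWith : (h : A → B → C) (xs : List A) (ys : List B) (f : C → ℕ) →
                           ∑ (cartesianProductWith h xs ys) f ≡ ∑ xs (λ x → ∑ ys (λ y → f (h x y)))
  ∑-cartesianProductWith h []       ys f = refl
  ∑-cartesianProductWith h (x ∷ xs) ys f =
    trans (∑-++ (map (h x) ys) (cartesianProductWith h xs ys) f)
          (cong₂ _+_ (∑-map (h x) ys f) (∑-cartesianProductWith h xs ys f))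

  ∑-product : (xs : List A) (ys : List B) (f : A → B → ℕ) →
              ∑ (cartesianProduct xs ys) (λ (x , y) → f x y) ≡ ∑ xs (λ x → ∑ ys (f x))
  ∑-product xs ys f = ∑-cartesianProductWith _,_ xs ys (λ (x , y) → f x y)

  term≤∑ : {xs : List A} {x : A} → x ∈ xs → (f : A → ℕ) → f x ≤ ∑ xs f
  term≤∑ {xs = y ∷ xs} (here refl) f = m≤m+n (f y) (∑ xs f)
  term≤∑ {xs = y ∷ xs} (there x∈)  f = ≤-trans (term≤∑ x∈ f) (m≤n+m (∑ xs f) (f y))

  ∑≡0 : {xs : List A} (f : A → ℕ) → ∑ xs f ≡ 0 → ∀ {x} → x ∈ xs → f x ≡ 0
  ∑≡0 f eq x∈ = n≤0⇒n≡0 (≤-trans (term≤∑ x∈ f) (≤-reflexive eq))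

  ∑-*-∑ : (xs : List A) (ys : List B) (f : A → ℕ) (g : B → ℕ) →
          ∑ xs f * ∑ ys g ≡ ∑ xs (λ x → ∑ ys (λ y → f x * g y))
  ∑-*-∑ xs ys f g = trans (sym (∑-*ʳ xs (∑ ys g) f)) (∑-cong xs (λ x → sym (∑-*ˡ ys (f x) g)))

  ∑² : (xs : List A) (ys : List B) {f g : A → B → ℕ} → (∀ x y → f x y ≡ g x y) →
       ∑ xs (λ x → ∑ ys (f x)) ≡ ∑ xs (λ x → ∑ ys (g x))
  ∑² xs ys f≗g = ∑-cong xs λ x → ∑-cong ys (f≗g x)

  2xy≤x²+y² : ∀ x y → 2 * (x * y) ≤ x * x + y * y
  2xy≤x²+y² x y with ≤-total x y
  ... | inj₁ x≤y with m≤n⇒∃[o]m+o≡n x≤y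
  ...   | d , refl = ≤-trans (m≤m+n _ (d * d)) (≤-reflexive (expand x d))
    where
    expand : ∀ x d → 2 * (x * (x + d)) + d * d ≡ x * x + (x + d) * (x + d)
    expand = solve-∀
  2xy≤x²+y² x y | inj₂ y≤x with m≤n⇒∃[o]m+o≡n y≤x
  ...   | d , refl = ≤-trans (m≤m+n _ (d * d)) (≤-reflexive (expand y d))
    where
    expand : ∀ y d → 2 * ((y + d) * y) + d * d ≡ (y + d) * (y + d) + y * y
    expand = solve-∀

  -- Doubling and expanding over pairs x, y reduces it to 2 s t ≤ s² + t² with s = f x * g y and t =
  -- f y * g x, so that no subtraction occurs.
  cauchy-schwarz : (xs : List A) (w f g : A → ℕ) →
    ∑ xs (λ x → w x * (f x * g x)) * ∑ xs (λ x → w x * (f x * g x))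
      ≤ ∑ xs (λ x → w x * (f x * f x)) * ∑ xs (λ x → w x * (g x * g x))
  cauchy-schwarz xs w f g = *-cancelˡ-≤ 2 (begin
    2 * (∑ xs fg * ∑ xs fg)
      ≡⟨ cong (2 *_) (∑-*-∑ xs xs fg fg) ⟩
    2 * ∑ xs (λ x → ∑ xs (λ y → fg x * fg y))
      ≡⟨ double (λ x y → fg x * fg y) ⟨
    ∑ xs (λ x → ∑ xs (λ y → 2 * (fg x * fg y)))
      ≤⟨ ∑-mono xs (λ x → ∑-mono xs (λ y → pointwise x y)) ⟩
    ∑ xs (λ x → ∑ xs (λ y → ff x * gg y + ff y * gg x))
      ≡⟨ ∑-cong xs (λ x → ∑-+ xs (λ y → ff x * gg y) (λ y → ff y * gg x)) ⟩
    ∑ xs (λ x → ∑ xs (λ y → ff x * gg y) + ∑ xs (λ y → ff y * gg x))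
      ≡⟨ ∑-+ xs (λ x → ∑ xs (λ y → ff x * gg y)) (λ x → ∑ xs (λ y → ff y * gg x)) ⟩
    ∑ xs (λ x → ∑ xs (λ y → ff x * gg y)) + ∑ xs (λ x → ∑ xs (λ y → ff y * gg x))
      ≡⟨ cong₂ _+_ (∑-*-∑ xs xs ff gg)
           (trans (∑-*-∑ xs xs ff gg) (∑-swap xs xs (λ y x → ff y * gg x))) ⟨
    ∑ xs ff * ∑ xs gg + ∑ xs ff * ∑ xs gg
      ≡⟨ cong (∑ xs ff * ∑ xs gg +_) (+-identityʳ _) ⟨
    2 * (∑ xs ff * ∑ xs gg) ∎)
    where
    open ≤-Reasoning

    fg = λ x → w x * (f x * g x)
    ff = λ x → w x * (f x * f x)
    gg = λ x → w x * (g x * g x)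

    double : (h : _ → _ → ℕ) → ∑ xs (λ x → ∑ xs (λ y → 2 * h x y)) ≡ 2 * ∑ xs (λ x → ∑ xs (h x))
    double h = trans (∑-cong xs (λ x → ∑-*ˡ xs 2 (h x))) (∑-*ˡ xs 2 (λ x → ∑ xs (h x)))

    lhs : ∀ u v a b c d → 2 * ((u * (a * b)) * (v * (c * d))) ≡ u * v * (2 * ((a * d) * (c * b)))
    lhs = solve-∀

    rhs : ∀ u v a b c d → u * v * ((a * d) * (a * d) + (c * b) * (c * b))
                          ≡ u * (a * a) * (v * (d * d)) + v * (c * c) * (u * (b * b))
    rhs = solve-∀

    pointwise : ∀ x y → 2 * (fg x * fg y) ≤ ff x * gg y + ff y * gg x
    pointwise x y = subst₂ _≤_
      (sym (lhs (w x) (w y) (f x) (g x) (f y) (g y)))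
      (rhs (w x) (w y) (f x) (g x) (f y) (g y))
      (*-monoʳ-≤ (w x * w y) (2xy≤x²+y² (f x * g y) (f y * g x)))

  -- Indicators

  ⟪_⟫ : {P : Set} → Dec P → ℕ
  ⟪ P? ⟫ = if does P? then 1 else 0

  ⟪⟫-yes : {P : Set} (P? : Dec P) → P → ⟪ P? ⟫ ≡ 1
  ⟪⟫-yes (yes _) p = refl
  ⟪⟫-yes (no ¬p) p = contradiction p ¬p

  ⟪⟫-no : {P : Set} (P? : Dec P) → ¬ P → ⟪ P? ⟫ ≡ 0
  ⟪⟫-no (yes p) ¬p = contradiction p ¬p
  ⟪⟫-no (no _)  ¬p = refl

  ⟪⟫-positive : {P : Set} (P? : Dec P) → 0 < ⟪ P? ⟫ → P
  ⟪⟫-positive (yes p) _ = p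

  ⟪⟫≤1 : {P : Set} (P? : Dec P) → ⟪ P? ⟫ ≤ 1
  ⟪⟫≤1 (yes _) = ≤-refl
  ⟪⟫≤1 (no _)  = z≤n

  ∑-tabulate : ∀ {n} (g : Fin n → A) (f : A → ℕ) → ∑ (tabulate g) f ≡ ∑ (allFin n) (f ∘ g)
  ∑-tabulate {n = zero}  g f = refl
  ∑-tabulate {n = suc n} g f =
    cong (f (g zero) +_) (trans (∑-tabulate (g ∘ suc) f) (sym (∑-tabulate suc (f ∘ g))))

  ∑-allFin-suc : ∀ {n} (f : Fin (suc n) → ℕ) → ∑ (allFin (suc n)) f ≡ f zero + ∑ (allFin n) (f ∘ suc)
  ∑-allFin-suc f = cong (f zero +_) (∑-tabulate suc f)

  ∑-pick : ∀ {n} (x : Fin n) (f : Fin n → ℕ) → ∑ (allFin n) (λ c → ⟪ x ≟ᶠ c ⟫ * f c) ≡ f x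
  ∑-pick {suc n} zero    f = begin
    f zero + 0 + ∑ (tabulate suc) (λ c → ⟪ zero ≟ᶠ c ⟫ * f c)
      ≡⟨ cong₂ _+_ (+-identityʳ (f zero)) (∑-tabulate {n = n} suc (λ c → ⟪ zero ≟ᶠ c ⟫ * f c)) ⟩
    f zero + ∑ (allFin n) (λ _ → 0)
      ≡⟨ cong (f zero +_) (∑-zero (allFin n)) ⟩
    f zero + 0
      ≡⟨ +-identityʳ (f zero) ⟩
    f zero ∎
    where open ≡-Reasoning
  ∑-pick {suc n} (suc x) f = trans (∑-tabulate {n = n} suc (λ c → ⟪ suc x ≟ᶠ c ⟫ * f c)) (∑-pick x (f ∘ suc))

  -- Finite products

  ∏-mono : ∀ {n} {f g : Fin n → ℕ} → (∀ i → f i ≤ g i) → ∏ f ≤ ∏ g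
  ∏-mono {zero}  f≤g = ≤-refl
  ∏-mono {suc n} f≤g = *-mono-≤ (f≤g zero) (∏-mono (f≤g ∘ suc))

  ∏-const : ∀ n (c : ℕ) → ∏ {n} (λ _ → c) ≡ c ^ n
  ∏-const zero    c = refl
  ∏-const (suc n) c = cong (c *_) (∏-const n c)

  *-positive : ∀ x y → 0 < x * y → 0 < x × 0 < y
  *-positive (suc x) (suc y) _    = s≤s z≤n , s≤s z≤n
  *-positive (suc x) zero    0<xy = contradiction (subst (0 <_) (*-zeroʳ x) 0<xy) λ ()

  ∏-positive : ∀ {n} (f : Fin n → ℕ) → 0 < ∏ f → ∀ i → 0 < f i
  ∏-positive {suc n} f 0<∏ zero    = proj₁ (*-positive (f zero) (∏ (f ∘ suc)) 0<∏)
  ∏-positive {suc n} f 0<∏ (suc i) =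
    ∏-positive (f ∘ suc) (proj₂ (*-positive (f zero) (∏ (f ∘ suc)) 0<∏)) i

  ∏-single : ∀ {n} (r : ℕ) (t : Fin n → ℕ) → (∀ j → t j ≤ r) → ∀ i → r * ∏ t ≤ t i * r ^ n
  ∏-single {suc n} r t t≤r zero = begin
    r * (t zero * ∏ (t ∘ suc))    ≡⟨ x∙yz≈y∙xz r (t zero) _ ⟩
    t zero * (r * ∏ (t ∘ suc))
      ≤⟨ *-monoʳ-≤ (t zero) (*-monoʳ-≤ r (∏-mono (t≤r ∘ suc))) ⟩
    t zero * (r * ∏ {n} (λ _ → r))  ≡⟨ cong (λ p → t zero * (r * p)) (∏-const n r) ⟩
    t zero * (r * r ^ n)          ∎
    where open ≤-Reasoning
  ∏-single {suc n} r t t≤r (suc i) = begin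
    r * (t zero * ∏ (t ∘ suc))    ≡⟨ x∙yz≈y∙xz r (t zero) _ ⟩
    t zero * (r * ∏ (t ∘ suc))
      ≤⟨ *-mono-≤ (t≤r zero) (∏-single r (t ∘ suc) (t≤r ∘ suc) i) ⟩
    r * (t (suc i) * r ^ n)       ≡⟨ x∙yz≈y∙xz r (t (suc i)) (r ^ n) ⟩
    t (suc i) * (r * r ^ n)       ∎
    where open ≤-Reasoning

  ∏-gain : ∀ {n} (c r : ℕ) (t : Fin n → ℕ) → (∀ j → t j ≤ r) →
           ∀ i → c * t i ≤ r → c * ∏ t ≤ r ^ n
  ∏-gain {suc n} c r t t≤r zero    ct≤r = begin
    c * (t zero * ∏ (t ∘ suc))  ≡⟨ *-assoc c (t zero) _ ⟨
    c * t zero * ∏ (t ∘ suc)    ≤⟨ *-mono-≤ ct≤r (∏-mono (t≤r ∘ suc)) ⟩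
    r * ∏ {n} (λ _ → r)         ≡⟨ cong (r *_) (∏-const n r) ⟩
    r * r ^ n                   ∎
    where open ≤-Reasoning
  ∏-gain {suc n} c r t t≤r (suc i) ct≤r = begin
    c * (t zero * ∏ (t ∘ suc))    ≡⟨ x∙yz≈y∙xz c (t zero) _ ⟩
    t zero * (c * ∏ (t ∘ suc))    ≤⟨ *-mono-≤ (t≤r zero) (∏-gain c r (t ∘ suc) (t≤r ∘ suc) i ct≤r) ⟩
    r * r ^ n                     ∎
    where open ≤-Reasoning

  -- After division by c * r, the right side is t i times r / c times r ^ (n - 2). The factor at i
  -- is kept exact because it will be summed over the common value of two entries, while the gain
  -- comes from i′.
  ∏-gain₂ : ∀ {n} (c r : ℕ) (t : Fin n → ℕ) → (∀ j → t j ≤ r) →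
            ∀ i i′ → i ≢ i′ → c * t i′ ≤ r → r * (c * ∏ t) ≤ t i * r ^ n
  ∏-gain₂ {suc n} c r t t≤r zero zero i≢i′ _ = contradiction refl i≢i′
  ∏-gain₂ {suc n} c r t t≤r zero (suc i′) _ ct≤r = begin
    r * (c * (t zero * ∏ (t ∘ suc)))  ≡⟨ shuffle r c (t zero) _ ⟩
    t zero * (r * (c * ∏ (t ∘ suc)))
      ≤⟨ *-monoʳ-≤ (t zero) (*-monoʳ-≤ r (∏-gain c r (t ∘ suc) (t≤r ∘ suc) i′ ct≤r)) ⟩
    t zero * (r * r ^ n)              ∎
    where
    open ≤-Reasoning
    shuffle : ∀ r c x y → r * (c * (x * y)) ≡ x * (r * (c * y))
    shuffle = solve-∀
  ∏-gain₂ {suc n} c r t t≤r (suc i) zero _ ct≤r = begin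
    r * (c * (t zero * ∏ (t ∘ suc)))    ≡⟨ shuffle r c (t zero) _ ⟩
    c * t zero * (r * ∏ (t ∘ suc))
      ≤⟨ *-mono-≤ ct≤r (∏-single r (t ∘ suc) (t≤r ∘ suc) i) ⟩
    r * (t (suc i) * r ^ n)             ≡⟨ x∙yz≈y∙xz r (t (suc i)) (r ^ n) ⟩
    t (suc i) * (r * r ^ n)             ∎
    where
    open ≤-Reasoning
    shuffle : ∀ r c x y → r * (c * (x * y)) ≡ c * x * (r * y)
    shuffle = solve-∀
  ∏-gain₂ {suc n} c r t t≤r (suc i) (suc i′) i≢i′ ct≤r = begin
    r * (c * (t zero * ∏ (t ∘ suc)))    ≡⟨ shuffle r c (t zero) _ ⟩
    t zero * (r * (c * ∏ (t ∘ suc)))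
      ≤⟨ *-mono-≤ (t≤r zero) (∏-gain₂ c r (t ∘ suc) (t≤r ∘ suc) i i′ (i≢i′ ∘ cong suc) ct≤r) ⟩
    r * (t (suc i) * r ^ n)             ≡⟨ x∙yz≈y∙xz r (t (suc i)) (r ^ n) ⟩
    t (suc i) * (r * r ^ n)             ∎
    where
    open ≤-Reasoning
    shuffle : ∀ r c x y → r * (c * (x * y)) ≡ x * (r * (c * y))
    shuffle = solve-∀

  -- The cyclic successor and its inverse

  next-inject₁ : ∀ {n} (i : Fin n) → next (inject₁ i) ≡ suc i
  next-inject₁ {n} i = toℕ-injective (begin
    toℕ (next (inject₁ i))              ≡⟨ toℕ-fromℕ< (m%n<n (suc (toℕ (inject₁ i))) (suc n)) ⟩
    suc (toℕ (inject₁ i)) % suc n       ≡⟨ cong (λ t → suc t % suc n) (toℕ-inject₁ i) ⟩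
    suc (toℕ i) % suc n                 ≡⟨ m<n⇒m%n≡m (s≤s (toℕ<n i)) ⟩
    suc (toℕ i)                         ∎)
    where open ≡-Reasoning

  next-fromℕ : ∀ n → next (fromℕ n) ≡ zero
  next-fromℕ n = toℕ-injective (begin
    toℕ (next (fromℕ n))          ≡⟨ toℕ-fromℕ< (m%n<n (suc (toℕ (fromℕ n))) (suc n)) ⟩
    suc (toℕ (fromℕ n)) % suc n   ≡⟨ cong (λ t → suc t % suc n) (toℕ-fromℕ n) ⟩
    suc n % suc n                 ≡⟨ n%n≡0 (suc n) ⟩
    0                             ∎)
    where open ≡-Reasoning

  prev : ∀ {n} → Fin n → Fin n
  prev {suc n} zero    = fromℕ n
  prev {suc n} (suc i) = inject₁ i

  next-prev : ∀ {n} (i : Fin n) → next (prev i) ≡ i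
  next-prev {suc n} zero    = next-fromℕ n
  next-prev {suc n} (suc i) = next-inject₁ i

  prev-next : ∀ {n} (i : Fin n) → prev (next i) ≡ i
  prev-next {suc n} i with view i
  ... | ‵fromℕ     = cong prev (next-fromℕ n)
  ... | ‵inject₁ j = cong prev (next-inject₁ j)

  next-injective : ∀ {n} {i j : Fin n} → next i ≡ next j → i ≡ j
  next-injective {i = i} {j} eq = trans (sym (prev-next i)) (trans (cong prev eq) (prev-next j))

  nextᵖ : ∀ {n} → Permutation′ n
  nextᵖ = permutation next prev next-prev prev-next

  prevᵖ : ∀ {n} → Permutation′ n
  prevᵖ = permutation prev next prev-next next-prev

  -- Sums over vectors

  vecs : List A → ∀ n → List (Vec A n)
  vecs xs zero    = [] ∷ []
  vecs xs (suc n) = cartesianProductWith _∷_ xs (vecs xs n)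

  ∈-vecs : (xs : List A) → (∀ x → x ∈ xs) → ∀ {n} (v : Vec A n) → v ∈ vecs xs n
  ∈-vecs xs all []      = here refl
  ∈-vecs xs all (x ∷ v) = ∈-cartesianProductWith⁺ _∷_ (all x) (∈-vecs xs all v)

  ∑-vecs-suc : (xs : List A) (n : ℕ) (f : Vec A (suc n) → ℕ) →
               ∑ (vecs xs (suc n)) f ≡ ∑ xs (λ x → ∑ (vecs xs n) (λ v → f (x ∷ v)))
  ∑-vecs-suc xs n f = ∑-cartesianProductWith _∷_ xs (vecs xs n) f

  -- This distributive law is the source of the independence of the entries of a random tuple.
  ∑-∏ : (xs : List A) {n : ℕ} (φ : Fin n → A → ℕ) →
        ∑ (vecs xs n) (λ v → ∏ (λ j → φ j (lookup v j))) ≡ ∏ (λ j → ∑ xs (φ j))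
  ∑-∏ xs {zero}  φ = refl
  ∑-∏ xs {suc n} φ = begin
    ∑ (vecs xs (suc n)) (λ v → ∏ (λ j → φ j (lookup v j)))
      ≡⟨ ∑-vecs-suc xs n _ ⟩
    ∑ xs (λ x → ∑ (vecs xs n) (λ v → φ zero x * ∏ (λ j → φ (suc j) (lookup v j))))
      ≡⟨ ∑-cong xs (λ x → ∑-*ˡ (vecs xs n) (φ zero x) _) ⟩
    ∑ xs (λ x → φ zero x * ∑ (vecs xs n) (λ v → ∏ (λ j → φ (suc j) (lookup v j))))
      ≡⟨ ∑-cong xs (λ x → cong (φ zero x *_) (∑-∏ xs (φ ∘ suc))) ⟩
    ∑ xs (λ x → φ zero x * ∏ (λ j → ∑ xs (φ (suc j))))
      ≡⟨ ∑-*ʳ xs _ (φ zero) ⟩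
    ∑ xs (φ zero) * ∏ (λ j → ∑ xs (φ (suc j))) ∎
    where open ≡-Reasoning

  length-vecs : (xs : List A) (n : ℕ) → length (vecs xs n) ≡ length xs ^ n
  length-vecs xs n = begin
    length (vecs xs n)                               ≡⟨ *-identityʳ _ ⟨
    length (vecs xs n) * 1                           ≡⟨ ∑-const (vecs xs n) 1 ⟨
    ∑ (vecs xs n) (λ _ → 1)                          ≡⟨ ∑-cong (vecs xs n) (λ _ → trans (∏-const n 1) (^-zeroˡ n)) ⟨
    ∑ (vecs xs n) (λ v → ∏ {n} (λ _ → 1))            ≡⟨ ∑-∏ xs {n} (λ _ _ → 1) ⟩
    ∏ {n} (λ _ → ∑ xs (λ _ → 1))                     ≡⟨ ∏-const n _ ⟩
    ∑ xs (λ _ → 1) ^ n                               ≡⟨ cong (_^ n) (trans (∑-const xs 1) (*-identityʳ _)) ⟩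
    length xs ^ n                                    ∎
    where open ≡-Reasoning

  rotate : ∀ {n} → Vec A (suc n) → Vec A (suc n)
  rotate (x ∷ xs) = xs ∷ʳ x

  lookup-∷ʳ-fromℕ : ∀ {n} (xs : Vec A n) x → lookup (xs ∷ʳ x) (fromℕ n) ≡ x
  lookup-∷ʳ-fromℕ []       x = refl
  lookup-∷ʳ-fromℕ (y ∷ xs) x = lookup-∷ʳ-fromℕ xs x

  lookup-∷ʳ-inject₁ : ∀ {n} (xs : Vec A n) x i → lookup (xs ∷ʳ x) (inject₁ i) ≡ lookup xs i
  lookup-∷ʳ-inject₁ (y ∷ xs) x zero    = refl
  lookup-∷ʳ-inject₁ (y ∷ xs) x (suc i) = lookup-∷ʳ-inject₁ xs x i

  lookup-rotate : ∀ {n} (v : Vec A (suc n)) i → lookup (rotate v) i ≡ lookup v (next i)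
  lookup-rotate {n = n} (x ∷ xs) i with view i
  ... | ‵fromℕ     = trans (lookup-∷ʳ-fromℕ xs x) (cong (lookup (x ∷ xs)) (sym (next-fromℕ n)))
  ... | ‵inject₁ j = trans (lookup-∷ʳ-inject₁ xs x j) (cong (lookup (x ∷ xs)) (sym (next-inject₁ j)))

  ∑-rotate : (xs : List A) {n : ℕ} (f : Vec A (suc n) → ℕ) →
             ∑ (vecs xs (suc n)) (f ∘ rotate) ≡ ∑ (vecs xs (suc n)) f
  ∑-rotate xs {n} f = trans (∑-vecs-suc xs n (f ∘ rotate)) (snoc n f)
    where
    open ≡-Reasoning
    snoc : ∀ n (f : Vec _ (suc n) → ℕ) →
           ∑ xs (λ x → ∑ (vecs xs n) (λ v → f (v ∷ʳ x))) ≡ ∑ (vecs xs (suc n)) f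
    snoc zero    f = sym (∑-vecs-suc xs zero f)
    snoc (suc n) f = begin
      ∑ xs (λ x → ∑ (vecs xs (suc n)) (λ v → f (v ∷ʳ x)))
        ≡⟨ ∑-cong xs (λ x → ∑-vecs-suc xs n _) ⟩
      ∑ xs (λ x → ∑ xs (λ z → ∑ (vecs xs n) (λ v → f (z ∷ (v ∷ʳ x)))))
        ≡⟨ ∑-swap xs xs _ ⟩
      ∑ xs (λ z → ∑ xs (λ x → ∑ (vecs xs n) (λ v → f (z ∷ (v ∷ʳ x)))))
        ≡⟨ ∑-cong xs (λ z → snoc n (λ v → f (z ∷ v))) ⟩
      ∑ xs (λ z → ∑ (vecs xs (suc n)) (λ v → f (z ∷ v)))
        ≡⟨ ∑-vecs-suc xs (suc n) f ⟨
      ∑ (vecs xs (suc (suc n))) f ∎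

  -- Walks

  cyc : ∀ {n} → (A → A → ℕ) → Vec A n → ℕ
  cyc f v = ∏ (λ j → f (lookup v j) (lookup v (next j)))

  lin : ∀ {n} → (A → A → ℕ) → A → Vec A n → A → ℕ
  lin f x []       y = f x y
  lin f x (z ∷ zs) y = f x z * lin f z zs y

  cyc-lin : ∀ {n} (f : A → A → ℕ) x (xs : Vec A n) → cyc f (x ∷ xs) ≡ lin f x xs x
  cyc-lin f x xs =
    trans (∏-cong (λ j → cong (f (lookup (x ∷ xs) j)) (sym (lookup-rotate (x ∷ xs) j)))) (open-up x xs x)
    where
    open-up : ∀ {n} x (xs : Vec _ n) y →
              ∏ (λ j → f (lookup (x ∷ xs) j) (lookup (xs ∷ʳ y) j)) ≡ lin f x xs y
    open-up x []       y = *-identityʳ (f x y)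
    open-up x (z ∷ zs) y = cong (f x z *_) (open-up z zs y)

  cyc-rotate : ∀ {n} (f : A → A → ℕ) (v : Vec A (suc n)) → cyc f (rotate v) ≡ cyc f v
  cyc-rotate f v = begin
    ∏ (λ j → f (lookup (rotate v) j) (lookup (rotate v) (next j)))
      ≡⟨ ∏-cong (λ j → cong₂ f (lookup-rotate v j) (lookup-rotate v (next j))) ⟩
    ∏ (λ j → f (lookup v (next j)) (lookup v (next (next j))))
      ≡⟨ ∏-permute (λ j → f (lookup v j) (lookup v (next j))) nextᵖ ⟨
    cyc f v ∎
    where open ≡-Reasoning

  -- Rotational invariance lets a marked place be moved to the front, where the walk can be cut
  -- open.
  ∑-cyc-rotate : (us : List A) (f : A → A → ℕ) {n : ℕ} (F : Vec A (suc n) → ℕ) →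
    ∑ (vecs us (suc n)) (λ v → F (rotate v) * cyc f v) ≡ ∑ (vecs us (suc n)) (λ v → F v * cyc f v)
  ∑-cyc-rotate us f {n} F = trans
    (∑-cong (vecs us (suc n)) (λ v → cong (F (rotate v) *_) (sym (cyc-rotate f v))))
    (∑-rotate us (λ v → F v * cyc f v))

  -- matpow us f j is the (j + 1)-st power of the matrix f.
  matpow : List A → (A → A → ℕ) → ℕ → A → A → ℕ
  matpow us f zero    x y = f x y
  matpow us f (suc j) x y = ∑ us (λ z → f x z * matpow us f j z y)

  ∑-lin : (us : List A) (f : A → A → ℕ) (j : ℕ) (x y : A) →
          ∑ (vecs us j) (λ zs → lin f x zs y) ≡ matpow us f j x y
  ∑-lin us f zero    x y = +-identityʳ (f x y)
  ∑-lin us f (suc j) x y = begin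
    ∑ (vecs us (suc j)) (λ zs → lin f x zs y)
      ≡⟨ ∑-vecs-suc us j _ ⟩
    ∑ us (λ z → ∑ (vecs us j) (λ zs → f x z * lin f z zs y))
      ≡⟨ ∑-cong us (λ z → trans (∑-*ˡ (vecs us j) (f x z) _) (cong (f x z *_) (∑-lin us f j z y))) ⟩
    matpow us f (suc j) x y ∎
    where open ≡-Reasoning

  ∑-lin-marked : (us : List A) (f : A → A → ℕ) (D : A → ℕ) {j : ℕ} (i : Fin j) (q : ℕ) →
    toℕ i + suc q ≡ j → ∀ x y →
    ∑ (vecs us j) (λ zs → D (lookup zs i) * lin f x zs y)
      ≡ ∑ us (λ z → matpow us f (toℕ i) x z * (D z * matpow us f q z y))
  ∑-lin-marked us f D {suc j} zero q refl x y = begin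
    ∑ (vecs us (suc j)) (λ zs → D (lookup zs zero) * lin f x zs y)
      ≡⟨ ∑-vecs-suc us j _ ⟩
    ∑ us (λ z → ∑ (vecs us j) (λ zs → D z * (f x z * lin f z zs y)))
      ≡⟨ ∑-cong us (λ z → trans (∑-*ˡ (vecs us j) (D z) _)
                                (cong (D z *_) (trans (∑-*ˡ (vecs us j) (f x z) _) (cong (f x z *_) (∑-lin us f j z y))))) ⟩
    ∑ us (λ z → D z * (f x z * matpow us f j z y))
      ≡⟨ ∑-cong us (λ z → x∙yz≈y∙xz (D z) (f x z) _) ⟩
    ∑ us (λ z → f x z * (D z * matpow us f j z y)) ∎
    where open ≡-Reasoning
  ∑-lin-marked us f D {suc j} (suc i) q eq x y = begin
    ∑ (vecs us (suc j)) (λ zs → D (lookup zs (suc i)) * lin f x zs y)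
      ≡⟨ ∑-vecs-suc us j _ ⟩
    ∑ us (λ u → ∑ (vecs us j) (λ zs → D (lookup zs i) * (f x u * lin f u zs y)))
      ≡⟨ ∑-cong us (λ u → trans (∑-cong (vecs us j) (λ zs → x∙yz≈y∙xz (D (lookup zs i)) (f x u) _))
                                (∑-*ˡ (vecs us j) (f x u) _)) ⟩
    ∑ us (λ u → f x u * ∑ (vecs us j) (λ zs → D (lookup zs i) * lin f u zs y))
      ≡⟨ ∑-cong us (λ u → cong (f x u *_) (∑-lin-marked us f D i q (suc-injective eq) u y)) ⟩
    ∑ us (λ u → f x u * ∑ us (λ z → matpow us f (toℕ i) u z * (D z * matpow us f q z y)))
      ≡⟨ ∑-cong us (λ u → sym (∑-*ˡ us (f x u) _)) ⟩
    ∑ us (λ u → ∑ us (λ z → f x u * (matpow us f (toℕ i) u z * (D z * matpow us f q z y))))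
      ≡⟨ ∑-swap us us _ ⟩
    ∑ us (λ z → ∑ us (λ u → f x u * (matpow us f (toℕ i) u z * (D z * matpow us f q z y))))
      ≡⟨ ∑-cong us (λ z → trans (∑-cong us (λ u → sym (*-assoc (f x u) _ _))) (∑-*ʳ us _ _)) ⟩
    ∑ us (λ z → matpow us f (suc (toℕ i)) x z * (D z * matpow us f q z y)) ∎
    where open ≡-Reasoning

  ∑∑-swap : (xs : List A) (ys : List B) (f : A → A → B → B → ℕ) →
    ∑ xs (λ x → ∑ xs (λ y → ∑ ys (λ z → ∑ ys (λ u → f x y z u))))
      ≡ ∑ ys (λ z → ∑ ys (λ u → ∑ xs (λ x → ∑ xs (λ y → f x y z u))))
  ∑∑-swap xs ys f = begin
    ∑ xs (λ x → ∑ xs (λ y → ∑ ys (λ z → ∑ ys (λ u → f x y z u))))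
      ≡⟨ ∑-cong xs (λ x → ∑-swap xs ys _) ⟩
    ∑ xs (λ x → ∑ ys (λ z → ∑ xs (λ y → ∑ ys (λ u → f x y z u))))
      ≡⟨ ∑-swap xs ys _ ⟩
    ∑ ys (λ z → ∑ xs (λ x → ∑ xs (λ y → ∑ ys (λ u → f x y z u))))
      ≡⟨ ∑-cong ys (λ z → ∑-cong xs (λ x → ∑-swap xs ys _)) ⟩
    ∑ ys (λ z → ∑ xs (λ x → ∑ ys (λ u → ∑ xs (λ y → f x y z u))))
      ≡⟨ ∑-cong ys (λ z → ∑-swap xs ys _) ⟩
    ∑ ys (λ z → ∑ ys (λ u → ∑ xs (λ x → ∑ xs (λ y → f x y z u)))) ∎
    where open ≡-Reasoning

  ∑∑-*ˡ : (xs : List A) (ys : List B) (c : ℕ) (f : A → B → ℕ) →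
          ∑ xs (λ x → ∑ ys (λ y → c * f x y)) ≡ c * ∑ xs (λ x → ∑ ys (f x))
  ∑∑-*ˡ xs ys c f = trans (∑-cong xs (λ x → ∑-*ˡ ys c (f x))) (∑-*ˡ xs c (λ x → ∑ ys (f x)))

  cauchy-schwarz₂ : (xs : List A) (ys : List B) (w f g : A → B → ℕ) →
    let ⟨_,_⟩ = λ (f g : A → B → ℕ) → ∑ xs (λ x → ∑ ys (λ y → w x y * (f x y * g x y))) in
    ⟨ f , g ⟩ * ⟨ f , g ⟩ ≤ ⟨ f , f ⟩ * ⟨ g , g ⟩
  cauchy-schwarz₂ xs ys w f g =
    subst₂ _≤_ (cong₂ _*_ (flat f g) (flat f g)) (cong₂ _*_ (flat f f) (flat g g))
      (cauchy-schwarz (cartesianProduct xs ys) (un w) (un f) (un g))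
    where
    un : (A → B → ℕ) → A × B → ℕ
    un h (x , y) = h x y
    flat : ∀ f g → ∑ (cartesianProduct xs ys) (λ p → un w p * (un f p * un g p))
                   ≡ ∑ xs (λ x → ∑ ys (λ y → w x y * (f x y * g x y)))
    flat f g = ∑-product xs ys (λ x y → w x y * (f x y * g x y))

  -- Symmetric kernels with vertex weights: traces, norms and marked closed walks

  module Kernel {U : Set} (us : List U) (a : U → U → ℕ) (a-sym : ∀ x y → a x y ≡ a y x) (w : U → ℕ) where

    open ≤-Reasoning

    -- κ j x y is the total weight of the walks with j inner vertices from x to y,
    -- each inner vertex z counting with weight w z.
    κ : ℕ → U → U → ℕ
    κ zero    x y = a x y
    κ (suc j) x y = ∑ us (λ z → a x z * (w z * κ j z y))

    κ-+ : ∀ i j x y → κ (suc (i + j)) x y ≡ ∑ us (λ z → κ i x z * (w z * κ j z y))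
    κ-+ zero    j x y = refl
    κ-+ (suc i) j x y = begin-equality
      ∑ us (λ u → a x u * (w u * κ (suc (i + j)) u y))
        ≡⟨ ∑-cong us (λ u → cong (λ t → a x u * (w u * t)) (κ-+ i j u y)) ⟩
      ∑ us (λ u → a x u * (w u * ∑ us (λ z → κ i u z * (w z * κ j z y))))
        ≡⟨ ∑-cong us (λ u → trans (sym (*-assoc (a x u) (w u) _)) (sym (∑-*ˡ us (a x u * w u) _))) ⟩
      ∑ us (λ u → ∑ us (λ z → a x u * w u * (κ i u z * (w z * κ j z y))))
        ≡⟨ ∑-swap us us _ ⟩
      ∑ us (λ z → ∑ us (λ u → a x u * w u * (κ i u z * (w z * κ j z y))))
        ≡⟨ ∑-cong us (λ z → trans (∑-cong us (λ u → regroup (a x u) (w u) (κ i u z) (w z * κ j z y)))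
                                  (∑-*ʳ us (w z * κ j z y) _)) ⟩
      ∑ us (λ z → κ (suc i) x z * (w z * κ j z y)) ∎
      where
      regroup : ∀ a b c d → a * b * (c * d) ≡ a * (b * c) * d
      regroup = solve-∀

    κ-sym : ∀ j x y → κ j x y ≡ κ j y x
    κ-sym zero    x y = a-sym x y
    κ-sym (suc j) x y = begin-equality
      ∑ us (λ z → a x z * (w z * κ j z y))
        ≡⟨ ∑-cong us (λ z → trans (cong₂ (λ s t → s * (w z * t)) (a-sym x z) (κ-sym j z y))
                                  (flip₃ (a z x) (w z) (κ j y z))) ⟩
      ∑ us (λ z → κ j y z * (w z * a z x))
        ≡⟨ κ-+ j 0 y x ⟨
      κ (suc (j + 0)) y x
        ≡⟨ cong (λ t → κ (suc t) y x) (+-identityʳ j) ⟩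
      κ (suc j) y x ∎
      where
      flip₃ : ∀ a b c → a * (b * c) ≡ c * (b * a)
      flip₃ = solve-∀

    ⟪_,_⟫₂ : (f g : U → U → ℕ) → ℕ
    ⟪ f , g ⟫₂ = ∑ us (λ x → ∑ us (λ y → w x * w y * (f x y * g x y)))

    τ : ℕ → ℕ
    τ j = ⟪ κ j , κ j ⟫₂

    trace-at : ∀ i j x → ∑ us (λ y → w x * w y * (κ i x y * κ j x y)) ≡ w x * κ (suc (i + j)) x x
    trace-at i j x = begin-equality
      ∑ us (λ y → w x * w y * (κ i x y * κ j x y))
        ≡⟨ ∑-cong us (λ y → trans (cong (λ t → w x * w y * (κ i x y * t)) (κ-sym j x y))
                                  (regroup (w x) (w y) (κ i x y) (κ j y x))) ⟩
      ∑ us (λ y → w x * (κ i x y * (w y * κ j y x)))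
        ≡⟨ ∑-*ˡ us (w x) _ ⟩
      w x * ∑ us (λ y → κ i x y * (w y * κ j y x))
        ≡⟨ cong (w x *_) (κ-+ i j x x) ⟨
      w x * κ (suc (i + j)) x x ∎
      where
      regroup : ∀ a b c d → a * b * (c * d) ≡ a * (c * (b * d))
      regroup = solve-∀

    -- By symmetry of the kernel, two walks glued at both ends form a closed walk, and only its
    -- length i + j + 2 matters. The freedom in splitting i + j makes `τ` log-convex.
    trace : ∀ i j → ⟪ κ i , κ j ⟫₂ ≡ ∑ us (λ x → w x * κ (suc (i + j)) x x)
    trace i j = ∑-cong us (trace-at i j)

    τ-convex : ∀ j → τ (suc j) * τ (suc j) ≤ τ j * τ (suc (suc j))
    τ-convex j = begin
      τ (suc j) * τ (suc j)
        ≡⟨ cong₂ _*_ mixed mixed ⟩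
      ⟪ κ j , κ (suc (suc j)) ⟫₂ * ⟪ κ j , κ (suc (suc j)) ⟫₂
        ≤⟨ cauchy-schwarz₂ us us (λ x y → w x * w y) (κ j) (κ (suc (suc j))) ⟩
      τ j * τ (suc (suc j)) ∎
      where
      mixed : τ (suc j) ≡ ⟪ κ j , κ (suc (suc j)) ⟫₂
      mixed = trans (trace (suc j) (suc j))
        (trans (cong (λ t → ∑ us (λ x → w x * κ (suc t) x x)) (sym (+-suc j (suc j))))
               (sym (trace j (suc (suc j)))))

    -- Cauchy-Schwarz against the constant 1 bounds the squared trace by the number of vertices
    -- times the sum of the squared diagonal entries, and these are among the terms of `τ 1`.
    -- Log-convexity thus extends by one term, the number of vertices.
    τ₀-convex : (∀ x → x ∈ us) → τ 0 * τ 0 ≤ length us * τ 1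
    τ₀-convex x∈us = begin
      τ 0 * τ 0
        ≡⟨ cong₂ _*_ diagonal diagonal ⟩
      ∑ us (λ x → 1 * (1 * (w x * κ 1 x x))) * ∑ us (λ x → 1 * (1 * (w x * κ 1 x x)))
        ≤⟨ cauchy-schwarz us (λ _ → 1) (λ _ → 1) (λ x → w x * κ 1 x x) ⟩
      ∑ us (λ x → 1) * ∑ us (λ x → 1 * (w x * κ 1 x x * (w x * κ 1 x x)))
        ≤⟨ *-mono-≤ (≤-reflexive (trans (∑-const us 1) (*-identityʳ (length us)))) (∑-mono us bound) ⟩
      length us * τ 1 ∎
      where
      diagonal : τ 0 ≡ ∑ us (λ x → 1 * (1 * (w x * κ 1 x x)))
      diagonal = trans (trace 0 0) (∑-cong us (λ x → sym (trans (+-identityʳ _) (+-identityʳ _))))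
      regroup : ∀ a b → 1 * (a * b * (a * b)) ≡ a * a * (b * b)
      regroup = solve-∀
      bound : ∀ x → 1 * (w x * κ 1 x x * (w x * κ 1 x x)) ≤ ∑ us (λ y → w x * w y * (κ 1 x y * κ 1 x y))
      bound x = ≤-trans (≤-reflexive (regroup (w x) (κ 1 x x)))
                        (term≤∑ (x∈us x) (λ y → w x * w y * (κ 1 x y * κ 1 x y)))

    ⟪_,_⟫₁ : (f g : U → ℕ) → ℕ
    ⟪ f , g ⟫₁ = ∑ us (λ x → w x * (f x * g x))

    apply : (U → ℕ) → U → ℕ
    apply g x = ∑ us (λ y → a x y * (w y * g y))

    iter : (U → ℕ) → ℕ → U → ℕ
    iter g zero    = g
    iter g (suc i) = apply (iter g i)

    apply-adjoint : ∀ f g → ⟪ apply f , g ⟫₁ ≡ ⟪ f , apply g ⟫₁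
    apply-adjoint f g = begin-equality
      ∑ us (λ x → w x * (apply f x * g x))
        ≡⟨ ∑-cong us (λ x → trans (left (w x) (apply f x) (g x)) (sym (∑-*ˡ us (w x * g x) _))) ⟩
      ∑ us (λ x → ∑ us (λ y → w x * g x * (a x y * (w y * f y))))
        ≡⟨ ∑-swap us us _ ⟩
      ∑ us (λ y → ∑ us (λ x → w x * g x * (a x y * (w y * f y))))
        ≡⟨ ∑-cong us (λ y → trans
             (∑-cong us (λ x → trans (cong (λ t → w x * g x * (t * (w y * f y))) (a-sym x y))
                                     (middle (w x) (g x) (a y x) (w y) (f y))))
             (trans (∑-*ˡ us (w y * f y) _) (*-assoc (w y) (f y) _))) ⟩
      ∑ us (λ y → w y * (f y * apply g y)) ∎
      where
      left : ∀ a b c → a * (b * c) ≡ a * c * b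
      left = solve-∀
      middle : ∀ a b c d e → a * b * (c * (d * e)) ≡ d * e * (c * (a * b))
      middle = solve-∀

    σ : (U → ℕ) → ℕ → ℕ
    σ g i = ⟪ iter g i , iter g i ⟫₁

    -- The operator `apply` is self-adjoint for the weighted inner product, so the squared norm of
    -- an iterate is also the inner product of its two neighbours.
    σ-convex : ∀ g i → σ g (suc i) * σ g (suc i) ≤ σ g i * σ g (suc (suc i))
    σ-convex g i = begin
      σ g (suc i) * σ g (suc i)
        ≡⟨ cong₂ _*_ mixed mixed ⟩
      ⟪ iter g i , iter g (suc (suc i)) ⟫₁ * ⟪ iter g i , iter g (suc (suc i)) ⟫₁
        ≤⟨ cauchy-schwarz us w (iter g i) (iter g (suc (suc i))) ⟩
      σ g i * σ g (suc (suc i)) ∎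
      where
      mixed : σ g (suc i) ≡ ⟪ iter g i , iter g (suc (suc i)) ⟫₁
      mixed = apply-adjoint (iter g i) (iter g (suc i))

    iter-κ : ∀ g i x → iter g (suc i) x ≡ ∑ us (λ y → κ i x y * (w y * g y))
    iter-κ g zero    x = refl
    iter-κ g (suc i) x = begin-equality
      ∑ us (λ z → a x z * (w z * iter g (suc i) z))
        ≡⟨ ∑-cong us (λ z → cong (λ t → a x z * (w z * t)) (iter-κ g i z)) ⟩
      ∑ us (λ z → a x z * (w z * ∑ us (λ y → κ i z y * (w y * g y))))
        ≡⟨ ∑-cong us (λ z → trans (sym (*-assoc (a x z) (w z) _)) (sym (∑-*ˡ us (a x z * w z) _))) ⟩
      ∑ us (λ z → ∑ us (λ y → a x z * w z * (κ i z y * (w y * g y))))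
        ≡⟨ ∑-swap us us _ ⟩
      ∑ us (λ y → ∑ us (λ z → a x z * w z * (κ i z y * (w y * g y))))
        ≡⟨ ∑-cong us (λ y → trans (∑-cong us (λ z → regroup (a x z) (w z) (κ i z y) (w y * g y)))
                                  (∑-*ʳ us (w y * g y) _)) ⟩
      ∑ us (λ y → κ (suc i) x y * (w y * g y)) ∎
      where
      regroup : ∀ a b c d → a * b * (c * d) ≡ a * (b * c) * d
      regroup = solve-∀

    -- The Hilbert–Schmidt norm bounds the operator norm.
    σ≤τσ₀ : ∀ g i → σ g (suc i) ≤ τ i * σ g 0
    σ≤τσ₀ g i = begin
      ∑ us (λ x → w x * (iter g (suc i) x * iter g (suc i) x))
        ≤⟨ ∑-mono us (λ x → *-monoʳ-≤ (w x) (pointwise x)) ⟩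
      ∑ us (λ x → w x * (∑ us (λ y → w y * (κ i x y * κ i x y)) * σ g 0))
        ≡⟨ ∑-cong us (λ x → sym (*-assoc (w x) _ (σ g 0))) ⟩
      ∑ us (λ x → w x * ∑ us (λ y → w y * (κ i x y * κ i x y)) * σ g 0)
        ≡⟨ ∑-*ʳ us (σ g 0) _ ⟩
      ∑ us (λ x → w x * ∑ us (λ y → w y * (κ i x y * κ i x y))) * σ g 0
        ≡⟨ cong (_* σ g 0) (∑-cong us (λ x → trans (sym (∑-*ˡ us (w x) _))
                                                   (∑-cong us (λ y → sym (*-assoc (w x) (w y) _))))) ⟩
      τ i * σ g 0 ∎
      where
      entry : ∀ x → iter g (suc i) x ≡ ∑ us (λ y → w y * (κ i x y * g y))
      entry x = trans (iter-κ g i x) (∑-cong us (λ y → x∙yz≈y∙xz (κ i x y) (w y) (g y)))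
      pointwise : ∀ x → iter g (suc i) x * iter g (suc i) x
                        ≤ ∑ us (λ y → w y * (κ i x y * κ i x y)) * σ g 0
      pointwise x = subst (_≤ ∑ us (λ y → w y * (κ i x y * κ i x y)) * σ g 0) (sym (cong₂ _*_ (entry x) (entry x))) (cauchy-schwarz us w (κ i x) g)

    -- The weight of the closed walks through z and u, marked by `D z` and `D′ u`, whose two arcs
    -- between z and u have p and q inner vertices.
    Φ : (D D′ : U → ℕ) → ℕ → ℕ → ℕ
    Φ D D′ p q = ∑ us (λ z → ∑ us (λ u → w z * D z * (w u * D′ u) * (κ p z u * κ q z u)))

    Φ-swap : ∀ D D′ p q → Φ D D′ p q ≡ Φ D D′ q p
    Φ-swap D D′ p q = ∑² us us (λ z u → cong (w z * D z * (w u * D′ u) *_) (*-comm (κ p z u) (κ q z u)))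

    Θ : (U → ℕ) → ℕ → ℕ → U → U → ℕ
    Θ D i j x y = ∑ us (λ z → κ i x z * (w z * D z * κ j z y))

    -- Two walks from x to y, one through z and one through u, are glued at x and y. In the closed
    -- walk so obtained, x and y become inner vertices of the two arcs between z and u; this is the
    -- origin of the two successors.
    ⟪Θ,Θ⟫ : ∀ D D′ i j i′ j′ →
            ⟪ Θ D i j , Θ D′ i′ j′ ⟫₂ ≡ Φ D D′ (suc (i + i′)) (suc (j + j′))
    ⟪Θ,Θ⟫ D D′ i j i′ j′ = begin-equality
      ∑ us (λ x → ∑ us (λ y → w x * w y * (Θ D i j x y * Θ D′ i′ j′ x y)))
        ≡⟨ ∑² us us (λ x y → trans (cong (w x * w y *_) (∑-*-∑ us us _ _))
             (trans (sym (∑-*ˡ us (w x * w y) _)) (∑-cong us (λ z → sym (∑-*ˡ us (w x * w y) _))))) ⟩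
      ∑ us (λ x → ∑ us (λ y → ∑ us (λ z → ∑ us (λ u →
        w x * w y * (κ i x z * (w z * D z * κ j z y) * (κ i′ x u * (w u * D′ u * κ j′ u y)))))))
        ≡⟨ ∑∑-swap us us _ ⟩
      ∑ us (λ z → ∑ us (λ u → ∑ us (λ x → ∑ us (λ y →
        w x * w y * (κ i x z * (w z * D z * κ j z y) * (κ i′ x u * (w u * D′ u * κ j′ u y)))))))
        ≡⟨ ∑² us us factor ⟩
      Φ D D′ (suc (i + i′)) (suc (j + j′)) ∎
      where
      regroup : ∀ wx wy a wz d b c wu d′ e →
        wx * wy * (a * (wz * d * b) * (c * (wu * d′ * e))) ≡ wz * d * (wu * d′) * (a * (wx * c) * (b * (wy * e)))
      regroup = solve-∀
      factor : ∀ z u →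
        ∑ us (λ x → ∑ us (λ y →
          w x * w y * (κ i x z * (w z * D z * κ j z y) * (κ i′ x u * (w u * D′ u * κ j′ u y)))))
        ≡ w z * D z * (w u * D′ u) * (κ (suc (i + i′)) z u * κ (suc (j + j′)) z u)
      factor z u = begin-equality
        ∑ us (λ x → ∑ us (λ y →
          w x * w y * (κ i x z * (w z * D z * κ j z y) * (κ i′ x u * (w u * D′ u * κ j′ u y)))))
          ≡⟨ ∑² us us (λ x y → trans
               (regroup (w x) (w y) (κ i x z) (w z) (D z) (κ j z y) (κ i′ x u) (w u) (D′ u) (κ j′ u y))
               (cong₂ (λ s t → w z * D z * (w u * D′ u) * (s * (w x * κ i′ x u) * (κ j z y * (w y * t))))
                      (κ-sym i x z) (κ-sym j′ u y))) ⟩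
        ∑ us (λ x → ∑ us (λ y →
          w z * D z * (w u * D′ u) * (κ i z x * (w x * κ i′ x u) * (κ j z y * (w y * κ j′ y u)))))
          ≡⟨ ∑∑-*ˡ us us (w z * D z * (w u * D′ u)) _ ⟩
        w z * D z * (w u * D′ u) * ∑ us (λ x → ∑ us (λ y →
          κ i z x * (w x * κ i′ x u) * (κ j z y * (w y * κ j′ y u))))
          ≡⟨ cong (w z * D z * (w u * D′ u) *_) (∑-*-∑ us us _ _) ⟨
        w z * D z * (w u * D′ u) *
          (∑ us (λ x → κ i z x * (w x * κ i′ x u)) * ∑ us (λ y → κ j z y * (w y * κ j′ y u)))
          ≡⟨ cong₂ (λ s t → w z * D z * (w u * D′ u) * (s * t)) (κ-+ i i′ z u) (κ-+ j j′ z u) ⟨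
        w z * D z * (w u * D′ u) * (κ (suc (i + i′)) z u * κ (suc (j + j′)) z u) ∎

    -- Cauchy-Schwarz with the weights `ρ x` splits the square of `h x y` into a row sum of `ρ` and
    -- a sum in which `ρ` will be summed over a column. The numbers c₁ and c₂ are denominators of
    -- the two bounds; the column bound may depend on z, so that it can be summed over classes of
    -- vertices later.
    schur-test : (ρ : U → U → ℕ) (r : U → ℕ) (g : U → U → ℕ) (c₁ c₂ P : ℕ) →
      (∀ x → c₁ * (w x * ∑ us (ρ x)) ≤ P) →
      (∀ z → c₂ * (w z * ∑ us (λ x → ρ x z)) ≤ r z) →
      let h = λ x y → ∑ us (λ z → ρ x z * (w z * g z y)) in
      c₁ * c₂ * ⟪ h , h ⟫₂
        ≤ P * ∑ us (λ z → r z * ∑ us (λ y → w z * w y * (g z y * g z y)))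
    schur-test ρ r g c₁ c₂ P rows columns = begin
      c₁ * c₂ * ∑ us (λ x → ∑ us (λ y → w x * w y * (h x y * h x y)))
        ≡⟨ trans (*-assoc c₁ c₂ _) (cong (c₁ *_) (sym (∑∑-*ˡ us us c₂ _))) ⟩
      c₁ * ∑ us (λ x → ∑ us (λ y → c₂ * (w x * w y * (h x y * h x y))))
        ≡⟨ ∑∑-*ˡ us us c₁ _ ⟨
      ∑ us (λ x → ∑ us (λ y → c₁ * (c₂ * (w x * w y * (h x y * h x y)))))
        ≤⟨ ∑-mono us (λ x → ∑-mono us (λ y → step x y)) ⟩
      ∑ us (λ x → ∑ us (λ y → P * (c₂ * (w y * G x y))))
        ≡⟨ ∑∑-*ˡ us us P _ ⟩
      P * ∑ us (λ x → ∑ us (λ y → c₂ * (w y * G x y)))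
        ≤⟨ *-monoʳ-≤ P collect ⟩
      P * ∑ us (λ z → r z * ∑ us (λ y → w z * w y * (g z y * g z y))) ∎
      where
      h = λ x y → ∑ us (λ z → ρ x z * (w z * g z y))
      G = λ x y → ∑ us (λ z → ρ x z * (w z * g z y * (w z * g z y)))

      cs : ∀ x y → h x y * h x y ≤ ∑ us (ρ x) * G x y
      cs x y = subst₂ _≤_ (cong₂ _*_ one one) (cong (_* G x y) (∑-cong us (λ z → *-identityʳ (ρ x z))))
        (cauchy-schwarz us (ρ x) (λ _ → 1) (λ z → w z * g z y))
        where
        one : ∑ us (λ z → ρ x z * (1 * (w z * g z y))) ≡ h x y
        one = ∑-cong us (λ z → cong (ρ x z *_) (*-identityˡ _))

      regroup : ∀ c₁ c₂ a b s t → c₁ * (c₂ * (a * b * (s * t))) ≡ c₁ * (a * s) * (c₂ * (b * t))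
      regroup = solve-∀

      step : ∀ x y → c₁ * (c₂ * (w x * w y * (h x y * h x y))) ≤ P * (c₂ * (w y * G x y))
      step x y = begin
        c₁ * (c₂ * (w x * w y * (h x y * h x y)))
          ≤⟨ *-monoʳ-≤ c₁ (*-monoʳ-≤ c₂ (*-monoʳ-≤ (w x * w y) (cs x y))) ⟩
        c₁ * (c₂ * (w x * w y * (∑ us (ρ x) * G x y)))
          ≡⟨ regroup c₁ c₂ (w x) (w y) (∑ us (ρ x)) (G x y) ⟩
        c₁ * (w x * ∑ us (ρ x)) * (c₂ * (w y * G x y))
          ≤⟨ *-monoˡ-≤ _ (rows x) ⟩
        P * (c₂ * (w y * G x y)) ∎

      regroup′ : ∀ c b r v k → c * (b * (r * (v * k * (v * k)))) ≡ c * (v * r) * (v * b * (k * k))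
      regroup′ = solve-∀

      collect : ∑ us (λ x → ∑ us (λ y → c₂ * (w y * G x y)))
                ≤ ∑ us (λ z → r z * ∑ us (λ y → w z * w y * (g z y * g z y)))
      collect = begin
        ∑ us (λ x → ∑ us (λ y → c₂ * (w y * G x y)))
          ≡⟨ ∑² us us (λ x y → trans (cong (c₂ *_) (sym (∑-*ˡ us (w y) _))) (sym (∑-*ˡ us c₂ _))) ⟩
        ∑ us (λ x → ∑ us (λ y → ∑ us (λ z → c₂ * (w y * (ρ x z * (w z * g z y * (w z * g z y)))))))
          ≡⟨ ∑-cong us (λ x → trans (∑-swap us us _)
               (∑² us us (λ z y → regroup′ c₂ (w y) (ρ x z) (w z) (g z y)))) ⟩
        ∑ us (λ x → ∑ us (λ z → ∑ us (λ y → c₂ * (w z * ρ x z) * (w z * w y * (g z y * g z y)))))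
          ≡⟨ ∑² us us (λ x z → ∑-*ˡ us (c₂ * (w z * ρ x z)) _) ⟩
        ∑ us (λ x → ∑ us (λ z → c₂ * (w z * ρ x z) * ∑ us (λ y → w z * w y * (g z y * g z y))))
          ≡⟨ ∑-swap us us _ ⟩
        ∑ us (λ z → ∑ us (λ x → c₂ * (w z * ρ x z) * ∑ us (λ y → w z * w y * (g z y * g z y))))
          ≡⟨ ∑-cong us (λ z → trans (∑-*ʳ us _ _)
               (cong (_* ∑ us (λ y → w z * w y * (g z y * g z y)))
                     (trans (∑-*ˡ us c₂ _) (cong (c₂ *_) (∑-*ˡ us (w z) _))))) ⟩
        ∑ us (λ z → c₂ * (w z * ∑ us (λ x → ρ x z)) * ∑ us (λ y → w z * w y * (g z y * g z y)))
          ≤⟨ ∑-mono us (λ z → *-monoˡ-≤ _ (columns z)) ⟩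
        ∑ us (λ z → r z * ∑ us (λ y → w z * w y * (g z y * g z y))) ∎

    module _ {C : Set} (cs : List C) where

      -- In the application c is a vertex of G, and `D c` and `D′ c` indicate that a certain entry
      -- of a tuple is c. Then this is the weight of the closed walks in which two given entries of
      -- two tuples coincide.
      Ψ : (D D′ : C → U → ℕ) → ℕ → ℕ → ℕ
      Ψ D D′ p q = ∑ cs (λ c → Φ (D c) (D′ c) p q)

      Ψ-swap : ∀ D D′ p q → Ψ D D′ p q ≡ Ψ D D′ q p
      Ψ-swap D D′ p q = ∑-cong cs (λ c → Φ-swap (D c) (D′ c) p q)

      Ψ-cauchy-schwarz : ∀ D D′ i j i′ j′ →
        let mixed = Ψ D D′ (suc (i + i′)) (suc (j + j′)) in
        mixed * mixed ≤ Ψ D D (suc (i + i)) (suc (j + j)) * Ψ D′ D′ (suc (i′ + i′)) (suc (j′ + j′))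
      Ψ-cauchy-schwarz D D′ i j i′ j′ = subst₂ _≤_
        (cong₂ _*_ (flat D D′ i j i′ j′) (flat D D′ i j i′ j′))
        (cong₂ _*_ (flat D D i j i j) (flat D′ D′ i′ j′ i′ j′))
        (cauchy-schwarz₂ cs (cartesianProduct us us) (λ _ (x , y) → w x * w y)
          (λ c (x , y) → Θ (D c) i j x y) (λ c (x , y) → Θ (D′ c) i′ j′ x y))
        where
        flat : ∀ D D′ i j i′ j′ →
          ∑ cs (λ c → ∑ (cartesianProduct us us) (λ (x , y) → w x * w y * (Θ (D c) i j x y * Θ (D′ c) i′ j′ x y)))
            ≡ Ψ D D′ (suc (i + i′)) (suc (j + j′))
        flat D D′ i j i′ j′ = ∑-cong cs (λ c → trans
          (∑-product us us (λ x y → w x * w y * (Θ (D c) i j x y * Θ (D′ c) i′ j′ x y)))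
          (⟪Θ,Θ⟫ (D c) (D′ c) i j i′ j′))

      module _ (K L : ℕ) (degree : ∀ x → w x * ∑ us (a x) ≤ L) where

        -- In terms of the random walk: a step lands in a given class c with probability at most 1 /
        -- K, and the classes are disjoint.
        Sparse : (C → U → ℕ) → Set
        Sparse D = (∀ c x → K * (w x * ∑ us (λ z → a x z * D c z)) ≤ L) × (∀ z → ∑ cs (λ c → D c z) ≤ 1)

        -- The short arc has a single inner vertex x, and the two marked vertices are steps from x
        -- into the same class. In the Schur test the rows are at most L / K by sparsity and the
        -- columns at most `D c z * L`; by disjointness, the sum over c costs nothing.
        Ψ-base : ∀ D → Sparse D → ∀ b → K * Ψ D D 1 (suc (b + b)) ≤ L * (L * τ b)
        Ψ-base D (rows , partial) b = begin
          K * Ψ D D 1 (suc (b + b))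
            ≡⟨ cong (K *_) (∑-cong cs (λ c → ⟪Θ,Θ⟫ (D c) (D c) 0 b 0 b)) ⟨
          K * ∑ cs (λ c → ⟪ Θ (D c) 0 b , Θ (D c) 0 b ⟫₂)
            ≡⟨ ∑-*ˡ cs K _ ⟨
          ∑ cs (λ c → K * ⟪ Θ (D c) 0 b , Θ (D c) 0 b ⟫₂)
            ≤⟨ ∑-mono cs bound ⟩
          ∑ cs (λ c → L * ∑ us (λ z → D c z * L * T z))
            ≡⟨ trans (∑-*ˡ cs L _) (cong (L *_) (∑-swap cs us _)) ⟩
          L * ∑ us (λ z → ∑ cs (λ c → D c z * L * T z))
            ≤⟨ *-monoʳ-≤ L (∑-mono us collapse) ⟩
          L * ∑ us (λ z → L * T z)
            ≡⟨ cong (L *_) (∑-*ˡ us L T) ⟩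
          L * (L * τ b) ∎
          where
          T = λ z → ∑ us (λ y → w z * w y * (κ b z y * κ b z y))
          h = λ c x y → ∑ us (λ z → a x z * D c z * (w z * κ b z y))

          regroup : ∀ p q r s → p * (q * r * s) ≡ p * r * (q * s)
          regroup = solve-∀

          Θ≡h : ∀ c x y → Θ (D c) 0 b x y ≡ h c x y
          Θ≡h c x y = ∑-cong us (λ z → regroup (a x z) (w z) (D c z) (κ b z y))

          column : ∀ c z → 1 * (w z * ∑ us (λ x → a x z * D c z)) ≤ D c z * L
          column c z = begin
            1 * (w z * ∑ us (λ x → a x z * D c z))
              ≡⟨ +-identityʳ _ ⟩
            w z * ∑ us (λ x → a x z * D c z)
              ≡⟨ cong (w z *_) (trans (∑-*ʳ us (D c z) _) (cong (_* D c z) (∑-cong us (λ x → a-sym x z)))) ⟩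
            w z * (∑ us (a z) * D c z)
              ≡⟨ trans (sym (*-assoc (w z) _ _)) (*-comm _ (D c z)) ⟩
            D c z * (w z * ∑ us (a z))
              ≤⟨ *-monoʳ-≤ (D c z) (degree z) ⟩
            D c z * L ∎

          bound : ∀ c → K * ⟪ Θ (D c) 0 b , Θ (D c) 0 b ⟫₂ ≤ L * ∑ us (λ z → D c z * L * T z)
          bound c = begin
            K * ⟪ Θ (D c) 0 b , Θ (D c) 0 b ⟫₂
              ≡⟨ cong₂ _*_ (sym (*-identityʳ K))
                   (∑² us us (λ x y → cong (w x * w y *_) (cong₂ _*_ (Θ≡h c x y) (Θ≡h c x y)))) ⟩
            K * 1 * ⟪ h c , h c ⟫₂
              ≤⟨ schur-test (λ x z → a x z * D c z) (λ z → D c z * L) (κ b) K 1 L (rows c) (column c) ⟩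
            L * ∑ us (λ z → D c z * L * T z) ∎

          collapse : ∀ z → ∑ cs (λ c → D c z * L * T z) ≤ L * T z
          collapse z = begin
            ∑ cs (λ c → D c z * L * T z)    ≡⟨ trans (∑-*ʳ cs (T z) _) (cong (_* T z) (∑-*ʳ cs L _)) ⟩
            ∑ cs (λ c → D c z) * L * T z    ≤⟨ *-monoˡ-≤ (T z) (*-monoˡ-≤ L (partial z)) ⟩
            1 * L * T z                     ≡⟨ cong (_* T z) (*-identityˡ L) ⟩
            L * T z                         ∎

        Ψ-diagonal : ∀ D → Sparse D → ∀ a b → K * Ψ D D (suc (a + a)) (suc (b + b)) ≤ L * (L * τ (a + b))
        Ψ-diagonal D sparse a b = Antidiagonal.bounded Γ convex a b
          (Ψ-base D sparse (a + b))
          (subst (λ t → K * t ≤ L * (L * τ (a + b))) (Ψ-swap D D 1 (suc (a + b + (a + b)))) (Ψ-base D sparse (a + b)))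
          where
          Γ : ℕ → ℕ → ℕ
          Γ a b = K * Ψ D D (suc (a + a)) (suc (b + b))

          scale : ∀ k x → k * x * (k * x) ≡ k * k * (x * x)
          scale = solve-∀
          scale′ : ∀ k x y → k * k * (x * y) ≡ k * x * (k * y)
          scale′ = solve-∀

          convex : ∀ a b → Γ (suc a) (suc b) * Γ (suc a) (suc b) ≤ Γ a (suc (suc b)) * Γ (suc (suc a)) b
          convex a b = begin
            Γ (suc a) (suc b) * Γ (suc a) (suc b)
              ≡⟨ scale K _ ⟩
            K * K * (Ψ D D (suc (suc a + suc a)) (suc (suc b + suc b)) * Ψ D D (suc (suc a + suc a)) (suc (suc b + suc b)))
              ≡⟨ cong (K * K *_) (cong₂ _*_ indices indices) ⟩
            K * K * (Ψ D D (suc (a + suc (suc a))) (suc (suc (suc b) + b)) * Ψ D D (suc (a + suc (suc a))) (suc (suc (suc b) + b)))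
              -- The arcs are cut off centre, as a + (a + 2) and (b + 2) + b, so that doubling the
              -- pieces yields the two neighbours on the antidiagonal.
              ≤⟨ *-monoʳ-≤ (K * K) (Ψ-cauchy-schwarz D D a (suc (suc b)) (suc (suc a)) b) ⟩
            K * K * (Ψ D D (suc (a + a)) (suc (suc (suc b) + suc (suc b))) * Ψ D D (suc (suc (suc a) + suc (suc a))) (suc (b + b)))
              ≡⟨ scale′ K _ _ ⟩
            Γ a (suc (suc b)) * Γ (suc (suc a)) b ∎
            where
            indices : Ψ D D (suc (suc a + suc a)) (suc (suc b + suc b)) ≡ Ψ D D (suc (a + suc (suc a))) (suc (suc (suc b) + b))
            indices = cong₂ (λ p q → Ψ D D (suc p) (suc q)) (sym (+-suc a (suc a))) (cong suc (+-suc b b))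

        -- Different marks are reduced to equal ones by one more Cauchy-Schwarz inequality, now with
        -- both arcs cut in the middle.
        Ψ-bound : ∀ D D′ → Sparse D → Sparse D′ → ∀ a b →
                  K * Ψ D D′ (suc (a + a)) (suc (b + b)) ≤ L * (L * τ (a + b))
        Ψ-bound D D′ sparse sparse′ a b = square-cancel-≤ (begin
          K * Ψ D D′ p q * (K * Ψ D D′ p q)    ≡⟨ scale K _ _ ⟩
          K * K * (Ψ D D′ p q * Ψ D D′ p q)    ≤⟨ *-monoʳ-≤ (K * K) (Ψ-cauchy-schwarz D D′ a b a b) ⟩
          K * K * (Ψ D D p q * Ψ D′ D′ p q)    ≡⟨ scale K _ _ ⟨
          K * Ψ D D p q * (K * Ψ D′ D′ p q)
            ≤⟨ *-mono-≤ (Ψ-diagonal D sparse a b) (Ψ-diagonal D′ sparse′ a b) ⟩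
          L * (L * τ (a + b)) * (L * (L * τ (a + b))) ∎)
          where
          p = suc (a + a)
          q = suc (b + b)
          scale : ∀ k x y → k * x * (k * y) ≡ k * k * (x * y)
          scale = solve-∀

    -- The closed walk is cut at x and at the opposite vertex, which turns its weight into the
    -- squared norm of a row of `κ (suc b)`, and the mark may be squared because it is 0 or 1. In
    -- the Schur test for the first step, a column consists of the reversed steps into Q, so it is
    -- at most L / K.
    diagonal-bound : (K L : ℕ) → (∀ x → w x * ∑ us (a x) ≤ L) →
      (Q : U → ℕ) → (∀ x → Q x ≤ 1) → (∀ z → K * (w z * ∑ us (λ x → a z x * Q x)) ≤ L) →
      ∀ b → K * ∑ us (λ x → Q x * (w x * κ (suc (suc b + suc b)) x x)) ≤ L * (L * τ b)
    diagonal-bound K L degree Q Q≤1 columns b = begin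
      K * ∑ us (λ x → Q x * (w x * κ (suc (suc b + suc b)) x x))
        ≤⟨ *-monoʳ-≤ K (∑-mono us expand) ⟩
      K * ⟪ h , h ⟫₂
        ≡⟨ cong (_* ⟪ h , h ⟫₂) (sym (*-identityˡ K)) ⟩
      1 * K * ⟪ h , h ⟫₂
        ≤⟨ schur-test ρ (λ _ → L) (κ b) 1 K L row column ⟩
      L * ∑ us (λ z → L * ∑ us (λ y → w z * w y * (κ b z y * κ b z y)))
        ≡⟨ cong (L *_) (∑-*ˡ us L _) ⟩
      L * (L * τ b) ∎
      where
      ρ = λ x z → Q x * a x z
      h = λ x y → ∑ us (λ z → ρ x z * (w z * κ b z y))

      h≡ : ∀ x y → h x y ≡ Q x * κ (suc b) x y
      h≡ x y = trans (∑-cong us (λ z → *-assoc (Q x) (a x z) _)) (∑-*ˡ us (Q x) _)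

      idempotent : ∀ x → Q x ≤ Q x * Q x
      idempotent x with Q x | Q≤1 x
      ... | zero        | _ = z≤n
      ... | suc zero    | _ = ≤-refl
      ... | suc (suc _) | s≤s ()

      regroup : ∀ q a b k → q * q * (a * b * (k * k)) ≡ a * b * (q * k * (q * k))
      regroup = solve-∀

      expand : ∀ x → Q x * (w x * κ (suc (suc b + suc b)) x x) ≤ ∑ us (λ y → w x * w y * (h x y * h x y))
      expand x = begin
        Q x * (w x * κ (suc (suc b + suc b)) x x)
          ≡⟨ cong (Q x *_) (trace-at (suc b) (suc b) x) ⟨
        Q x * ∑ us (λ y → w x * w y * (κ (suc b) x y * κ (suc b) x y))
          ≤⟨ *-monoˡ-≤ _ (idempotent x) ⟩
        Q x * Q x * ∑ us (λ y → w x * w y * (κ (suc b) x y * κ (suc b) x y))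
          ≡⟨ ∑-*ˡ us (Q x * Q x) _ ⟨
        ∑ us (λ y → Q x * Q x * (w x * w y * (κ (suc b) x y * κ (suc b) x y)))
          ≡⟨ ∑-cong us (λ y → trans (regroup (Q x) (w x) (w y) (κ (suc b) x y))
               (cong (w x * w y *_) (sym (cong₂ _*_ (h≡ x y) (h≡ x y))))) ⟩
        ∑ us (λ y → w x * w y * (h x y * h x y)) ∎

      row : ∀ x → 1 * (w x * ∑ us (ρ x)) ≤ L
      row x = begin
        1 * (w x * ∑ us (ρ x))      ≡⟨ *-identityˡ _ ⟩
        w x * ∑ us (ρ x)            ≤⟨ *-monoʳ-≤ (w x) (∑-mono us (λ z → ≤-trans (*-monoˡ-≤ (a x z) (Q≤1 x)) (≤-reflexive (*-identityˡ _)))) ⟩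
        w x * ∑ us (a x)            ≤⟨ degree x ⟩
        L                           ∎

      column : ∀ z → K * (w z * ∑ us (λ x → ρ x z)) ≤ L
      column z = ≤-trans (≤-reflexive (cong (λ t → K * (w z * t))
        (∑-cong us (λ x → trans (*-comm (Q x) (a x z)) (cong (_* Q x) (a-sym x z)))))) (columns z)

  -- Closed walks as cyclic vectors

  module ClosedWalks {U : Set} (us : List U) (a : U → U → ℕ) (a-sym : ∀ x y → a x y ≡ a y x) (w : U → ℕ) where

    open Kernel us a a-sym w
    open ≤-Reasoning

    -- The weight of a vertex is put on the edge leaving it, so that the cyclic product takes every
    -- vertex weight exactly once.
    f : U → U → ℕ
    f x y = w x * a x y

    pow-κ : ∀ j x y → matpow us f j x y ≡ w x * κ j x y
    pow-κ zero    x y = refl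
    pow-κ (suc j) x y = trans
      (∑-cong us (λ z → trans (cong (w x * a x z *_) (pow-κ j z y)) (*-assoc (w x) (a x z) _)))
      (∑-*ˡ us (w x) _)

    marked : ∀ {n} → (Vec U n → ℕ) → ℕ
    marked {n} F = ∑ (vecs us n) (λ v → F v * cyc f v)

    marked-cong : ∀ {n} {F G : Vec U n → ℕ} → (∀ v → F v ≡ G v) → marked F ≡ marked G
    marked-cong F≗G = ∑-cong (vecs us _) (λ v → cong (_* cyc f v) (F≗G v))

    marked-rotate : ∀ {n} (F : Vec U (suc n) → ℕ) → marked (F ∘ rotate) ≡ marked F
    marked-rotate = ∑-cyc-rotate us f

    marked-+ : ∀ {n} (F G : Vec U n → ℕ) → marked (λ v → F v + G v) ≡ marked F + marked G
    marked-+ {n} F G = trans (∑-cong (vecs us n) (λ v → *-distribʳ-+ (cyc f v) (F v) (G v))) (∑-+ (vecs us n) _ _)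

    marked-∑ : ∀ {n} {C : Set} (K b : ℕ) (cs : List C) (F : C → Vec U n → ℕ) → (∀ c → K * marked (F c) ≤ b) →
               K * marked (λ v → ∑ cs (λ c → F c v)) ≤ length cs * b
    marked-∑ {n} K b cs F bound = begin
      K * marked (λ v → ∑ cs (λ c → F c v))
        ≡⟨ cong (K *_) (trans (∑-cong (vecs us n) (λ v → sym (∑-*ʳ cs (cyc f v) (λ c → F c v)))) (∑-swap (vecs us n) cs _)) ⟩
      K * ∑ cs (λ c → marked (F c))
        ≡⟨ ∑-*ˡ cs K (λ c → marked (F c)) ⟨
      ∑ cs (λ c → K * marked (F c))
        ≤⟨ ∑-mono cs bound ⟩
      ∑ cs (λ _ → b)
        ≡⟨ ∑-const cs b ⟩
      length cs * b ∎

    marked-if : ∀ {n} (K b : ℕ) {P : Set} (P? : Dec P) (F : Vec U n → ℕ) → (P → K * marked F ≤ b) →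
                K * marked (λ v → ⟪ P? ⟫ * F v) ≤ b
    marked-if {n} K b (yes p) F bound = subst (λ t → K * t ≤ b) (marked-cong (λ v → sym (*-identityˡ (F v)))) (bound p)
    marked-if {n} K b (no _)  F bound = subst (_≤ b) (sym (trans (cong (K *_) (∑-zero (vecs us n))) (*-zeroʳ K))) z≤n

    marked-mono : ∀ {n} (F G : Vec U n → ℕ) → (∀ v → 0 < cyc f v → F v ≤ G v) → marked F ≤ marked G
    marked-mono {n} F G F≤G = ∑-mono (vecs us n) (λ v → pointwise (cyc f v) (F≤G v))
      where
      pointwise : ∀ {x y} t → (0 < t → x ≤ y) → x * t ≤ y * t
      pointwise {x} {y} zero    _   = ≤-reflexive (trans (*-zeroʳ x) (sym (*-zeroʳ y)))
      pointwise         (suc t) x≤y = *-monoˡ-≤ (suc t) (x≤y (s≤s z≤n))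

    marked-suc : ∀ {n} (F : Vec U (suc n) → ℕ) →
      marked F ≡ ∑ us (λ x → ∑ (vecs us n) (λ xs → F (x ∷ xs) * lin f x xs x))
    marked-suc {n} F = trans (∑-vecs-suc us n (λ v → F v * cyc f v))
      (∑² us (vecs us n) (λ x xs → cong (F (x ∷ xs) *_) (cyc-lin f x xs)))

    marked-head : ∀ {n} (Q : U → ℕ) →
      marked {suc n} (λ v → Q (lookup v zero)) ≡ ∑ us (λ x → Q x * (w x * κ n x x))
    marked-head {n} Q = trans (marked-suc (λ v → Q (lookup v zero)))
      (∑-cong us (λ x → trans (∑-*ˡ (vecs us n) (Q x) _)
        (cong (Q x *_) (trans (∑-lin us f n x x) (pow-κ n x x)))))

    total : ∀ r → marked {suc (suc (r + r))} (λ _ → 1) ≡ τ r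
    total r = trans (marked-head (λ _ → 1))
      (trans (∑-cong us (λ x → *-identityˡ _)) (sym (trace r r)))

    marked-lookup : ∀ {n} (Q : U → ℕ) i →
      marked {suc n} (λ v → Q (lookup v i)) ≡ ∑ us (λ x → Q x * (w x * κ n x x))
    marked-lookup {n} Q = <-weakInduction
      (λ i → marked {suc n} (λ v → Q (lookup v i)) ≡ ∑ us (λ x → Q x * (w x * κ n x x)))
      (marked-head Q)
      (λ i ih → trans (marked-cong (λ v → cong Q (sym (trans (lookup-rotate v (inject₁ i)) (cong (lookup v) (next-inject₁ i))))))
                      (trans (marked-rotate (λ v → Q (lookup v (inject₁ i)))) ih))

    module _ {C : Set} (cs : List C) (D D′ : C → U → ℕ) where

      pair : ∀ {n} (i i′ : Fin n) → Vec U n → ℕ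
      pair i i′ v = ∑ cs (λ c → D c (lookup v i) * D′ c (lookup v i′))

      pair-rotate : ∀ {n} (i i′ : Fin n) → marked (pair (suc i) (suc i′)) ≡ marked (pair (inject₁ i) (inject₁ i′))
      pair-rotate i i′ = trans
        (marked-cong (λ v → ∑-cong cs (λ c → sym (cong₂ (λ x y → D c x * D′ c y) (shift v i) (shift v i′)))))
        (marked-rotate (pair (inject₁ i) (inject₁ i′)))
        where
        shift : ∀ {n} (v : Vec U (suc n)) i → lookup (rotate v) (inject₁ i) ≡ lookup v (suc i)
        shift v i = trans (lookup-rotate v (inject₁ i)) (cong (lookup v) (next-inject₁ i))

      pair-head : ∀ {n} (i : Fin n) q → toℕ i + suc q ≡ n → marked (pair zero (suc i)) ≡ Ψ cs D D′ (toℕ i) q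
      pair-head {n} i q eq = begin-equality
        marked (pair zero (suc i))
          ≡⟨ marked-suc (pair zero (suc i)) ⟩
        ∑ us (λ x → ∑ (vecs us n) (λ xs → ∑ cs (λ c → D c x * D′ c (lookup xs i)) * lin f x xs x))
          ≡⟨ ∑² us (vecs us n) (λ x xs → trans (sym (∑-*ʳ cs (lin f x xs x) _)) (∑-cong cs (λ c → *-assoc (D c x) _ _))) ⟩
        ∑ us (λ x → ∑ (vecs us n) (λ xs → ∑ cs (λ c → D c x * (D′ c (lookup xs i) * lin f x xs x))))
          ≡⟨ ∑-cong us (λ x → trans (∑-swap (vecs us n) cs _) (∑-cong cs (λ c → trans (∑-*ˡ (vecs us n) (D c x) _)
               (cong (D c x *_) (∑-lin-marked us f (D′ c) i q eq x x))))) ⟩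
        ∑ us (λ x → ∑ cs (λ c → D c x * ∑ us (λ z → matpow us f (toℕ i) x z * (D′ c z * matpow us f q z x))))
          ≡⟨ ∑-swap us cs _ ⟩
        ∑ cs (λ c → ∑ us (λ x → D c x * ∑ us (λ z → matpow us f (toℕ i) x z * (D′ c z * matpow us f q z x))))
          ≡⟨ ∑² cs us (λ c x → trans (sym (∑-*ˡ us (D c x) _)) (∑-cong us (weigh c x))) ⟩
        Ψ cs D D′ (toℕ i) q ∎
        where
        regroup : ∀ d wx k d′ wz k′ → d * (wx * k * (d′ * (wz * k′))) ≡ wx * d * (wz * d′) * (k * k′)
        regroup = solve-∀
        weigh : ∀ c x z → D c x * (matpow us f (toℕ i) x z * (D′ c z * matpow us f q z x))
                          ≡ w x * D c x * (w z * D′ c z) * (κ (toℕ i) x z * κ q x z)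
        weigh c x z = trans
          (cong₂ (λ s t → D c x * (s * (D′ c z * t))) (pow-κ (toℕ i) x z)
                 (trans (pow-κ q z x) (cong (w z *_) (κ-sym q z x))))
          (regroup (D c x) (w x) (κ (toℕ i) x z) (D′ c z) (w z) (κ q x z))

      module _ (K L : ℕ) (degree : ∀ x → w x * ∑ us (a x) ≤ L)
               (sparse : Sparse cs K L degree D) (sparse′ : Sparse cs K L degree D′) (r : ℕ) where

        -- Rotation moves i to the front. One arc then has 2 p + 1 inner vertices, and as the length
        -- 2 r + 4 is even, the other one has 2 q + 1 with p + q = r, as `Ψ-bound` requires.
        pair-bound : ∀ (i i′ : Fin (suc (suc (suc r + suc r)))) p → toℕ i′ ≡ toℕ i + suc (suc (p + p)) →
                     K * marked (pair i i′) ≤ L * (L * τ r)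
        pair-bound = <-weakInduction
          (λ i → ∀ i′ p → toℕ i′ ≡ toℕ i + suc (suc (p + p)) → K * marked (pair i i′) ≤ L * (L * τ r))
          base step
          where
          half : ∀ p s → suc (p + p) < suc (suc s + suc s) → p ≤ s
          half p s lt with ≤-<-connex p s
          ... | inj₁ p≤s = p≤s
          ... | inj₂ s<p = contradiction (+-mono-≤ s<p s<p) (<⇒≱ (≤-pred lt))

          base : ∀ i′ p → toℕ i′ ≡ suc (suc (p + p)) → K * marked (pair zero i′) ≤ L * (L * τ r)
          base (suc i) p eq with m≤n⇒∃[o]m+o≡n (half p r (subst (_< suc (suc r + suc r)) (suc-injective eq) (toℕ<n i)))
          ... | q , refl = subst (λ t → K * t ≤ L * (L * τ (p + q))) (sym head)
                (Ψ-bound cs K L degree D D′ sparse sparse′ p q)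
            where
            position : ∀ p q → suc (p + p) + suc (suc (q + q)) ≡ suc (suc (p + q) + suc (p + q))
            position = solve-∀
            head : marked (pair zero (suc i)) ≡ Ψ cs D D′ (suc (p + p)) (suc (q + q))
            head = trans (pair-head i (suc (q + q)) (trans (cong (_+ suc (suc (q + q))) (suc-injective eq)) (position p q)))
                         (cong (λ t → Ψ cs D D′ t (suc (q + q))) (suc-injective eq))

          step : ∀ i → (∀ i′ p → toℕ i′ ≡ toℕ (inject₁ i) + suc (suc (p + p)) → K * marked (pair (inject₁ i) i′) ≤ L * (L * τ r)) →
                 ∀ i′ p → toℕ i′ ≡ suc (toℕ i) + suc (suc (p + p)) → K * marked (pair (suc i) i′) ≤ L * (L * τ r)
          step i ih (suc i′) p eq = subst (λ t → K * t ≤ L * (L * τ r)) (sym (pair-rotate i i′))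
            (ih (inject₁ i′) p (trans (toℕ-inject₁ i′)
              (trans (suc-injective eq) (cong (_+ suc (suc (p + p))) (sym (toℕ-inject₁ i))))))

  -- Bipartite kernels

  both : List A → List (Bool × A)
  both xs = cartesianProduct (true ∷ false ∷ []) xs

  ∈-both : {xs : List A} → (∀ x → x ∈ xs) → ∀ u → u ∈ both xs
  ∈-both x∈xs (true  , x) = ∈-cartesianProduct⁺ {xs = true ∷ false ∷ []} (here refl) (x∈xs x)
  ∈-both x∈xs (false , x) = ∈-cartesianProduct⁺ {xs = true ∷ false ∷ []} (there (here refl)) (x∈xs x)

  ∑-both : (xs : List A) (f : Bool × A → ℕ) →
           ∑ (both xs) f ≡ ∑ xs (λ x → f (true , x)) + ∑ xs (λ x → f (false , x))
  ∑-both xs f = trans (∑-product (true ∷ false ∷ []) xs (λ s x → f (s , x)))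
    (cong (∑ xs (λ x → f (true , x)) +_) (+-identityʳ _))

  length-both : (xs : List A) → length (both xs) ≡ 2 * length xs
  length-both xs = begin
    length (both xs)                        ≡⟨ ∑-one (both xs) ⟨
    ∑ (both xs) (λ _ → 1)                   ≡⟨ ∑-both xs (λ _ → 1) ⟩
    ∑ xs (λ _ → 1) + ∑ xs (λ _ → 1)         ≡⟨ cong (λ t → t + t) (∑-one xs) ⟩
    length xs + length xs                   ≡⟨ cong (length xs +_) (+-identityʳ (length xs)) ⟨
    2 * length xs                           ∎
    where open ≡-Reasoning

  bipartite : (Bool → A → A → ℕ) → Bool × A → Bool × A → ℕ
  bipartite B (true  , x) (true  , y) = 0
  bipartite B (true  , x) (false , y) = B true x y
  bipartite B (false , x) (true  , y) = B false x y
  bipartite B (false , x) (false , y) = 0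

  bipartite-sym : (B : Bool → A → A → ℕ) → (∀ x y → B true x y ≡ B false y x) →
                  ∀ u v → bipartite B u v ≡ bipartite B v u
  bipartite-sym B B-sym (true  , x) (true  , y) = refl
  bipartite-sym B B-sym (true  , x) (false , y) = B-sym x y
  bipartite-sym B B-sym (false , x) (true  , y) = sym (B-sym y x)
  bipartite-sym B B-sym (false , x) (false , y) = refl

  ∑-bipartite : (B : Bool → A → A → ℕ) (xs : List A) (g : Bool × A → ℕ) → ∀ s x →
    ∑ (both xs) (λ v → bipartite B (s , x) v * g v) ≡ ∑ xs (λ y → B s x y * g (not s , y))
  ∑-bipartite B xs g true  x = trans (∑-both xs _) (cong (_+ ∑ xs (λ y → B true x y * g (false , y))) (∑-zero xs))
  ∑-bipartite B xs g false x = trans (∑-both xs _)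
    (trans (cong (∑ xs (λ y → B false x y * g (true , y)) +_) (∑-zero xs)) (+-identityʳ _))

  -- A condition on the single entry j, padded with the factor 1 at all other places so that it has
  -- the product form that `row` expects.
  at : ∀ {n} → Fin n → (A → ℕ) → Fin n → A → ℕ
  at j h i y = if does (i ≟ᶠ j) then h y else 1

  ∏-at : ∀ {n} (j : Fin n) (h : A → ℕ) (y : Fin n → A) → ∏ (λ i → at j h i (y i)) ≡ h (y j)
  ∏-at {n = suc n} zero    h y = trans (cong (h (y zero) *_) (trans (∏-const n 1) (^-zeroˡ n))) (*-identityʳ _)
  ∏-at {n = suc n} (suc j) h y = trans (+-identityʳ _) (∏-at j h (y ∘ suc))

  at-hit : ∀ {n} (j : Fin n) (h : A → ℕ) y → at j h j y ≡ h y
  at-hit zero    h y = refl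
  at-hit (suc j) h y = at-hit j h y

  at≤1 : ∀ {n} (j : Fin n) (h : A → ℕ) i y → h y ≤ 1 → at j h i y ≤ 1
  at≤1 j h i y h≤1 with does (i ≟ᶠ j)
  ... | true  = h≤1
  ... | false = ≤-refl

  length-allFin : ∀ n → length (allFin n) ≡ n
  length-allFin n = length-tabulate {n = n} id
    where open import Data.List.Properties using (length-tabulate)

  -- p ↦ q is an edge of the auxiliary graph if p₀ q₀ p₁ q₁ … is a closed walk alternating between
  -- the two sides; seen from q, the walk runs backwards.
  module Tuples {n : ℕ} (A : Fin n → Fin n → ℕ) (A≤1 : ∀ x y → A x y ≤ 1) (ℓ : ℕ) where

    open ≤-Reasoning

    V = Fin n

    vs : List V
    vs = allFin n

    E : Bool → V → V → ℕ
    E true  x y = A x y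
    E false x y = A y x

    E≤1 : ∀ s x y → E s x y ≤ 1
    E≤1 true  x y = A≤1 x y
    E≤1 false x y = A≤1 y x

    codegree : Bool → V → V → ℕ
    codegree s x x′ = ∑ vs (λ y → E s x y * E s x′ y)

    codegree-sym : ∀ s x x′ → codegree s x x′ ≡ codegree s x′ x
    codegree-sym s x x′ = ∑-cong vs (λ y → *-comm (E s x y) (E s x′ y))

    EE≤1 : ∀ s x x′ y → E s x y * E s x′ y ≤ 1
    EE≤1 s x x′ y = *-mono-≤ (E≤1 s x y) (E≤1 s x′ y)

    codegree≤n : ∀ s x x′ → codegree s x x′ ≤ n
    codegree≤n s x x′ = begin
      codegree s x x′      ≤⟨ ∑-mono vs (EE≤1 s x x′) ⟩
      ∑ vs (λ _ → 1)       ≡⟨ ∑-const vs 1 ⟩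
      length vs * 1        ≡⟨ trans (*-identityʳ _) (length-allFin n) ⟩
      n                    ∎

    turn : Bool → Fin ℓ → Fin ℓ
    turn true  = next
    turn false = prev

    M : Bool → Vec V ℓ → Vec V ℓ → ℕ
    M s p q = ∏ (λ j → E s (lookup p j) (lookup q j) * E s (lookup p (turn s j)) (lookup q j))

    M-sym : ∀ p q → M true p q ≡ M false q p
    M-sym p q = begin-equality
      ∏ (λ j → A (lookup p j) (lookup q j) * A (lookup p (next j)) (lookup q j))
        ≡⟨ ∏-* (λ j → A (lookup p j) (lookup q j)) (λ j → A (lookup p (next j)) (lookup q j)) ⟩
      ∏ (λ j → A (lookup p j) (lookup q j)) * ∏ (λ j → A (lookup p (next j)) (lookup q j))
        ≡⟨ cong (∏ (λ j → A (lookup p j) (lookup q j)) *_)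
             (trans (∏-permute (λ j → A (lookup p (next j)) (lookup q j)) prevᵖ)
                    (∏-cong (λ j → cong (λ i → A (lookup p i) (lookup q (prev j))) (next-prev j)))) ⟩
      ∏ (λ j → A (lookup p j) (lookup q j)) * ∏ (λ j → A (lookup p j) (lookup q (prev j)))
        ≡⟨ ∏-* (λ j → A (lookup p j) (lookup q j)) (λ j → A (lookup p j) (lookup q (prev j))) ⟨
      M false q p ∎

    U = Bool × Vec V ℓ

    us : List U
    us = both (vecs vs ℓ)

    a : U → U → ℕ
    a = bipartite M

    a-sym : ∀ u v → a u v ≡ a v u
    a-sym = bipartite-sym M M-sym

    -- ι t plays the role of R / t for K ≤ t, and ι t = 0 for t < K.
    module Weighted (K R : ℕ) .{{_ : NonZero R}} (ι : ℕ → ℕ)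
      (ι-inverse : ∀ t → t ≤ n → ι t * t ≡ R * ⟪ K ≤? t ⟫) (ι-bound : ∀ t → t ≤ n → K * ι t ≤ R) where

      α : Bool → V → V → ℕ
      α s x x′ = ι (codegree s x x′)

      w : U → ℕ
      w (s , p) = ∏ (λ j → α s (lookup p j) (lookup p (turn s j)))

      L : ℕ
      L = R ^ ℓ

      factor : Bool → Vec V ℓ → (Fin ℓ → V → ℕ) → Fin ℓ → ℕ
      factor s p ψ j = α s x x′ * ∑ vs (λ y → E s x y * E s x′ y * ψ j y)
        where
        x  = lookup p j
        x′ = lookup p (turn s j)

      -- This is the independence of the entries after a random step from p: `factor s p ψ j` is R
      -- times the expectation of `ψ j` for a uniform common neighbour, or 0 if the codegree is
      -- below K.
      row : ∀ s p (g : U → ℕ) (ψ : Fin ℓ → V → ℕ) →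
        (∀ q → g (not s , q) ≡ ∏ (λ j → ψ j (lookup q j))) →
        w (s , p) * ∑ us (λ v → a (s , p) v * g v) ≡ ∏ (factor s p ψ)
      row s p g ψ g≡ = begin-equality
        w (s , p) * ∑ us (λ v → a (s , p) v * g v)
          ≡⟨ cong (w (s , p) *_) (∑-bipartite M (vecs vs ℓ) g s p) ⟩
        w (s , p) * ∑ (vecs vs ℓ) (λ q → M s p q * g (not s , q))
          ≡⟨ cong (w (s , p) *_) (∑-cong (vecs vs ℓ) (λ q → trans (cong (M s p q *_) (g≡ q)) (sym (∏-* _ (λ j → ψ j (lookup q j)))))) ⟩
        w (s , p) * ∑ (vecs vs ℓ) (λ q → ∏ (λ j →
          E s (lookup p j) (lookup q j) * E s (lookup p (turn s j)) (lookup q j) * ψ j (lookup q j)))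
          ≡⟨ cong (w (s , p) *_) (∑-∏ vs (λ j y → E s (lookup p j) y * E s (lookup p (turn s j)) y * ψ j y)) ⟩
        w (s , p) * ∏ (λ j → ∑ vs (λ y → E s (lookup p j) y * E s (lookup p (turn s j)) y * ψ j y))
          ≡⟨ ∏-* (λ j → α s (lookup p j) (lookup p (turn s j))) _ ⟨
        ∏ (factor s p ψ) ∎

      degree : U → ℕ
      degree u = ∑ us (a u)

      good : U → ℕ
      good (s , p) = ∏ (λ j → ⟪ K ≤? codegree s (lookup p j) (lookup p (turn s j)) ⟫)

      w-degree : ∀ u → w u * degree u ≡ L * good u
      w-degree (s , p) = begin-equality
        w (s , p) * degree (s , p)
          ≡⟨ cong (w (s , p) *_) (∑-cong us (λ v → *-identityʳ (a (s , p) v))) ⟨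
        w (s , p) * ∑ us (λ v → a (s , p) v * 1)
          ≡⟨ row s p (λ _ → 1) (λ _ _ → 1) (λ _ → sym (trans (∏-const ℓ 1) (^-zeroˡ ℓ))) ⟩
        ∏ (factor s p (λ _ _ → 1))
          ≡⟨ ∏-cong (λ j → trans (cong (α s (lookup p j) (lookup p (turn s j)) *_) (∑-cong vs (λ y → *-identityʳ _)))
                                 (ι-inverse _ (codegree≤n s (lookup p j) (lookup p (turn s j))))) ⟩
        ∏ (λ j → R * ⟪ K ≤? codegree s (lookup p j) (lookup p (turn s j)) ⟫)
          ≡⟨ ∏-* (λ _ → R) (λ j → ⟪ K ≤? codegree s (lookup p j) (lookup p (turn s j)) ⟫) ⟩
        ∏ {ℓ} (λ _ → R) * good (s , p)
          ≡⟨ cong (_* good (s , p)) (∏-const ℓ R) ⟩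
        L * good (s , p) ∎

      good≤1 : ∀ u → good u ≤ 1
      good≤1 (s , p) = ≤-trans (∏-mono (λ j → ⟪⟫≤1 (K ≤? codegree s (lookup p j) (lookup p (turn s j)))))
                               (≤-reflexive (trans (∏-const ℓ 1) (^-zeroˡ ℓ)))

      w-degree≤L : ∀ u → w u * ∑ us (a u) ≤ L
      w-degree≤L u = begin
        w u * degree u  ≡⟨ w-degree u ⟩
        L * good u      ≤⟨ *-monoʳ-≤ L (good≤1 u) ⟩
        L * 1           ≡⟨ *-identityʳ L ⟩
        L               ∎

      factor≤R : ∀ s p ψ → (∀ j y → ψ j y ≤ 1) → ∀ j → factor s p ψ j ≤ R
      factor≤R s p ψ ψ≤1 j = begin
        α s x x′ * ∑ vs (λ y → E s x y * E s x′ y * ψ j y)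
          ≤⟨ *-monoʳ-≤ (α s x x′) (∑-mono vs (λ y → ≤-trans (*-monoʳ-≤ (E s x y * E s x′ y) (ψ≤1 j y)) (≤-reflexive (*-identityʳ _)))) ⟩
        α s x x′ * codegree s x x′
          ≡⟨ ι-inverse _ (codegree≤n s x x′) ⟩
        R * ⟪ K ≤? codegree s x x′ ⟫
          ≤⟨ *-monoʳ-≤ R (⟪⟫≤1 (K ≤? codegree s x x′)) ⟩
        R * 1
          ≡⟨ *-identityʳ R ⟩
        R ∎
        where
        x  = lookup p j
        x′ = lookup p (turn s j)

      -- At most one common neighbour contributes to the sum, and `α` is at most R / K.
      factor-pinned : ∀ s p ψ j c → (∀ y → ψ j y ≤ ⟪ y ≟ᶠ c ⟫) → K * factor s p ψ j ≤ R
      factor-pinned s p ψ j c ψ≤ = begin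
        K * (α s x x′ * ∑ vs (λ y → E s x y * E s x′ y * ψ j y))
          ≤⟨ *-monoʳ-≤ K (*-monoʳ-≤ (α s x x′) (∑-mono vs (λ y →
             ≤-trans (*-monoˡ-≤ (ψ j y) (EE≤1 s x x′ y)) (≤-trans (≤-reflexive (*-identityˡ _)) (ψ≤ y))))) ⟩
        K * (α s x x′ * ∑ vs (λ y → ⟪ y ≟ᶠ c ⟫))
          ≡⟨ cong (λ t → K * (α s x x′ * t)) (trans (∑-cong vs (λ y → ≟-swap y)) (∑-pick c (λ _ → 1))) ⟩
        K * (α s x x′ * 1)
          ≡⟨ cong (K *_) (*-identityʳ (α s x x′)) ⟩
        K * α s x x′
          ≤⟨ ι-bound _ (codegree≤n s x x′) ⟩
        R ∎
        where
        x  = lookup p j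
        x′ = lookup p (turn s j)
        ≟-swap : ∀ y → ⟪ y ≟ᶠ c ⟫ ≡ ⟪ c ≟ᶠ y ⟫ * 1
        ≟-swap y with y ≟ᶠ c
        ... | yes refl = sym (trans (*-identityʳ _) (⟪⟫-yes (c ≟ᶠ c) refl))
        ... | no y≢c   = sym (trans (*-identityʳ _) (⟪⟫-no (c ≟ᶠ y) (y≢c ∘ sym)))

      D : Fin ℓ → V → U → ℕ
      D j c (s , p) = ⟪ lookup p j ≟ᶠ c ⟫

      open Kernel us a a-sym w using (Sparse)

      D-sparse : ∀ j → Sparse vs K L w-degree≤L (D j)
      D-sparse j = rows , λ (s , p) → ≤-reflexive
        (trans (∑-cong vs (λ c → sym (*-identityʳ ⟪ lookup p j ≟ᶠ c ⟫))) (∑-pick (lookup p j) (λ _ → 1)))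
        where
        rows : ∀ c u → K * (w u * ∑ us (λ v → a u v * D j c v)) ≤ L
        rows c (s , p) = subst (λ t → K * t ≤ L)
          (sym (row s p (D j c) ψ (λ q → sym (∏-at j h (lookup q)))))
          (∏-gain K R (factor s p ψ) (factor≤R s p ψ (λ i y → at≤1 j h i y (⟪⟫≤1 (y ≟ᶠ c)))) j
            (factor-pinned s p ψ j c (λ y → ≤-reflexive (at-hit j h y))))
          where
          h = λ y → ⟪ y ≟ᶠ c ⟫
          ψ = at j h

      coincide : Fin ℓ → Fin ℓ → U → ℕ
      coincide j j′ (s , p) = ⟪ lookup p j ≟ᶠ lookup p j′ ⟫

      -- Sum over the common value c. By independence, the entry at j′ equals c with conditional
      -- probability at most 1 / K, and the probabilities that the entry at j equals c add up to at
      -- most 1. The factor R inserted on both sides is the one that `∏-gain₂` carries.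
      coincide-sparse : ∀ j j′ → j ≢ j′ → ∀ u → K * (w u * ∑ us (λ v → a u v * coincide j j′ v)) ≤ L
      coincide-sparse j j′ j≢j′ u@(s , p) = *-cancelˡ-≤ R (begin
        R * (K * (w u * ∑ us (λ v → a u v * coincide j j′ v)))
          ≡⟨ cong (λ t → R * (K * t)) split ⟩
        R * (K * ∑ vs (λ c → ∏ (factor s p (ψ c))))
          ≡⟨ trans (cong (R *_) (sym (∑-*ˡ vs K _))) (sym (∑-*ˡ vs R _)) ⟩
        ∑ vs (λ c → R * (K * ∏ (factor s p (ψ c))))
          ≤⟨ ∑-mono vs (λ c → ∏-gain₂ K R (factor s p (ψ c)) (factor≤R s p (ψ c) (ψ≤1 c)) j j′ j≢j′
               (factor-pinned s p (ψ c) j′ c (pinned c))) ⟩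
        ∑ vs (λ c → factor s p (ψ c) j * L)
          ≡⟨ ∑-*ʳ vs L _ ⟩
        ∑ vs (λ c → factor s p (ψ c) j) * L
          ≤⟨ *-monoˡ-≤ L collapse ⟩
        R * L ∎)
        where
        x  = lookup p j
        x′ = lookup p (turn s j)
        h : V → V → ℕ
        h c y = ⟪ y ≟ᶠ c ⟫
        ψ : V → Fin ℓ → V → ℕ
        ψ c i y = at j (h c) i y * at j′ (h c) i y
        ψ≤1 : ∀ c i y → ψ c i y ≤ 1
        ψ≤1 c i y = *-mono-≤ (at≤1 j (h c) i y (⟪⟫≤1 (y ≟ᶠ c))) (at≤1 j′ (h c) i y (⟪⟫≤1 (y ≟ᶠ c)))
        pinned : ∀ c y → ψ c j′ y ≤ ⟪ y ≟ᶠ c ⟫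
        pinned c y = ≤-trans (*-monoˡ-≤ _ (at≤1 j (h c) j′ y (⟪⟫≤1 (y ≟ᶠ c))))
          (≤-reflexive (trans (*-identityˡ _) (at-hit j′ (h c) y)))
        pinned′ : ∀ c y → ψ c j y ≤ ⟪ y ≟ᶠ c ⟫
        pinned′ c y = ≤-trans (*-monoʳ-≤ (at j (h c) j y) (at≤1 j′ (h c) j y (⟪⟫≤1 (y ≟ᶠ c))))
          (≤-reflexive (trans (*-identityʳ _) (at-hit j (h c) y)))

        coincide-sum : ∀ (q : Vec V ℓ) → ⟪ lookup q j ≟ᶠ lookup q j′ ⟫ ≡ ∑ vs (λ c → ∏ (λ i → ψ c i (lookup q i)))
        coincide-sum q = trans (sym (trans (∑-pick (lookup q j′) (λ c → ⟪ lookup q j ≟ᶠ c ⟫)) refl))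
          (∑-cong vs (λ c → trans (*-comm (h c (lookup q j′)) (h c (lookup q j)))
            (sym (trans (∏-* (λ i → at j (h c) i (lookup q i)) (λ i → at j′ (h c) i (lookup q i)))
                        (cong₂ _*_ (∏-at j (h c) (lookup q)) (∏-at j′ (h c) (lookup q)))))))

        split : w u * ∑ us (λ v → a u v * coincide j j′ v) ≡ ∑ vs (λ c → ∏ (factor s p (ψ c)))
        split = begin-equality
          w u * ∑ us (λ v → a u v * coincide j j′ v)
            ≡⟨ cong (w u *_) (∑-cong us (λ v → trans (cong (a u v *_) (coincide-sum (proj₂ v))) (sym (∑-*ˡ vs (a u v) _)))) ⟩
          w u * ∑ us (λ v → ∑ vs (λ c → a u v * ∏ (λ i → ψ c i (lookup (proj₂ v) i))))
            ≡⟨ trans (cong (w u *_) (∑-swap us vs _)) (sym (∑-*ˡ vs (w u) _)) ⟩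
          ∑ vs (λ c → w u * ∑ us (λ v → a u v * ∏ (λ i → ψ c i (lookup (proj₂ v) i))))
            ≡⟨ ∑-cong vs (λ c → row s p (λ v → ∏ (λ i → ψ c i (lookup (proj₂ v) i))) (ψ c) (λ q → refl)) ⟩
          ∑ vs (λ c → ∏ (factor s p (ψ c))) ∎

        collapse : ∑ vs (λ c → factor s p (ψ c) j) ≤ R
        collapse = begin
          ∑ vs (λ c → α s x x′ * ∑ vs (λ y → E s x y * E s x′ y * ψ c j y))
            ≤⟨ ∑-mono vs (λ c → *-monoʳ-≤ (α s x x′) (∑-mono vs (λ y → *-monoʳ-≤ (E s x y * E s x′ y) (pinned′ c y)))) ⟩
          ∑ vs (λ c → α s x x′ * ∑ vs (λ y → E s x y * E s x′ y * ⟪ y ≟ᶠ c ⟫))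
            ≡⟨ trans (∑-*ˡ vs (α s x x′) _) (cong (α s x x′ *_) (∑-swap vs vs _)) ⟩
          α s x x′ * ∑ vs (λ y → ∑ vs (λ c → E s x y * E s x′ y * ⟪ y ≟ᶠ c ⟫))
            ≡⟨ cong (α s x x′ *_) (∑-cong vs (λ y → trans (∑-cong vs (λ c → *-comm (E s x y * E s x′ y) _))
                                                          (∑-pick y (λ _ → E s x y * E s x′ y)))) ⟩
          α s x x′ * codegree s x x′
            ≡⟨ ι-inverse _ (codegree≤n s x x′) ⟩
          R * ⟪ K ≤? codegree s x x′ ⟫
            ≤⟨ *-monoʳ-≤ R (⟪⟫≤1 (K ≤? codegree s x x′)) ⟩
          R * 1
            ≡⟨ *-identityʳ R ⟩
          R ∎

  -- A lower bound for the return weight of the walk on tuples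

  ∑-cyc : (us : List A) (f : A → A → ℕ) (j : ℕ) →
          ∑ (vecs us (suc j)) (cyc f) ≡ ∑ us (λ x → matpow us f j x x)
  ∑-cyc us f j = trans (∑-vecs-suc us j (cyc f))
    (∑-cong us (λ x → trans (∑-cong (vecs us j) (cyc-lin f x)) (∑-lin us f j x x)))

  -- Capping one edge of a closed walk opens it up to a walk.
  ∑-cyc-capped : (us : List A) (f β : A → A → ℕ) (K : ℕ) → (∀ x y → β x y * f x y ≤ K) → ∀ r (i : Fin (suc (suc r))) →
    ∑ (vecs us (suc (suc r))) (λ v → β (lookup v i) (lookup v (next i)) * cyc f v)
      ≤ K * ∑ us (λ x → ∑ us (matpow us f r x))
  ∑-cyc-capped us f β K cap r = <-weakInduction
    (λ i → ∑ (vecs us (suc (suc r))) (λ v → F i v * cyc f v) ≤ K * ∑ us (λ x → ∑ us (matpow us f r x)))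
    base (λ i ih → ≤-trans (≤-reflexive (step i)) ih)
    where
    open ≤-Reasoning
    F : Fin (suc (suc r)) → Vec _ (suc (suc r)) → ℕ
    F i v = β (lookup v i) (lookup v (next i))

    shift : ∀ (v : Vec _ (suc (suc r))) i → lookup (rotate v) (inject₁ i) ≡ lookup v (suc i)
    shift v i = trans (lookup-rotate v (inject₁ i)) (cong (lookup v) (next-inject₁ i))

    step : ∀ i → ∑ (vecs us (suc (suc r))) (λ v → F (suc i) v * cyc f v)
                 ≡ ∑ (vecs us (suc (suc r))) (λ v → F (inject₁ i) v * cyc f v)
    step i = trans
      (∑-cong (vecs us (suc (suc r))) (λ v → cong (_* cyc f v) (sym (cong₂ β (shift v i)
        (trans (lookup-rotate v (next (inject₁ i))) (cong (λ t → lookup v (next t)) (next-inject₁ i)))))))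
      (∑-cyc-rotate us f (F (inject₁ i)))

    capped : ∀ x z zs → F zero (x ∷ z ∷ zs) * cyc f (x ∷ z ∷ zs) ≤ K * lin f z zs x
    capped x z zs = begin
      F zero (x ∷ z ∷ zs) * cyc f (x ∷ z ∷ zs)
        ≡⟨ cong₂ _*_ (cong (λ i → β x (lookup (x ∷ z ∷ zs) i)) (next-inject₁ zero)) (cyc-lin f x (z ∷ zs)) ⟩
      β x z * (f x z * lin f z zs x)
        ≡⟨ *-assoc (β x z) (f x z) _ ⟨
      β x z * f x z * lin f z zs x
        ≤⟨ *-monoˡ-≤ _ (cap x z) ⟩
      K * lin f z zs x ∎

    base : ∑ (vecs us (suc (suc r))) (λ v → F zero v * cyc f v) ≤ K * ∑ us (λ x → ∑ us (matpow us f r x))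
    base = begin
      ∑ (vecs us (suc (suc r))) (λ v → F zero v * cyc f v)
        ≡⟨ trans (∑-vecs-suc us (suc r) _) (∑-cong us (λ x → ∑-vecs-suc us r _)) ⟩
      ∑ us (λ x → ∑ us (λ z → ∑ (vecs us r) (λ zs → F zero (x ∷ z ∷ zs) * cyc f (x ∷ z ∷ zs))))
        ≤⟨ ∑-mono us (λ x → ∑-mono us (λ z → ∑-mono (vecs us r) (capped x z))) ⟩
      ∑ us (λ x → ∑ us (λ z → ∑ (vecs us r) (λ zs → K * lin f z zs x)))
        ≡⟨ ∑² us us (λ x z → trans (∑-*ˡ (vecs us r) K _) (cong (K *_) (∑-lin us f r z x))) ⟩
      ∑ us (λ x → ∑ us (λ z → K * matpow us f r z x))
        ≡⟨ trans (∑∑-*ˡ us us K (λ x z → matpow us f r z x)) (cong (K *_) (∑-swap us us _)) ⟩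
      K * ∑ us (λ x → ∑ us (matpow us f r x)) ∎

  -- A union bound: either all values of f are positive, and so is their product, or some value of g
  -- is.
  covering : ∀ {n} (f g : Fin n → ℕ) → (∀ j → 1 ≤ f j + g j) → 1 ≤ ∏ f + ∑ (allFin n) g
  covering {zero}  f g _     = ≤-refl
  covering {suc n} f g cover with f zero | cover zero
  ... | zero  | 1≤g = ≤-trans 1≤g (m≤m+n (g zero) _)
  ... | suc t | _   = begin
    1                                              ≤⟨ covering (f ∘ suc) (g ∘ suc) (cover ∘ suc) ⟩
    ∏ (f ∘ suc) + ∑ (allFin n) (g ∘ suc)           ≤⟨ +-mono-≤ (m≤m+n (∏ (f ∘ suc)) (t * ∏ (f ∘ suc))) (m≤n+m (∑ (allFin n) (g ∘ suc)) (g zero)) ⟩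
    suc t * ∏ (f ∘ suc) + (g zero + ∑ (allFin n) (g ∘ suc)) ≡⟨ cong (suc t * ∏ (f ∘ suc) +_) (∑-allFin-suc g) ⟨
    suc t * ∏ (f ∘ suc) + ∑ (allFin (suc n)) g     ∎
    where open ≤-Reasoning

  covering₂ : ∀ p q x y → 1 ≤ p + x → 1 ≤ q + y → 1 ≤ p * q + (x + y)
  covering₂ zero    q       x y 1≤x _   = ≤-trans 1≤x (m≤m+n x y)
  covering₂ (suc p) zero    x y _   1≤y = ≤-trans 1≤y (≤-trans (m≤n+m y x) (m≤n+m (x + y) (suc p * 0)))
  covering₂ (suc p) (suc q) x y _   _   = s≤s z≤n

  module Count {n : ℕ} .{{_ : NonZero n}} (A : Fin n → Fin n → ℕ) (A≤1 : ∀ x y → A x y ≤ 1) (r : ℕ)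
    (K R : ℕ) .{{_ : NonZero R}} (ι : ℕ → ℕ)
    (ι-inverse : ∀ t → t ≤ n → ι t * t ≡ R * ⟪ K ≤? t ⟫) (ι-bound : ∀ t → t ≤ n → K * ι t ≤ R) where

    open ≤-Reasoning

    ℓ : ℕ
    ℓ = suc (suc r)

    open Tuples A A≤1 ℓ
    open Weighted K R ι ι-inverse ι-bound

    e : ℕ
    e = ∑ vs (λ x → ∑ vs (A x))

    zs : List (Bool × V)
    zs = both vs

    module Z = Kernel zs (bipartite E) (bipartite-sym E (λ _ _ → refl)) (λ _ → 1)

    one : Bool × V → ℕ
    one _ = 1

    -- A codegree step consists of two edges, so these are the walks with 2 j + 2 edges in the
    -- bipartite graph, starting on either side.
    walks : ℕ → ℕ
    walks j = ∑ vs (λ x → ∑ vs (matpow vs (codegree true) j x)) + ∑ vs (λ x → ∑ vs (matpow vs (codegree false) j x))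

    κ-bipartite : ∀ j s x u → Z.κ (suc j) (s , x) u ≡ ∑ vs (λ y → E s x y * Z.κ j (not s , y) u)
    κ-bipartite j s x u = trans (∑-bipartite E vs _ s x)
      (∑-cong vs (λ y → cong (E s x y *_) (*-identityˡ (Z.κ j (not s , y) u))))

    κ-bipartite₂ : ∀ j s x u → Z.κ (suc (suc j)) (s , x) u ≡ ∑ vs (λ x′ → codegree s x x′ * Z.κ j (s , x′) u)
    κ-bipartite₂ j s x u = begin-equality
      Z.κ (suc (suc j)) (s , x) u
        ≡⟨ κ-bipartite (suc j) s x u ⟩
      ∑ vs (λ y → E s x y * Z.κ (suc j) (not s , y) u)
        ≡⟨ ∑-cong vs (λ y → trans (cong (E s x y *_) (back s y)) (sym (∑-*ˡ vs (E s x y) _))) ⟩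
      ∑ vs (λ y → ∑ vs (λ x′ → E s x y * (E s x′ y * Z.κ j (s , x′) u)))
        ≡⟨ ∑-swap vs vs _ ⟩
      ∑ vs (λ x′ → ∑ vs (λ y → E s x y * (E s x′ y * Z.κ j (s , x′) u)))
        ≡⟨ ∑-cong vs (λ x′ → trans (∑-cong vs (λ y → sym (*-assoc (E s x y) (E s x′ y) _))) (∑-*ʳ vs _ _)) ⟩
      ∑ vs (λ x′ → codegree s x x′ * Z.κ j (s , x′) u) ∎
      where
      back : ∀ s y → Z.κ (suc j) (not s , y) u ≡ ∑ vs (λ x′ → E s x′ y * Z.κ j (s , x′) u)
      back true  y = κ-bipartite j false y u
      back false y = κ-bipartite j true y u

    κ-pow : ∀ j s x y → Z.κ (suc (j + j)) (s , x) (s , y) ≡ matpow vs (codegree s) j x y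
    κ-pow zero s x y = trans (κ-bipartite 0 s x (s , y)) (∑-cong vs (λ z → cong (E s x z *_) (back s z)))
      where
      back : ∀ s z → bipartite E (not s , z) (s , y) ≡ E s y z
      back true  z = refl
      back false z = refl
    κ-pow (suc j) s x y = begin-equality
      Z.κ (suc (suc (j + suc j))) (s , x) (s , y)
        ≡⟨ cong (λ t → Z.κ (suc (suc t)) (s , x) (s , y)) (+-suc j j) ⟩
      Z.κ (suc (suc (suc (j + j)))) (s , x) (s , y)
        ≡⟨ κ-bipartite₂ (suc (j + j)) s x (s , y) ⟩
      ∑ vs (λ x′ → codegree s x x′ * Z.κ (suc (j + j)) (s , x′) (s , y))
        ≡⟨ ∑-cong vs (λ x′ → cong (codegree s x x′ *_) (κ-pow j s x′ y)) ⟩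
      matpow vs (codegree s) (suc j) x y ∎

    -- Cutting a walk with 2 j + 2 edges at its middle vertex leaves two walks with j + 1 edges
    -- starting there, which are counted by the square of an entry of `iter one (suc j)`.
    walks≤σ : ∀ j → walks j ≤ Z.σ one (suc j)
    walks≤σ j = begin
      walks j
        ≡⟨ cong₂ _+_ (∑² vs vs (λ x y → sym (κ-pow j true x y))) (∑² vs vs (λ x y → sym (κ-pow j false x y))) ⟩
      ∑ vs (λ x → ∑ vs (λ y → κ (true , x) (true , y))) + ∑ vs (λ x → ∑ vs (λ y → κ (false , x) (false , y)))
        ≤⟨ +-mono-≤ (∑-mono vs (λ x → ≤-trans (m≤m+n _ _) (≤-reflexive (sym (∑-both vs (κ (true , x)))))))
                    (∑-mono vs (λ x → ≤-trans (m≤n+m _ (∑ vs (λ y → κ (false , x) (true , y)))) (≤-reflexive (sym (∑-both vs (κ (false , x))))))) ⟩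
      ∑ vs (λ x → ∑ zs (κ (true , x))) + ∑ vs (λ x → ∑ zs (κ (false , x)))
        ≡⟨ ∑-both vs (λ u → ∑ zs (κ u)) ⟨
      ∑ zs (λ u → ∑ zs (κ u))
        ≡⟨ ∑² zs zs (λ u v → trans (Z.κ-+ j j u v)
             (∑-cong zs (λ z → cong₂ _*_ (Z.κ-sym j u z) (*-identityˡ (Z.κ j z v))))) ⟩
      ∑ zs (λ u → ∑ zs (λ v → ∑ zs (λ z → Z.κ j z u * Z.κ j z v)))
        ≡⟨ trans (∑-cong zs (λ u → ∑-swap zs zs _)) (∑-swap zs zs _) ⟩
      ∑ zs (λ z → ∑ zs (λ u → ∑ zs (λ v → Z.κ j z u * Z.κ j z v)))
        ≡⟨ ∑-cong zs (λ z → trans (sym (∑-*-∑ zs zs (Z.κ j z) (Z.κ j z)))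
             (trans (sym (cong₂ _*_ (entry z) (entry z))) (sym (*-identityˡ _)))) ⟩
      Z.σ one (suc j) ∎
      where
      κ = Z.κ (suc (j + j))
      entry : ∀ z → Z.iter one (suc j) z ≡ ∑ zs (Z.κ j z)
      entry z = trans (Z.iter-κ one j z) (∑-cong zs (λ y → *-identityʳ (Z.κ j z y)))

    H : ℕ
    H = ∑ us degree

    degree-cyc : ∀ s p → degree (s , p) ≡ cyc (codegree s) p
    degree-cyc s p = begin-equality
      ∑ us (a (s , p))
        ≡⟨ ∑-cong us (λ v → sym (*-identityʳ (a (s , p) v))) ⟩
      ∑ us (λ v → a (s , p) v * 1)
        ≡⟨ trans (∑-bipartite M (vecs vs ℓ) (λ _ → 1) s p) (∑-cong (vecs vs ℓ) (λ q → *-identityʳ (M s p q))) ⟩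
      ∑ (vecs vs ℓ) (M s p)
        ≡⟨ ∑-∏ vs (λ j y → E s (lookup p j) y * E s (lookup p (turn s j)) y) ⟩
      ∏ (λ j → codegree s (lookup p j) (lookup p (turn s j)))
        ≡⟨ forward s ⟩
      cyc (codegree s) p ∎
      where
      forward : ∀ s → ∏ (λ j → codegree s (lookup p j) (lookup p (turn s j))) ≡ cyc (codegree s) p
      forward true  = refl
      forward false = trans (∏-permute (λ j → codegree false (lookup p j) (lookup p (prev j))) nextᵖ)
        (∏-cong (λ j → trans (cong (λ i → codegree false (lookup p (next j)) (lookup p i)) (prev-next j))
                             (codegree-sym false (lookup p (next j)) (lookup p j))))

    ∑-us : (f : U → ℕ) → ∑ us f ≡ ∑ (vecs vs ℓ) (λ p → f (true , p)) + ∑ (vecs vs ℓ) (λ p → f (false , p))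
    ∑-us = ∑-both (vecs vs ℓ)

    -- An ordered edge of the auxiliary graph is a closed walk with 2 ℓ edges in the bipartite
    -- graph, and its start decides the side. Hence `H` is the trace of the power 2 ℓ of the
    -- adjacency matrix.
    H≡τ : H ≡ Z.τ (suc r)
    H≡τ = begin-equality
      ∑ us degree
        ≡⟨ ∑-us degree ⟩
      ∑ (vecs vs ℓ) (λ p → degree (true , p)) + ∑ (vecs vs ℓ) (λ p → degree (false , p))
        ≡⟨ cong₂ _+_ (side true) (side false) ⟩
      ∑ vs (λ x → 1 * Z.κ (suc (suc r + suc r)) (true , x) (true , x)) + ∑ vs (λ x → 1 * Z.κ (suc (suc r + suc r)) (false , x) (false , x))
        ≡⟨ ∑-both vs (λ z → 1 * Z.κ (suc (suc r + suc r)) z z) ⟨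
      ∑ zs (λ z → 1 * Z.κ (suc (suc r + suc r)) z z)
        ≡⟨ Z.trace (suc r) (suc r) ⟨
      Z.τ (suc r) ∎
      where
      side : ∀ s → ∑ (vecs vs ℓ) (λ p → degree (s , p)) ≡ ∑ vs (λ x → 1 * Z.κ (suc (suc r + suc r)) (s , x) (s , x))
      side s = trans (∑-cong (vecs vs ℓ) (degree-cyc s)) (trans (∑-cyc vs (codegree s) (suc r))
        (∑-cong vs (λ x → sym (trans (*-identityˡ _) (κ-pow (suc r) s x x)))))

    defect : Bool → V → V → ℕ
    defect s x x′ = ⟪ ¬? (K ≤? codegree s x x′) ⟫

    defects : U → ℕ
    defects (s , p) = ∑ (allFin ℓ) (λ j → defect s (lookup p j) (lookup p (turn s j)))

    good-or-defect : ∀ u → 1 ≤ good u + defects u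
    good-or-defect (s , p) = covering
      (λ j → ⟪ K ≤? codegree s (lookup p j) (lookup p (turn s j)) ⟫)
      (λ j → defect s (lookup p j) (lookup p (turn s j)))
      (λ j → dichotomy (K ≤? codegree s (lookup p j) (lookup p (turn s j))))
      where
      dichotomy : {P : Set} (P? : Dec P) → 1 ≤ ⟪ P? ⟫ + ⟪ ¬? P? ⟫
      dichotomy (yes _) = ≤-refl
      dichotomy (no _)  = ≤-refl

    defect-cap : ∀ s x x′ → defect s x x′ * codegree s x x′ ≤ K
    defect-cap s x x′ = cap (K ≤? codegree s x x′)
      where
      cap : ∀ {t} (K≤?t : Dec (K ≤ t)) → ⟪ ¬? K≤?t ⟫ * t ≤ K
      cap     (yes _) = z≤n
      cap {t} (no K≰) = ≤-trans (≤-reflexive (*-identityˡ t)) (≰⇒≥ K≰)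

    -- In the degree, a product of codegrees, a defective pair contributes a factor of at most K.
    -- Capping this factor opens the closed walk, and there are ℓ places for the pair. On the side
    -- false the pairs run backwards, so place j is treated as place `prev j`.
    defects-rare : ∑ us (λ u → defects u * degree u) ≤ ℓ * (K * walks r)
    defects-rare = begin
      ∑ us (λ u → defects u * degree u)
        ≡⟨ ∑-us _ ⟩
      ∑ (vecs vs ℓ) (λ p → defects (true , p) * degree (true , p)) + ∑ (vecs vs ℓ) (λ p → defects (false , p) * degree (false , p))
        ≤⟨ +-mono-≤ (side true) (side false) ⟩
      ℓ * (K * W true) + ℓ * (K * W false)
        ≡⟨ trans (cong (ℓ *_) (*-distribˡ-+ K (W true) (W false))) (*-distribˡ-+ ℓ (K * W true) (K * W false)) ⟨
      ℓ * (K * walks r) ∎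
      where
      W : Bool → ℕ
      W s = ∑ vs (λ x → ∑ vs (matpow vs (codegree s) r x))

      single : ∀ s j → ∑ (vecs vs ℓ) (λ p → defect s (lookup p j) (lookup p (turn s j)) * cyc (codegree s) p) ≤ K * W s
      single true  j = ∑-cyc-capped vs (codegree true) (defect true) K (defect-cap true) r j
      single false j = ≤-trans
        (≤-reflexive (∑-cong (vecs vs ℓ) (λ p → cong (_* cyc (codegree false) p)
          (trans (cong (λ t → ⟪ ¬? (K ≤? t) ⟫) (codegree-sym false (lookup p j) (lookup p (prev j))))
                 (cong (λ i → defect false (lookup p (prev j)) (lookup p i)) (sym (next-prev j)))))))
        (∑-cyc-capped vs (codegree false) (defect false) K (defect-cap false) r (prev j))

      side : ∀ s → ∑ (vecs vs ℓ) (λ p → defects (s , p) * degree (s , p)) ≤ ℓ * (K * W s)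
      side s = begin
        ∑ (vecs vs ℓ) (λ p → defects (s , p) * degree (s , p))
          ≡⟨ ∑-cong (vecs vs ℓ) (λ p → trans (cong (defects (s , p) *_) (degree-cyc s p))
             (sym (∑-*ʳ (allFin ℓ) (cyc (codegree s) p) (λ j → defect s (lookup p j) (lookup p (turn s j)))))) ⟩
        ∑ (vecs vs ℓ) (λ p → ∑ (allFin ℓ) (λ j → defect s (lookup p j) (lookup p (turn s j)) * cyc (codegree s) p))
          ≡⟨ ∑-swap (vecs vs ℓ) (allFin ℓ) _ ⟩
        ∑ (allFin ℓ) (λ j → ∑ (vecs vs ℓ) (λ p → defect s (lookup p j) (lookup p (turn s j)) * cyc (codegree s) p))
          ≤⟨ ∑-mono (allFin ℓ) (single s) ⟩
        ∑ (allFin ℓ) (λ _ → K * W s)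
          ≡⟨ trans (∑-const (allFin ℓ) (K * W s)) (cong (_* (K * W s)) (length-allFin ℓ)) ⟩
        ℓ * (K * W s) ∎

    Hᵍ : ℕ
    Hᵍ = ∑ us (λ u → ∑ us (λ v → good u * good v * a u v))

    H≤ : H ≤ Hᵍ + 2 * (ℓ * (K * walks r))
    H≤ = begin
      ∑ us (λ u → ∑ us (λ v → a u v))
        ≤⟨ ∑-mono us (λ u → ∑-mono us (λ v → pointwise u v)) ⟩
      ∑ us (λ u → ∑ us (λ v → good u * good v * a u v + (defects u * a u v + a u v * defects v)))
        ≡⟨ ∑-cong us (λ u → trans (∑-+ us _ _) (cong (_+_ _) (∑-+ us _ _))) ⟩
      ∑ us (λ u → ∑ us (λ v → good u * good v * a u v) + (∑ us (λ v → defects u * a u v) + ∑ us (λ v → a u v * defects v)))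
        ≡⟨ trans (∑-+ us _ _) (cong (Hᵍ +_) (∑-+ us _ _)) ⟩
      Hᵍ + (∑ us (λ u → ∑ us (λ v → defects u * a u v)) + ∑ us (λ u → ∑ us (λ v → a u v * defects v)))
        ≡⟨ cong (Hᵍ +_) (cong₂ _+_ (∑-cong us (λ u → ∑-*ˡ us (defects u) (a u)))
             (trans (∑-swap us us _) (∑-cong us (λ v → trans (∑-*ʳ us (defects v) (λ u → a u v))
               (trans (*-comm _ (defects v)) (cong (defects v *_) (∑-cong us (λ u → a-sym u v)))))))) ⟩
      Hᵍ + (∑ us (λ u → defects u * degree u) + ∑ us (λ u → defects u * degree u))
        ≤⟨ +-monoʳ-≤ Hᵍ (+-mono-≤ defects-rare defects-rare) ⟩
      Hᵍ + (ℓ * (K * walks r) + ℓ * (K * walks r))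
        ≡⟨ cong (λ t → Hᵍ + (ℓ * (K * walks r) + t)) (+-identityʳ _) ⟨
      Hᵍ + 2 * (ℓ * (K * walks r)) ∎
      where
      distribute : ∀ p q x y a → (p * q + (x + y)) * a ≡ p * q * a + (x * a + a * y)
      distribute = solve-∀
      pointwise : ∀ u v → a u v ≤ good u * good v * a u v + (defects u * a u v + a u v * defects v)
      pointwise u v = begin
        a u v
          ≡⟨ *-identityˡ (a u v) ⟨
        1 * a u v
          ≤⟨ *-monoˡ-≤ (a u v) (covering₂ (good u) (good v) (defects u) (defects v) (good-or-defect u) (good-or-defect v)) ⟩
        (good u * good v + (defects u + defects v)) * a u v
          ≡⟨ distribute (good u) (good v) (defects u) (defects v) (a u v) ⟩
        good u * good v * a u v + (defects u * a u v + a u v * defects v) ∎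

    module _ (e>0 : 0 < e) (e-large : 8 * ℓ * K * (n * n * n) ≤ e * e) where

      σ₀ : Z.σ one 0 ≡ 2 * n
      σ₀ = begin-equality
        ∑ zs (λ _ → 1)                         ≡⟨ ∑-both vs (λ _ → 1) ⟩
        ∑ vs (λ _ → 1) + ∑ vs (λ _ → 1)        ≡⟨ cong (λ t → t + t) (trans (∑-const vs 1) (trans (*-identityʳ _) (length-allFin n))) ⟩
        n + n                                  ≡⟨ cong (n +_) (+-identityʳ n) ⟨
        2 * n                                  ∎

      edges : Z.⟪ one , Z.iter one 1 ⟫₁ ≡ 2 * e
      edges = begin-equality
        ∑ zs (λ z → 1 * (1 * Z.iter one 1 z))
          ≡⟨ ∑-cong zs (λ z → trans (*-identityˡ _) (*-identityˡ _)) ⟩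
        ∑ zs (Z.iter one 1)
          ≡⟨ ∑-both vs _ ⟩
        ∑ vs (λ x → Z.iter one 1 (true , x)) + ∑ vs (λ x → Z.iter one 1 (false , x))
          ≡⟨ cong₂ _+_ (side true) (side false) ⟩
        e + ∑ vs (λ x → ∑ vs (λ y → A y x))
          ≡⟨ cong (e +_) (trans (∑-swap vs vs _) (sym (+-identityʳ e))) ⟩
        2 * e ∎
        where
        side : ∀ s → ∑ vs (λ x → Z.iter one 1 (s , x)) ≡ ∑ vs (λ x → ∑ vs (E s x))
        side s = ∑-cong vs (λ x → trans (∑-bipartite E vs (λ _ → 1) s x) (∑-cong vs (λ y → *-identityʳ (E s x y))))

      -- The Rayleigh quotient of the constant function is the average degree e / n, and by
      -- Cauchy-Schwarz its square is at most the first quotient of the sequence `σ one`.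
      σ-ratio : e * e * Z.σ one 0 ≤ n * n * Z.σ one 1
      σ-ratio = *-cancelˡ-≤ 2 (begin
        2 * (e * e * Z.σ one 0)           ≡⟨ cong (λ t → 2 * (e * e * t)) σ₀ ⟩
        2 * (e * e * (2 * n))             ≡⟨ arrange e n ⟩
        n * (2 * e * (2 * e))             ≡⟨ cong (n *_) (cong₂ _*_ edges edges) ⟨
        n * (Z.⟪ one , Z.iter one 1 ⟫₁ * Z.⟪ one , Z.iter one 1 ⟫₁)
          ≤⟨ *-monoʳ-≤ n (cauchy-schwarz zs (λ _ → 1) one (Z.iter one 1)) ⟩
        n * (Z.σ one 0 * Z.σ one 1)       ≡⟨ cong (λ t → n * (t * Z.σ one 1)) σ₀ ⟩
        n * (2 * n * Z.σ one 1)           ≡⟨ arrange′ n (Z.σ one 1) ⟩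
        2 * (n * n * Z.σ one 1)           ∎)
        where
        arrange : ∀ e n → 2 * (e * e * (2 * n)) ≡ n * (2 * e * (2 * e))
        arrange = solve-∀
        arrange′ : ∀ n s → n * (2 * n * s) ≡ 2 * (n * n * s)
        arrange′ = solve-∀

      module σ-LC = LogConvex (Z.σ one) (Z.σ-convex one)

      σ-top : Z.σ one (suc (suc r)) ≤ 2 * n * H
      σ-top = begin
        Z.σ one (suc (suc r))       ≤⟨ Z.σ≤τσ₀ one (suc r) ⟩
        Z.τ (suc r) * Z.σ one 0     ≡⟨ cong₂ _*_ (sym H≡τ) σ₀ ⟩
        H * (2 * n)                 ≡⟨ *-comm H (2 * n) ⟩
        2 * n * H                   ∎

      instance
        e²≢0 : NonZero (e * e)
        e²≢0 = >-nonZero (*-mono-< e>0 e>0)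

      H>0 : 0 < H
      H>0 = n≢0⇒n>0 λ H≡0 → <⇒≱
        (*-mono-< (m^n>0 (e * e) ℓ) (subst (0 <_) (sym σ₀) (*-mono-< {0} {2} {0} {n} (s≤s z≤n) (>-nonZero⁻¹ n))))
        (begin
          (e * e) ^ ℓ * Z.σ one 0                ≤⟨ σ-LC.growth (e * e) (n * n) σ-ratio ℓ ⟩
          (n * n) ^ ℓ * Z.σ one ℓ                ≤⟨ *-monoʳ-≤ ((n * n) ^ ℓ) σ-top ⟩
          (n * n) ^ ℓ * (2 * n * H)              ≡⟨ cong (λ t → (n * n) ^ ℓ * (2 * n * t)) H≡0 ⟩
          (n * n) ^ ℓ * (2 * n * 0)              ≡⟨ trans (cong ((n * n) ^ ℓ *_) (*-zeroʳ (2 * n))) (*-zeroʳ ((n * n) ^ ℓ)) ⟩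
          0                                      ∎)

      -- One more step multiplies `σ one` by at least e² / n², and the last term is at most 2 n
      -- times `H`; so the opened walks number at most 2 n³ / e² times `H`. The 8 in `e-large`
      -- consists of this 2, a 2 for the two ends of an auxiliary edge, and a 2 to keep half of `H`.
      defects-few : 2 * (2 * (ℓ * (K * walks r))) ≤ H
      defects-few = *-cancelˡ-≤ (e * e) (begin
        e * e * (2 * (2 * (ℓ * (K * walks r))))
          ≤⟨ *-monoʳ-≤ (e * e) (*-monoʳ-≤ 2 (*-monoʳ-≤ 2 (*-monoʳ-≤ ℓ (*-monoʳ-≤ K (walks≤σ r))))) ⟩
        e * e * (2 * (2 * (ℓ * (K * Z.σ one (suc r)))))
          ≡⟨ arrange (e * e) ℓ K (Z.σ one (suc r)) ⟩
        4 * ℓ * K * (e * e * Z.σ one (suc r))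
          ≤⟨ *-monoʳ-≤ (4 * ℓ * K) (σ-LC.ratio-increasing (e * e) (n * n) σ-ratio (suc r)) ⟩
        4 * ℓ * K * (n * n * Z.σ one (suc (suc r)))
          ≤⟨ *-monoʳ-≤ (4 * ℓ * K) (*-monoʳ-≤ (n * n) σ-top) ⟩
        4 * ℓ * K * (n * n * (2 * n * H))
          ≡⟨ arrange′ ℓ K n H ⟩
        8 * ℓ * K * (n * n * n) * H
          ≤⟨ *-monoˡ-≤ H e-large ⟩
        e * e * H ∎)
        where
        arrange : ∀ q l k s → q * (2 * (2 * (l * (k * s)))) ≡ 4 * l * k * (q * s)
        arrange = solve-∀
        arrange′ : ∀ l k n h → 4 * l * k * (n * n * (2 * n * h)) ≡ 8 * l * k * (n * n * n) * h
        arrange′ = solve-∀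

      H≤2Hᵍ : H ≤ 2 * Hᵍ
      H≤2Hᵍ = +-cancelʳ-≤ H H (2 * Hᵍ) (begin
        H + H                                          ≡⟨ cong (H +_) (+-identityʳ H) ⟨
        2 * H                                          ≤⟨ *-monoʳ-≤ 2 H≤ ⟩
        2 * (Hᵍ + 2 * (ℓ * (K * walks r)))             ≡⟨ *-distribˡ-+ 2 Hᵍ _ ⟩
        2 * Hᵍ + 2 * (2 * (ℓ * (K * walks r)))         ≤⟨ +-monoʳ-≤ (2 * Hᵍ) defects-few ⟩
        2 * Hᵍ + H                                     ∎)

      open Kernel us a a-sym w

      instance
        L≢0 : NonZero L
        L≢0 = m^n≢0 R ℓ

      σ-degree₀ : σ degree 0 ≤ L * H
      σ-degree₀ = begin
        ∑ us (λ u → w u * (degree u * degree u))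
          ≡⟨ ∑-cong us (λ u → trans (sym (*-assoc (w u) _ _)) (trans (cong (_* degree u) (w-degree u)) (*-assoc L (good u) _))) ⟩
        ∑ us (λ u → L * (good u * degree u))
          ≤⟨ ∑-mono us (λ u → *-monoʳ-≤ L (≤-trans (*-monoˡ-≤ (degree u) (good≤1 u)) (≤-reflexive (*-identityˡ _)))) ⟩
        ∑ us (λ u → L * degree u)
          ≡⟨ ∑-*ˡ us L degree ⟩
        L * H ∎

      degree-mixed : ⟪ degree , iter degree 1 ⟫₁ ≡ L * L * Hᵍ
      degree-mixed = begin-equality
        ∑ us (λ u → w u * (degree u * ∑ us (λ v → a u v * (w v * degree v))))
          ≡⟨ ∑-cong us (λ u → trans (sym (*-assoc (w u) (degree u) _))
               (cong₂ _*_ (w-degree u) (∑-cong us (λ v → cong (a u v *_) (w-degree v))))) ⟩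
        ∑ us (λ u → L * good u * ∑ us (λ v → a u v * (L * good v)))
          ≡⟨ ∑-cong us (λ u → sym (∑-*ˡ us (L * good u) _)) ⟩
        ∑ us (λ u → ∑ us (λ v → L * good u * (a u v * (L * good v))))
          ≡⟨ ∑² us us (λ u v → arrange L (good u) (a u v) (good v)) ⟩
        ∑ us (λ u → ∑ us (λ v → L * L * (good u * good v * a u v)))
          ≡⟨ ∑∑-*ˡ us us (L * L) _ ⟩
        L * L * Hᵍ ∎
        where
        arrange : ∀ l g a h → l * g * (a * (l * h)) ≡ l * l * (g * h * a)
        arrange = solve-∀

      degree-cs : L * L * Hᵍ * (L * L * Hᵍ) ≤ σ degree 0 * σ degree 1
      degree-cs = subst (λ t → t * t ≤ σ degree 0 * σ degree 1) degree-mixed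
        (cauchy-schwarz us w degree (iter degree 1))

      Hᵍ>0 : 0 < Hᵍ
      Hᵍ>0 = n≢0⇒n>0 λ Hᵍ≡0 → <⇒≱ H>0 (subst (λ t → H ≤ 2 * t) Hᵍ≡0 H≤2Hᵍ)

      σ-degree₀>0 : 0 < σ degree 0
      σ-degree₀>0 = n≢0⇒n>0 λ σ≡0 → <⇒≱ (*-mono-< LLH>0 LLH>0)
        (subst (λ t → L * L * Hᵍ * (L * L * Hᵍ) ≤ t * σ degree 1) σ≡0 degree-cs)
        where
        LLH>0 : 0 < L * L * Hᵍ
        LLH>0 = *-mono-< (*-mono-< (>-nonZero⁻¹ L) (>-nonZero⁻¹ L)) Hᵍ>0

      -- If all tuples were good, `degree` would be an eigenfunction with eigenvalue L, which is why
      -- it is the test function. The good tuples retain at least half of the auxiliary edges; this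
      -- loss of 2 enters squared.
      σ-degree-ratio : L * L * σ degree 0 ≤ 4 * σ degree 1
      σ-degree-ratio = *-cancelˡ-≤ (σ degree 0) {{>-nonZero σ-degree₀>0}} (begin
        σ degree 0 * (L * L * σ degree 0)
          ≡⟨ arrange₁ L (σ degree 0) ⟩
        L * L * (σ degree 0 * σ degree 0)
          ≤⟨ *-monoʳ-≤ (L * L) (*-mono-≤ bound bound) ⟩
        L * L * (L * (2 * Hᵍ) * (L * (2 * Hᵍ)))
          ≡⟨ arrange₂ L Hᵍ ⟩
        4 * (L * L * Hᵍ * (L * L * Hᵍ))
          ≤⟨ *-monoʳ-≤ 4 degree-cs ⟩
        4 * (σ degree 0 * σ degree 1)
          ≡⟨ x∙yz≈y∙xz 4 (σ degree 0) _ ⟩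
        σ degree 0 * (4 * σ degree 1) ∎)
        where
        bound : σ degree 0 ≤ L * (2 * Hᵍ)
        bound = ≤-trans σ-degree₀ (*-monoʳ-≤ L H≤2Hᵍ)
        arrange₁ : ∀ l s → s * (l * l * s) ≡ l * l * (s * s)
        arrange₁ = solve-∀
        arrange₂ : ∀ l h → l * l * (l * (2 * h) * (l * (2 * h))) ≡ 4 * (l * l * h * (l * l * h))
        arrange₂ = solve-∀

      closed-walks-many : ∀ j → (L * L) ^ suc j ≤ 4 ^ suc j * τ j
      closed-walks-many j = *-cancelʳ-≤ _ _ (σ degree 0) {{>-nonZero σ-degree₀>0}} (begin
        (L * L) ^ suc j * σ degree 0
          ≤⟨ LogConvex.growth (σ degree) (σ-convex degree) (L * L) 4 σ-degree-ratio (suc j) ⟩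
        4 ^ suc j * σ degree (suc j)
          ≤⟨ *-monoʳ-≤ (4 ^ suc j) (σ≤τσ₀ degree j) ⟩
        4 ^ suc j * (τ j * σ degree 0)
          ≡⟨ *-assoc (4 ^ suc j) (τ j) _ ⟨
        4 ^ suc j * τ j * σ degree 0 ∎)

  -- Parity along a closed walk

  even : ℕ → Bool
  even zero    = true
  even (suc t) = not (even t)

  even⇒2∣ : ∀ t → even t ≡ true → 2 ∣ t
  even⇒2∣ zero          _  = divides 0 refl
  even⇒2∣ (suc (suc t)) eq with even⇒2∣ t (trans (sym (not-involutive (even t))) eq)
  ... | divides q refl = divides (suc q) refl

  even-gap : ∀ i d → even i ≡ even (i + d) → ∃ λ p → d ≡ p + p
  even-gap i zero          _  = 0 , refl
  even-gap i (suc zero)    eq = contradiction (trans eq (cong even (+-comm i 1))) (b≢not-b (even i))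
    where
    b≢not-b : ∀ b → b ≢ not b
    b≢not-b true  ()
    b≢not-b false ()
  even-gap i (suc (suc d)) eq with even-gap i d
    (trans eq (trans (cong even (trans (+-suc i (suc d)) (cong suc (+-suc i d)))) (not-involutive (even (i + d)))))
  ... | p , refl = suc p , cong suc (sym (+-suc p p))

  even-gap⁺ : ∀ i i′ → i < i′ → even i ≡ even i′ → ∃ λ p → i′ ≡ i + suc (suc (p + p))
  even-gap⁺ i i′ i<i′ eq with m≤n⇒∃[o]m+o≡n i<i′
  ... | d , refl with even-gap i (suc d) (trans eq (cong even (sym (+-suc i d))))
  ...   | suc p , refl = p , trans (sym (+-suc i _)) (cong (λ t → i + suc t) (+-suc p p))

  flip-by : Bool → Bool → Bool
  flip-by true  s = s
  flip-by false s = not s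

  flip-by-not : ∀ b s → not (flip-by b s) ≡ flip-by (not b) s
  flip-by-not true  s = refl
  flip-by-not false s = not-involutive s

  flip-by-injective : ∀ b b′ s → flip-by b s ≡ flip-by b′ s → b ≡ b′
  flip-by-injective true  true  s     _ = refl
  flip-by-injective false false s     _ = refl
  flip-by-injective true  false true  ()
  flip-by-injective true  false false ()
  flip-by-injective false true  true  ()
  flip-by-injective false true  false ()

  -- In the application t₀, t and t′ are `T 0`, `T (suc r)` and `T (suc (suc r))`. In the power m =
  -- j + 1 of the linear inequality, the chord bound replaces t ^ m by t₀ * t′ ^ j and the lower
  -- bound replaces M ^ m by 4 ^ m * t′, so all powers of t′ cancel.
  cutoff : ∀ (K q M t₀ t t′ j : ℕ) → 0 < t′ → t ^ suc j ≤ t₀ * t′ ^ j →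
    K * t′ ≤ q * (M * t) → M ^ suc j ≤ 4 ^ suc j * t′ → K ^ suc j ≤ (4 * q) ^ suc j * t₀
  cutoff K q M t₀ t t′ j t′>0 chord step many =
    *-cancelʳ-≤ _ _ t′ {{>-nonZero t′>0}} (*-cancelʳ-≤ _ _ (t′ ^ j) {{m^n≢0 t′ j {{>-nonZero t′>0}}}} (begin
      K ^ m * t′ * t′ ^ j                    ≡⟨ trans (*-assoc (K ^ m) t′ _) (sym (^-*-distrib K t′ m)) ⟩
      (K * t′) ^ m                           ≤⟨ ^-monoˡ-≤ m step ⟩
      (q * (M * t)) ^ m                      ≡⟨ trans (^-*-distrib q _ m) (cong (q ^ m *_) (^-*-distrib M t m)) ⟩
      q ^ m * (M ^ m * t ^ m)                ≤⟨ *-monoʳ-≤ (q ^ m) (*-mono-≤ many chord) ⟩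
      q ^ m * (4 ^ m * t′ * (t₀ * t′ ^ j))   ≡⟨ arrange (q ^ m) (4 ^ m) t′ t₀ (t′ ^ j) ⟩
      4 ^ m * q ^ m * t₀ * t′ * t′ ^ j       ≡⟨ cong (λ s → s * t₀ * t′ * t′ ^ j) (^-*-distrib 4 q m) ⟨
      (4 * q) ^ m * t₀ * t′ * t′ ^ j         ∎))
    where
    open ≤-Reasoning
    m = suc j
    arrange : ∀ a b c d e → a * (b * c * (d * e)) ≡ b * a * d * c * e
    arrange = solve-∀

  -- Two kinds of conflict for each pair of places (i , j), (i′ , j′).
  abstract
    events : ℕ → ℕ → ℕ
    events k ℓ = k * (k * (ℓ * (ℓ * 2)))

    events-* : ∀ k ℓ b → k * (k * (ℓ * (ℓ * (b + b)))) ≡ events k ℓ * b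
    events-* = expanded
      where
      expanded : ∀ k ℓ b → k * (k * (ℓ * (ℓ * (b + b)))) ≡ k * (k * (ℓ * (ℓ * 2))) * b
      expanded = solve-∀

    events>0 : ∀ k ℓ .{{_ : NonZero k}} .{{_ : NonZero ℓ}} → 0 < events k ℓ
    events>0 (suc _) (suc _) = s≤s z≤n

  -- An upper bound for the weight of walks with coinciding entries

  module Conflicts {U : Set} (us : List U) (a : U → U → ℕ) (a-sym : ∀ x y → a x y ≡ a y x) (w : U → ℕ)
    (K L : ℕ) (degree≤L : ∀ x → w x * ∑ us (a x) ≤ L)
    {C : Set} (cs : List C) {ℓ : ℕ} (D : Fin ℓ → C → U → ℕ)
    (D-sparse : ∀ j → Kernel.Sparse us a a-sym w cs K L degree≤L (D j))
    (coincide : Fin ℓ → Fin ℓ → U → ℕ) (coincide≤1 : ∀ j j′ u → coincide j j′ u ≤ 1)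
    (coincide-sparse : ∀ j j′ → j ≢ j′ → ∀ u → K * (w u * ∑ us (λ v → a u v * coincide j j′ v)) ≤ L)
    (r : ℕ) where

    open ≤-Reasoning
    open Kernel us a a-sym w
    open ClosedWalks us a a-sym w

    k : ℕ
    k = suc (suc (suc r + suc r))

    gap? : (i i′ : Fin k) → Dec (toℕ i < toℕ i′ × even (toℕ i) ≡ even (toℕ i′))
    gap? i i′ = (toℕ i <? toℕ i′) ×-dec (even (toℕ i) ≟ᵇ even (toℕ i′))

    -- Entries at odd distance lie on opposite sides and cannot coincide, hence the parity condition
    -- in the first kind. The second kind does not depend on i′; it is repeated for every i′ so that
    -- a single fourfold sum covers both.
    conflict : Fin k → Fin k → Fin ℓ → Fin ℓ → Vec U k → ℕ
    conflict i i′ j j′ v = ⟪ gap? i i′ ⟫ * pair cs (D j) (D j′) i i′ v + ⟪ ¬? (j ≟ᶠ j′) ⟫ * coincide j j′ (lookup v i)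

    conflicts-at : Fin k → Fin k → Vec U k → ℕ
    conflicts-at i i′ v = ∑ (allFin ℓ) λ j → ∑ (allFin ℓ) λ j′ → conflict i i′ j j′ v

    conflicts : Vec U k → ℕ
    conflicts v = ∑ (allFin k) λ i → ∑ (allFin k) λ i′ → conflicts-at i i′ v

    conflict-free : ∀ v → conflicts v ≡ 0 → ∀ i i′ j j′ → conflict i i′ j j′ v ≡ 0
    conflict-free v none i i′ j j′ =
      ∑≡0 (λ j′ → conflict i i′ j j′ v)
        (∑≡0 (λ j → ∑ (allFin ℓ) λ j′ → conflict i i′ j j′ v)
          (∑≡0 (λ i′ → conflicts-at i i′ v)
            (∑≡0 (λ i → ∑ (allFin k) λ i′ → conflicts-at i i′ v) none (∈-allFin i)) (∈-allFin i′)) (∈-allFin j)) (∈-allFin j′)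

    limit : ℕ
    limit = L * (L * τ r)

    conflict-bound : ∀ i i′ j j′ → K * marked (conflict i i′ j j′) ≤ limit + limit
    conflict-bound i i′ j j′ = begin
      K * marked (conflict i i′ j j′)
        ≡⟨ cong (K *_) (marked-+ F₁ F₂) ⟩
      K * (marked F₁ + marked F₂)
        ≡⟨ *-distribˡ-+ K (marked F₁) (marked F₂) ⟩
      K * marked F₁ + K * marked F₂
        ≤⟨ +-mono-≤ (marked-if K limit (gap? i i′) (pair cs (D j) (D j′) i i′) apart)
                    (marked-if K limit (¬? (j ≟ᶠ j′)) (λ v → coincide j j′ (lookup v i)) together) ⟩
      limit + limit ∎
      where
      F₁ F₂ : Vec U k → ℕ
      F₁ v = ⟪ gap? i i′ ⟫ * pair cs (D j) (D j′) i i′ v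
      F₂ v = ⟪ ¬? (j ≟ᶠ j′) ⟫ * coincide j j′ (lookup v i)

      apart : toℕ i < toℕ i′ × even (toℕ i) ≡ even (toℕ i′) → K * marked (pair cs (D j) (D j′) i i′) ≤ limit
      apart (i<i′ , eq) with even-gap⁺ (toℕ i) (toℕ i′) i<i′ eq
      ... | p , gap = pair-bound cs (D j) (D j′) K L degree≤L (D-sparse j) (D-sparse j′) r i i′ p gap

      together : j ≢ j′ → K * marked (λ v → coincide j j′ (lookup v i)) ≤ limit
      together j≢j′ = subst (λ t → K * t ≤ limit) (sym (marked-lookup (coincide j j′) i))
        (diagonal-bound K L degree≤L (coincide j j′) (coincide≤1 j j′)
          (coincide-sparse j j′ j≢j′) r)

    q : ℕ
    q = events k ℓ

    conflicts-bound : K * marked conflicts ≤ q * limit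
    conflicts-bound = ≤-trans
      (sum k (λ i v → ∑ (allFin k) (λ i′ → conflicts-at i i′ v)) (k * (ℓ * (ℓ * (limit + limit)))) λ i →
       sum k (λ i′ → conflicts-at i i′) (ℓ * (ℓ * (limit + limit))) λ i′ →
       sum ℓ (λ j v → ∑ (allFin ℓ) (λ j′ → conflict i i′ j j′ v)) (ℓ * (limit + limit)) λ j →
       sum ℓ (λ j′ → conflict i i′ j j′) (limit + limit) λ j′ →
       conflict-bound i i′ j j′)
      (≤-reflexive (events-* k ℓ limit))
      where
      sum : ∀ m (F : Fin m → Vec U k → ℕ) b → (∀ i → K * marked (F i) ≤ b) →
            K * marked (λ v → ∑ (allFin m) (λ i → F i v)) ≤ m * b
      sum m F b bound = subst (λ t → K * marked (λ v → ∑ (allFin m) (λ i → F i v)) ≤ t * b) (length-allFin m)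
        (marked-∑ K b (allFin m) F bound)

    -- The index is half the length of the closed walks: `τ j` belongs to length 2 j + 2, and at
    -- length 0 each tuple counts once.
    T : ℕ → ℕ
    T zero    = length us
    T (suc j) = τ j

    T-convex : (∀ x → x ∈ us) → ∀ j → T (suc j) * T (suc j) ≤ T j * T (suc (suc j))
    T-convex x∈us zero    = τ₀-convex x∈us
    T-convex x∈us (suc j) = τ-convex j

    K-bounded : (∀ x → x ∈ us) → 0 < L → (L * L) ^ suc (suc r) ≤ 4 ^ suc (suc r) * τ (suc r) →
                (∀ v → 0 < cyc f v → 0 < conflicts v) →
                K ^ suc (suc r) ≤ (4 * q) ^ suc (suc r) * length us
    K-bounded x∈us L>0 many clash =
      cutoff K q (L * L) (length us) (τ r) (τ (suc r)) (suc r) τ>0 (LogConvex.chord T (T-convex x∈us) (suc r)) step many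
      where
      τ>0 : 0 < τ (suc r)
      τ>0 = n≢0⇒n>0 λ τ≡0 → <⇒≱ (m^n>0 (L * L) {{>-nonZero (*-mono-< L>0 L>0)}} (suc (suc r)))
        (≤-trans many (≤-reflexive (trans (cong (4 ^ suc (suc r) *_) τ≡0) (*-zeroʳ (4 ^ suc (suc r))))))

      step : K * τ (suc r) ≤ q * (L * L * τ r)
      step = begin
        K * τ (suc r)             ≡⟨ cong (K *_) (total (suc r)) ⟨
        K * marked {k} (λ _ → 1)   ≤⟨ *-monoʳ-≤ K (marked-mono (λ _ → 1) conflicts clash) ⟩
        K * marked conflicts       ≤⟨ conflicts-bound ⟩
        q * (L * (L * τ r))       ≡⟨ cong (q *_) (*-assoc L L (τ r)) ⟨
        q * (L * L * τ r)         ∎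

  -- Tori from closed walks of tuples

  module Embedding {n k ℓ : ℕ} (G : Graph n) (colour : Fin n → Bool) where

    crossing? : (x y : Fin n) → Dec (Adj G x y × colour x ≡ true × colour y ≡ false)
    crossing? x y = Adj? G x y ×-dec (colour x ≟ᵇ true) ×-dec (colour y ≟ᵇ false)

    -- Both sides are indexed by all of `Fin n`. Orienting the edges from colour true to colour
    -- false makes the colour of an entry reveal the side of its tuple, so entries of different
    -- sides are different vertices of G.
    crossing : Fin n → Fin n → ℕ
    crossing x y = ⟪ crossing? x y ⟫

    crossing≤1 : ∀ x y → crossing x y ≤ 1
    crossing≤1 x y = ⟪⟫≤1 (crossing? x y)

    open Tuples crossing crossing≤1 ℓ

    E-positive : ∀ s x y → 0 < E s x y → Adj G x y × colour x ≡ s × colour y ≡ not s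
    E-positive true  x y 0<E = ⟪⟫-positive (crossing? x y) 0<E
    E-positive false x y 0<E with ⟪⟫-positive (crossing? y x) 0<E
    ... | yx , y≡true , x≡false = Graph.Adj-sym G yx , x≡false , y≡true

    M-positive : ∀ s p q → 0 < M s p q → ∀ j →
      0 < E s (lookup p j) (lookup q j) × 0 < E s (lookup p (turn s j)) (lookup q j)
    M-positive s p q 0<M j = *-positive _ _ (∏-positive _ 0<M j)

    a-positive : ∀ u v → 0 < a u v → proj₁ v ≡ not (proj₁ u) × 0 < M (proj₁ u) (proj₂ u) (proj₂ v)
    a-positive (true  , p) (false , q) 0<a = refl , 0<a
    a-positive (false , p) (true  , q) 0<a = refl , 0<a

    module Walk (u : Fin k → U) (edge : ∀ i → 0 < a (u i) (u (next i))) where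

      side : Fin k → Bool
      side i = proj₁ (u i)

      vertex : Fin k → Fin ℓ → Fin n
      vertex i = lookup (proj₂ (u i))

      side-next : ∀ i → side (next i) ≡ not (side i)
      side-next i = proj₁ (a-positive (u i) (u (next i)) (edge i))

      step-positive : ∀ i j → 0 < E (side i) (vertex i j) (vertex (next i) j)
                            × 0 < E (side i) (vertex i (turn (side i) j)) (vertex (next i) j)
      step-positive i = M-positive (side i) (proj₂ (u i)) (proj₂ (u (next i)))
        (proj₂ (a-positive (u i) (u (next i)) (edge i)))

      colour-side : ∀ i j → colour (vertex i j) ≡ side i
      colour-side i j = proj₁ (proj₂ (E-positive (side i) _ _ (proj₁ (step-positive i j))))

      straight : ∀ i j → Adj G (vertex i j) (vertex (next i) j)
      straight i j = proj₁ (E-positive (side i) _ _ (proj₁ (step-positive i j)))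

      slanted : ∀ i j → Adj G (vertex i (turn (side i) j)) (vertex (next i) j)
      slanted i j = proj₁ (E-positive (side i) _ _ (proj₂ (step-positive i j)))

  side-even : ∀ {k} (s : Fin (suc k) → Bool) → (∀ i → s (next i) ≡ not (s i)) →
              ∀ i → s i ≡ flip-by (even (toℕ i)) (s zero)
  side-even s alternate = <-weakInduction (λ i → s i ≡ flip-by (even (toℕ i)) (s zero)) refl step
    where
    open ≡-Reasoning
    step : ∀ i → s (inject₁ i) ≡ flip-by (even (toℕ (inject₁ i))) (s zero) → s (suc i) ≡ flip-by (not (even (toℕ i))) (s zero)
    step i ih = begin
      s (suc i)                                      ≡⟨ cong s (next-inject₁ i) ⟨
      s (next (inject₁ i))                           ≡⟨ alternate (inject₁ i) ⟩
      not (s (inject₁ i))                            ≡⟨ cong not ih ⟩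
      not (flip-by (even (toℕ (inject₁ i))) (s zero)) ≡⟨ cong (λ t → not (flip-by (even t) (s zero))) (toℕ-inject₁ i) ⟩
      not (flip-by (even (toℕ i)) (s zero))          ≡⟨ flip-by-not (even (toℕ i)) (s zero) ⟩
      flip-by (not (even (toℕ i))) (s zero)          ∎

  module _ {n k ℓ : ℕ} (G : Graph n) (colour : Fin n → Bool) (4≤k : 4 ≤ suc k) where

    open Embedding {n} {suc k} {ℓ} G colour
    open Tuples crossing crossing≤1 ℓ

    -- Place i of the walk is row toℕ i + 1 of the torus. Starting on the side true puts the odd
    -- rows on the side whose `turn` is `next`, as their slanted edges demand.
    embed : (u : Fin (suc k) → U) (edge : ∀ i → 0 < a (u i) (u (next i))) → proj₁ (u zero) ≡ true →
      (∀ i j i′ j′ → lookup (proj₂ (u i)) j ≡ lookup (proj₂ (u i′)) j′ → i ≡ i′ × j ≡ j′) →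
      torus (suc k) ℓ 4≤k ⊑ G
    embed u edge start inj = g , g-injective , g-hom
      where
      open Walk u edge

      g : Fin (suc k * ℓ) → Fin n
      g z = vertex (proj₁ (remQuot ℓ z)) (proj₂ (remQuot ℓ z))

      g-x : ∀ i j → g (Defs.x i j) ≡ vertex i j
      g-x i j = cong (λ (i , j) → vertex i j) (remQuot-combine i j)

      g-injective : Injective _≡_ _≡_ g
      g-injective {z} {z′} eq with inj _ _ _ _ eq
      ... | i≡ , j≡ = trans (sym (combine-remQuot {suc k} ℓ z)) (trans (cong₂ combine i≡ j≡) (combine-remQuot {suc k} ℓ z′))

      side-parity : ∀ i → side i ≡ even (toℕ i)
      side-parity i = trans (side-even side side-next i) (trans (cong (flip-by (even (toℕ i))) start) (flip-true (even (toℕ i))))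
        where
        flip-true : ∀ b → flip-by b true ≡ b
        flip-true true  = refl
        flip-true false = refl

      odd-row : ∀ t → 2 ∤ suc t → even t ≡ true
      odd-row t 2∤ with even t in eq
      ... | true  = refl
      ... | false = contradiction (even⇒2∣ (suc t) (cong not eq)) 2∤

      even-row : ∀ t → 2 ∣ suc t → even t ≡ false
      even-row t 2∣ with even t in eq
      ... | false = refl
      ... | true  = contradiction (∣1⇒≡1 (∣m+n∣m⇒∣n (subst (2 ∣_) (+-comm 1 t) 2∣) (even⇒2∣ t eq))) λ ()

      g-edge : ∀ z z′ → TorusEdge (suc k) ℓ z z′ → Adj G (g z) (g z′)
      g-edge _ _ (i , j , inj₁ (refl , refl)) = subst₂ (Adj G) (sym (g-x i j)) (sym (g-x (next i) j)) (straight i j)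
      g-edge _ _ (i , j , inj₂ (inj₁ (2∤ , refl , refl))) =
        subst₂ (Adj G) (sym (g-x i (next j))) (sym (g-x (next i) j))
          (subst (λ s → Adj G (vertex i (turn s j)) (vertex (next i) j)) (trans (side-parity i) (odd-row (toℕ i) 2∤)) (slanted i j))
      -- On even rows `turn` is `prev`, so the slanted edge is taken at `next j`, from where it
      -- leads back to j.
      g-edge _ _ (i , j , inj₂ (inj₂ (2∣ , refl , refl))) =
        subst₂ (Adj G) (sym (g-x i j)) (sym (g-x (next i) (next j)))
          (subst (λ j′ → Adj G (vertex i j′) (vertex (next i) (next j))) (prev-next j)
            (subst (λ s → Adj G (vertex i (turn s (next j))) (vertex (next i) (next j)))
                   (trans (side-parity i) (even-row (toℕ i) 2∣)) (slanted i (next j))))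

      g-hom : ∀ z z′ → Adj (torus (suc k) ℓ 4≤k) z z′ → Adj G (g z) (g z′)
      g-hom z z′ (inj₁ e) = g-edge z z′ e
      g-hom z z′ (inj₂ e) = Graph.Adj-sym G (g-edge z′ z e)

    embed′ : (u : Fin (suc k) → U) (edge : ∀ i → 0 < a (u i) (u (next i))) →
      (∀ i j i′ j′ → lookup (proj₂ (u i)) j ≡ lookup (proj₂ (u i′)) j′ → i ≡ i′ × j ≡ j′) →
      torus (suc k) ℓ 4≤k ⊑ G
    embed′ u edge inj with proj₁ (u zero) in start
    ... | true  = embed u edge start inj
    -- Shifting the walk by one step makes it start on the side true.
    ... | false = embed (u ∘ next) (edge ∘ next)
      (trans (Walk.side-next u edge zero) (cong not start))
      (λ i j i′ j′ eq → let (i≡ , j≡) = inj _ j _ j′ eq in next-injective i≡ , j≡)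

  -- ι t is n ! / t for K ≤ t.
  reciprocals : ∀ n K → 0 < K → Σ[ ι ∈ (ℕ → ℕ) ]
    (∀ t → t ≤ n → ι t * t ≡ n ! * ⟪ K ≤? t ⟫) × (∀ t → t ≤ n → K * ι t ≤ n !)
  reciprocals n K K>0 = (λ t → ι t (K ≤? t) (t ≤? n)) , (λ t → inverse t (K ≤? t) (t ≤? n)) , (λ t → bound t (K ≤? t) (t ≤? n))
    where
    divisor : ∀ t → K ≤ t → t ≤ n → t ∣ n !
    divisor zero      K≤t _   = contradiction K≤t (<⇒≱ K>0)
    divisor t@(suc s) _   t≤n = ∣-trans (m∣m*n (s !)) (m≤n⇒m!∣n! t≤n)

    ι : ∀ t → Dec (K ≤ t) → Dec (t ≤ n) → ℕ
    ι t (yes K≤t) (yes t≤n) = _∣_.quotient (divisor t K≤t t≤n)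
    ι t _         _         = 0

    inverse : ∀ t (K≤?t : Dec (K ≤ t)) (t≤?n : Dec (t ≤ n)) → t ≤ n → ι t K≤?t t≤?n * t ≡ n ! * ⟪ K≤?t ⟫
    inverse t (yes K≤t) (yes t≤n) _   = trans (sym (_∣_.equality (divisor t K≤t t≤n))) (sym (*-identityʳ (n !)))
    inverse t (yes _)   (no t≰n)  t≤n = contradiction t≤n t≰n
    inverse t (no _)    _         _   = sym (*-zeroʳ (n !))

    bound : ∀ t (K≤?t : Dec (K ≤ t)) (t≤?n : Dec (t ≤ n)) → t ≤ n → K * ι t K≤?t t≤?n ≤ n !
    bound t (yes K≤t) (yes t≤n) _ = begin
      K * _∣_.quotient (divisor t K≤t t≤n)   ≤⟨ *-monoˡ-≤ (_∣_.quotient (divisor t K≤t t≤n)) K≤t ⟩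
      t * _∣_.quotient (divisor t K≤t t≤n)   ≡⟨ *-comm t _ ⟩
      _∣_.quotient (divisor t K≤t t≤n) * t   ≡⟨ _∣_.equality (divisor t K≤t t≤n) ⟨
      n !                                    ∎
      where open ≤-Reasoning
    bound t (yes _)   (no t≰n)  t≤n = contradiction t≤n t≰n
    bound t (no _)    _         _   = subst (_≤ n !) (sym (*-zeroʳ K)) z≤n

  -- Bipartite subgraphs

  differ : Bool → Bool → ℕ
  differ true  false = 1
  differ false true  = 1
  differ _     _     = 0

  differ-not : ∀ s t → differ s t + differ (not s) t ≡ 1
  differ-not true  true  = refl
  differ-not true  false = refl
  differ-not false true  = refl
  differ-not false false = refl

  -- Every new vertex is coloured so as to cut at least half of its edges to the earlier ones.
  max-cut : ∀ n (b : Fin n → Fin n → ℕ) → ∃ λ (c : Fin n → Bool) →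
    ∑ (allFin n) (λ x → ∑ (allFin n) (b x))
      ≤ 2 * ∑ (allFin n) (λ x → ∑ (allFin n) (λ y → b x y * differ (c x) (c y))) + ∑ (allFin n) (λ x → b x x)
  max-cut zero    b = (λ ()) , z≤n
  max-cut (suc n) b = colour , (begin
    ∑ (allFin (suc n)) (λ x → ∑ (allFin (suc n)) (b x))
      ≡⟨ split b ⟩
    b zero zero + (star b + ∑ (allFin n) (λ x → ∑ (allFin n) (b⁺ x)))
      ≤⟨ +-monoʳ-≤ (b zero zero) (+-mono-≤ star-cut cut) ⟩
    b zero zero + (2 * star b′ + (2 * rest + loops))
      ≤⟨ m≤m+n _ (2 * b′ zero zero) ⟩
    b zero zero + (2 * star b′ + (2 * rest + loops)) + 2 * b′ zero zero
      ≡⟨ arrange (b zero zero) (star b′) rest loops (b′ zero zero) ⟩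
    2 * (b′ zero zero + (star b′ + rest)) + (b zero zero + loops)
      ≡⟨ cong₂ (λ s t → 2 * s + t) (split b′) (∑-allFin-suc (λ x → b x x)) ⟨
    2 * ∑ (allFin (suc n)) (λ x → ∑ (allFin (suc n)) (b′ x)) + ∑ (allFin (suc n)) (λ x → b x x) ∎)
    where
    open ≤-Reasoning

    b⁺ : Fin n → Fin n → ℕ
    b⁺ x y = b (suc x) (suc y)

    c : Fin n → Bool
    c = proj₁ (max-cut n b⁺)
    cut = proj₂ (max-cut n b⁺)

    rest loops : ℕ
    rest  = ∑ (allFin n) (λ x → ∑ (allFin n) (λ y → b⁺ x y * differ (c x) (c y)))
    loops = ∑ (allFin n) (λ x → b⁺ x x)

    inner : (Fin (suc n) → Fin (suc n) → ℕ) → ℕ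
    inner b = ∑ (allFin n) (λ x → ∑ (allFin n) (λ y → b (suc x) (suc y)))

    star : (Fin (suc n) → Fin (suc n) → ℕ) → ℕ
    star b = ∑ (allFin n) (λ y → b zero (suc y) + b (suc y) zero)

    split : ∀ b → ∑ (allFin (suc n)) (λ x → ∑ (allFin (suc n)) (b x))
                  ≡ b zero zero + (star b + inner b)
    split b = begin-equality
      ∑ (allFin (suc n)) (λ x → ∑ (allFin (suc n)) (b x))
        ≡⟨ trans (∑-cong (allFin (suc n)) (λ x → ∑-allFin-suc (b x))) (∑-allFin-suc (λ x → b x zero + ∑ (allFin n) (λ y → b x (suc y)))) ⟩
      b zero zero + ∑ (allFin n) (λ y → b zero (suc y)) + ∑ (allFin n) (λ x → b (suc x) zero + ∑ (allFin n) (λ y → b (suc x) (suc y)))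
        ≡⟨ cong (b zero zero + ∑ (allFin n) (λ y → b zero (suc y)) +_) (∑-+ (allFin n) _ _) ⟩
      b zero zero + ∑ (allFin n) (λ y → b zero (suc y)) + (∑ (allFin n) (λ x → b (suc x) zero) + inner b)
        ≡⟨ trans (regroup (b zero zero) _ _ _) (cong (λ t → b zero zero + (t + inner b))
             (sym (∑-+ (allFin n) (λ y → b zero (suc y)) (λ y → b (suc y) zero)))) ⟩
      b zero zero + (star b + inner b) ∎
      where
      regroup : ∀ p q r s → p + q + (r + s) ≡ p + (q + r + s)
      regroup = solve-∀

    part : Bool → ℕ
    part s = ∑ (allFin n) (λ y → (b zero (suc y) + b (suc y) zero) * differ s (c y))

    parts : star b ≡ part true + part false
    parts = trans (∑-cong (allFin n) (λ y → trans (sym (*-identityʳ (b zero (suc y) + b (suc y) zero)))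
        (trans (cong ((b zero (suc y) + b (suc y) zero) *_) (sym (differ-not true (c y)))) (*-distribˡ-+ (b zero (suc y) + b (suc y) zero) _ _))))
      (∑-+ (allFin n) _ _)

    best : ∃ λ s → star b ≤ 2 * part s
    best with ≤-total (part true) (part false)
    ... | inj₁ t≤f = false , subst₂ _≤_ (sym parts) (cong (part false +_) (sym (+-identityʳ _))) (+-monoˡ-≤ (part false) t≤f)
    ... | inj₂ f≤t = true  , subst₂ _≤_ (sym parts) (cong (part true +_) (sym (+-identityʳ _))) (+-monoʳ-≤ (part true) f≤t)

    colour : Fin (suc n) → Bool
    colour zero    = proj₁ best
    colour (suc y) = c y

    b′ : Fin (suc n) → Fin (suc n) → ℕ
    b′ x y = b x y * differ (colour x) (colour y)

    differ-sym : ∀ s t → differ s t ≡ differ t s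
    differ-sym true  true  = refl
    differ-sym true  false = refl
    differ-sym false true  = refl
    differ-sym false false = refl

    star-cut : star b ≤ 2 * star b′
    star-cut = ≤-trans (proj₂ best) (≤-reflexive (cong (2 *_) (∑-cong (allFin n) (λ y →
      trans (*-distribʳ-+ (differ (proj₁ best) (c y)) (b zero (suc y)) (b (suc y) zero))
            (cong (λ t → b′ zero (suc y) + b (suc y) zero * t) (differ-sym (proj₁ best) (c y)))))))

    arrange : ∀ p s t d z → p + (2 * s + (2 * t + d)) + 2 * z ≡ 2 * (z + (s + t)) + (p + d)
    arrange = solve-∀

  length-filter : {P : A → Set} (P? : ∀ x → Dec (P x)) (xs : List A) → length (filter P? xs) ≡ ∑ xs (λ x → ⟪ P? x ⟫)
  length-filter P? []       = refl
  length-filter P? (x ∷ xs) with P? x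
  ... | yes _ = cong suc (length-filter P? xs)
  ... | no _  = length-filter P? xs

  -- One factor 2 is lost in the cut. The other is lost by giving up the order x < y, after which
  -- both orders of the two ends of a cut edge are counted.
  bipartition : ∀ {n k ℓ} (G : Graph n) → ∃ λ colour →
    ∣E G ∣ ≤ 4 * ∑ (allFin n) (λ x → ∑ (allFin n) (Embedding.crossing {n} {k} {ℓ} G colour x))
  bipartition {n} {k} {ℓ} G = colour , (begin
    ∣E G ∣
      ≡⟨ trans (length-filter (Edge? G) (cartesianProduct (allFin n) (allFin n))) (∑-product (allFin n) (allFin n) b) ⟩
    ∑ (allFin n) (λ x → ∑ (allFin n) (b x))
      ≤⟨ proj₂ (max-cut n b) ⟩
    2 * ∑ (allFin n) (λ x → ∑ (allFin n) (λ y → b x y * differ (colour x) (colour y))) + ∑ (allFin n) (λ x → b x x)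
      ≡⟨ trans (cong (2 * cut +_) (trans
           (∑-cong (allFin n) (λ x → ⟪⟫-no (Edge? G (x , x)) (λ (x<x , _) → <-irrefl refl x<x))) (∑-zero (allFin n)))) (+-identityʳ _) ⟩
    2 * ∑ (allFin n) (λ x → ∑ (allFin n) (λ y → b x y * differ (colour x) (colour y)))
      ≤⟨ *-monoʳ-≤ 2 (∑-mono (allFin n) (λ x → ∑-mono (allFin n) (λ y → oriented x y (colour x) (colour y) refl refl))) ⟩
    2 * ∑ (allFin n) (λ x → ∑ (allFin n) (λ y → crossing x y + crossing y x))
      ≡⟨ cong (2 *_) (trans (∑-cong (allFin n) (λ x → ∑-+ (allFin n) (crossing x) (λ y → crossing y x)))
           (trans (∑-+ (allFin n) _ _) (cong (∑ (allFin n) (λ x → ∑ (allFin n) (crossing x)) +_)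
             (∑-swap (allFin n) (allFin n) (λ x y → crossing y x))))) ⟩
    2 * (∑ (allFin n) (λ x → ∑ (allFin n) (crossing x)) + ∑ (allFin n) (λ x → ∑ (allFin n) (crossing x)))
      ≡⟨ four (∑ (allFin n) (λ x → ∑ (allFin n) (crossing x))) ⟩
    4 * ∑ (allFin n) (λ x → ∑ (allFin n) (crossing x)) ∎)
    where
    open ≤-Reasoning
    b : Fin n → Fin n → ℕ
    b x y = ⟪ Edge? G (x , y) ⟫
    colour = proj₁ (max-cut n b)
    open Embedding {n} {k} {ℓ} G colour using (crossing; crossing?)

    cut = ∑ (allFin n) (λ x → ∑ (allFin n) (λ y → b x y * differ (colour x) (colour y)))

    four : ∀ t → 2 * (t + t) ≡ 4 * t
    four = solve-∀

    one-sided : ∀ x y u v → (Edge G (x , y) → Adj G u v × colour u ≡ true × colour v ≡ false) → b x y * 1 ≤ crossing u v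
    one-sided x y u v f = ≤-trans (≤-reflexive (*-identityʳ _)) (implies (Edge? G (x , y)))
      where
      implies : (d : Dec (Edge G (x , y))) → ⟪ d ⟫ ≤ crossing u v
      implies (no _)  = z≤n
      implies (yes p) = ≤-reflexive (sym (⟪⟫-yes (crossing? u v) (f p)))

    oriented : ∀ x y s t → colour x ≡ s → colour y ≡ t → b x y * differ s t ≤ crossing x y + crossing y x
    oriented x y true  true  _ _ = ≤-trans (≤-reflexive (*-zeroʳ (b x y))) z≤n
    oriented x y false false _ _ = ≤-trans (≤-reflexive (*-zeroʳ (b x y))) z≤n
    oriented x y true  false p q = ≤-trans (one-sided x y x y (λ (_ , xy) → xy , p , q)) (m≤m+n (crossing x y) (crossing y x))
    oriented x y false true  p q = ≤-trans (one-sided x y y x (λ (_ , xy) → Graph.Adj-sym G xy , q , p)) (m≤n+m (crossing y x) (crossing x y))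

  -- The walks without conflict are the tori in G, so that in a torus-free graph K-bounded applies to
  -- every admissible K.
  module TorusFree {n : ℕ} .{{_ : NonZero n}} (r r′ : ℕ) (G : Graph n)
    (4≤k : 4 ≤ suc (suc (suc r′ + suc r′))) (free : ¬ torus (suc (suc (suc r′ + suc r′))) (suc (suc r)) 4≤k ⊑ G)
    (colour : Fin n → Bool) (K : ℕ) (K>0 : 0 < K) where

    k ℓ : ℕ
    k = suc (suc (suc r′ + suc r′))
    ℓ = suc (suc r)

    open Embedding {n} {k} {ℓ} G colour
    open Tuples crossing crossing≤1 ℓ

    ι : ℕ → ℕ
    ι = proj₁ (reciprocals n K K>0)

    instance
      n!≢0 : NonZero (n !)
      n!≢0 = n !≢0

    open Weighted K (n !) ι (proj₁ (proj₂ (reciprocals n K K>0))) (proj₂ (proj₂ (reciprocals n K K>0)))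
    open Count crossing crossing≤1 r K (n !) ι (proj₁ (proj₂ (reciprocals n K K>0))) (proj₂ (proj₂ (reciprocals n K K>0)))
      using (closed-walks-many; e)
    open Conflicts us a a-sym w K L w-degree≤L vs D D-sparse coincide
      (λ j j′ (s , p) → ⟪⟫≤1 (lookup p j ≟ᶠ lookup p j′)) coincide-sparse r′
      using (conflict; conflicts; conflict-free; gap?; q; K-bounded)
    open ClosedWalks us a a-sym w using (f; pair)

    module _ (v : Vec U k) (0<cyc : 0 < cyc f v) (none : conflicts v ≡ 0) where

      layer : Fin k → Fin ℓ → Fin n
      layer i = lookup (proj₂ (lookup v i))

      edge : ∀ i → 0 < a (lookup v i) (lookup v (next i))
      edge i = proj₂ (*-positive (w (lookup v i)) _ (∏-positive (λ i → f (lookup v i) (lookup v (next i))) 0<cyc i))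

      no-conflict : ∀ i i′ j j′ → conflict i i′ j j′ v ≡ 0
      no-conflict = conflict-free v none

      layers-apart : ∀ i i′ j j′ → toℕ i < toℕ i′ → even (toℕ i) ≡ even (toℕ i′) → layer i j ≢ layer i′ j′
      layers-apart i i′ j j′ i<i′ parity eq = contradiction
        (trans (sym one) (m+n≡0⇒m≡0 (⟪ gap? i i′ ⟫ * pair vs (D j) (D j′) i i′ v) (no-conflict i i′ j j′))) λ ()
        where
        one : ⟪ gap? i i′ ⟫ * pair vs (D j) (D j′) i i′ v ≡ 1
        one = cong₂ _*_ (⟪⟫-yes (gap? i i′) (i<i′ , parity))
          (trans (∑-pick (layer i j) (λ c → ⟪ layer i′ j′ ≟ᶠ c ⟫)) (⟪⟫-yes (layer i′ j′ ≟ᶠ layer i j) (sym eq)))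

      layer-injective : ∀ i j j′ → layer i j ≡ layer i j′ → j ≡ j′
      layer-injective i j j′ eq with j ≟ᶠ j′
      ... | yes j≡j′ = j≡j′
      ... | no j≢j′  = contradiction
        (trans (sym one) (m+n≡0⇒n≡0 (⟪ gap? i i ⟫ * pair vs (D j) (D j′) i i v) (no-conflict i i j j′))) λ ()
        where
        one : ⟪ ¬? (j ≟ᶠ j′) ⟫ * coincide j j′ (lookup v i) ≡ 1
        one = cong₂ _*_ (⟪⟫-yes (¬? (j ≟ᶠ j′)) j≢j′) (⟪⟫-yes (layer i j ≟ᶠ layer i j′) eq)

      open Walk (lookup v) edge using (side; side-next; colour-side)

      same-parity : ∀ i i′ j j′ → layer i j ≡ layer i′ j′ → even (toℕ i) ≡ even (toℕ i′)
      same-parity i i′ j j′ eq = flip-by-injective (even (toℕ i)) (even (toℕ i′)) (side zero) (begin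
        flip-by (even (toℕ i)) (side zero)     ≡⟨ side-even side side-next i ⟨
        side i                                 ≡⟨ colour-side i j ⟨
        colour (layer i j)                       ≡⟨ cong colour eq ⟩
        colour (layer i′ j′)                     ≡⟨ colour-side i′ j′ ⟩
        side i′                                ≡⟨ side-even side side-next i′ ⟩
        flip-by (even (toℕ i′)) (side zero)    ∎)
        where open ≡-Reasoning

      vertices-distinct : ∀ i j i′ j′ → layer i j ≡ layer i′ j′ → i ≡ i′ × j ≡ j′
      vertices-distinct i j i′ j′ eq with <-cmp (toℕ i) (toℕ i′)
      ... | tri< i<i′ _ _ = contradiction eq (layers-apart i i′ j j′ i<i′ (same-parity i i′ j j′ eq))
      ... | tri> _ _ i′<i = contradiction (sym eq) (layers-apart i′ i j′ j i′<i (sym (same-parity i i′ j j′ eq)))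
      ... | tri≈ _ i≡i′ _ with toℕ-injective i≡i′
      ...   | refl = refl , layer-injective i j j′ eq

      torus-copy : torus k ℓ 4≤k ⊑ G
      torus-copy = embed′ G colour 4≤k (lookup v) edge vertices-distinct

    length-us : length us ≡ 2 * n ^ ℓ
    length-us = trans (length-both (vecs vs ℓ))
      (cong (2 *_) (trans (length-vecs vs ℓ) (cong (_^ ℓ) (length-allFin n))))

    K-small : 0 < e → 8 * ℓ * K * (n * n * n) ≤ e * e →
              K ^ suc (suc r′) ≤ (4 * q) ^ suc (suc r′) * (2 * n ^ ℓ)
    K-small e>0 e-large = subst (λ t → K ^ suc (suc r′) ≤ (4 * q) ^ suc (suc r′) * t) length-us
      (K-bounded (∈-both (∈-vecs vs ∈-allFin)) (m^n>0 (n !) ℓ) (closed-walks-many e>0 e-large (suc r′))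
        (λ v 0<cyc → n≢0⇒n>0 (λ none → free (torus-copy v 0<cyc none))))

  -- From the codegree threshold to the number of edges

  ^-cancelˡ-≤ : ∀ j .{{_ : NonZero j}} {x y} → x ^ j ≤ y ^ j → x ≤ y
  ^-cancelˡ-≤ j {x} {y} le with ≤-<-connex x y
  ... | inj₁ x≤y = x≤y
  ... | inj₂ y<x = contradiction le (<⇒≱ (^-monoˡ-< j y<x))

  ^-cancelʳ-≤ : ∀ x → 1 < x → ∀ {i j} → x ^ i ≤ x ^ j → i ≤ j
  ^-cancelʳ-≤ x 1<x {i} {j} le with ≤-<-connex i j
  ... | inj₁ i≤j = i≤j
  ... | inj₂ j<i = contradiction le (<⇒≱ (^-monoʳ-< x 1<x j<i))

  abstract
    -- With all factors raised to the power m: 16 is the square of the 4 lost in the bipartition, 2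
    -- is the rounding of K, 4 * q comes from the bound on K, and 8 * ℓ from the size required of
    -- e². The single 2 counts the two sides in the number of tuples.
    constant : ℕ → ℕ → ℕ → ℕ
    constant ℓ m q = 16 ^ m * (2 ^ m * ((4 * q) ^ m * 2 * (8 * ℓ) ^ m))

    constant>0 : ∀ ℓ m q .{{_ : NonZero ℓ}} .{{_ : NonZero q}} → 0 < constant ℓ m q
    constant>0 ℓ m q = *-mono-< (m^n>0 16 m) (*-mono-< (m^n>0 2 m)
      (*-mono-< (*-mono-< (m^n>0 (4 * q) {{m*n≢0 4 q}} m) (s≤s {0} {1} z≤n)) (m^n>0 (8 * ℓ) {{m*n≢0 8 ℓ}} m)))

    assemble : ∀ (ℓ m q E e K n : ℕ) → E ≤ 4 * e → e * e ≤ 2 * K * (8 * ℓ * (n * n * n)) →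
      K ^ m ≤ (4 * q) ^ m * (2 * n ^ ℓ) → (E * E) ^ m ≤ constant ℓ m q * (n ^ ℓ * (n * n * n) ^ m)
    assemble ℓ m q E e K n E≤4e ee≤ Kᵐ≤ = begin
      (E * E) ^ m
        ≤⟨ ^-monoˡ-≤ m (≤-trans (*-mono-≤ E≤4e E≤4e) (≤-reflexive (square e))) ⟩
      (16 * (e * e)) ^ m
        ≤⟨ ^-monoˡ-≤ m (*-monoʳ-≤ 16 ee≤) ⟩
      (16 * (2 * K * (8 * ℓ * (n * n * n)))) ^ m
        ≡⟨ expand 16 2 K (8 * ℓ) (n * n * n) ⟩
      16 ^ m * (2 ^ m * K ^ m * ((8 * ℓ) ^ m * (n * n * n) ^ m))
        ≤⟨ *-monoʳ-≤ (16 ^ m) (*-monoˡ-≤ ((8 * ℓ) ^ m * (n * n * n) ^ m) (*-monoʳ-≤ (2 ^ m) Kᵐ≤)) ⟩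
      16 ^ m * (2 ^ m * ((4 * q) ^ m * (2 * n ^ ℓ)) * ((8 * ℓ) ^ m * (n * n * n) ^ m))
        ≡⟨ arrange (16 ^ m) (2 ^ m) ((4 * q) ^ m) (n ^ ℓ) ((8 * ℓ) ^ m) ((n * n * n) ^ m) ⟩
      constant ℓ m q * (n ^ ℓ * (n * n * n) ^ m) ∎
      where
      open ≤-Reasoning
      square : ∀ e → 4 * e * (4 * e) ≡ 16 * (e * e)
      square = solve-∀
      expand : ∀ a b K l c → (a * (b * K * (l * c))) ^ m ≡ a ^ m * (b ^ m * K ^ m * (l ^ m * c ^ m))
      expand a b K l c = trans (^-*-distrib a (b * K * (l * c)) m) (cong (a ^ m *_) (trans (^-*-distrib (b * K) (l * c) m)
        (cong₂ _*_ (^-*-distrib b K m) (^-*-distrib l c m))))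
      arrange : ∀ a b p x l c → a * (b * (p * (2 * x)) * (l * c)) ≡ a * (b * (p * 2 * l)) * (x * c)
      arrange = solve-∀

  -- K is taken as large as possible.
  edge-count : ∀ (ℓ m q E e n : ℕ) .{{_ : NonZero ℓ}} .{{_ : NonZero q}} .{{_ : NonZero n}} → E ≤ 4 * e →
    (∀ K → 0 < K → 0 < e → 8 * ℓ * K * (n * n * n) ≤ e * e → K ^ m ≤ (4 * q) ^ m * (2 * n ^ ℓ)) →
    (E * E) ^ m ≤ constant ℓ m q * (n ^ ℓ * (n * n * n) ^ m)
  edge-count ℓ m q E e n E≤4e K-small = go (e * e / unit) ee≤ (m/n*n≤m (e * e) unit)
    where
    open ≤-Reasoning

    unit : ℕ
    unit = 8 * ℓ * (n * n * n)

    instance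
      unit≢0 : NonZero unit
      unit≢0 = m*n≢0 (8 * ℓ) (n * n * n) {{m*n≢0 8 ℓ}} {{m*n≢0 (n * n) n {{m*n≢0 n n}}}}

    ee≤ : e * e ≤ suc (e * e / unit) * unit
    ee≤ = begin
      e * e                                   ≡⟨ m≡m%n+[m/n]*n (e * e) unit ⟩
      e * e % unit + (e * e / unit) * unit    ≤⟨ +-monoˡ-≤ (e * e / unit * unit) (<⇒≤ (m%n<n (e * e) unit)) ⟩
      unit + (e * e / unit) * unit            ∎

    regroup : ∀ l K c → 8 * l * K * c ≡ K * (8 * l * c)
    regroup = solve-∀

    large : ∀ K → 0 < K → e * e ≤ suc K * unit → K * unit ≤ e * e → (E * E) ^ m ≤ constant ℓ m q * (n ^ ℓ * (n * n * n) ^ m)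
    large K K>0 upper lower = assemble ℓ m q E e K n E≤4e
      -- Since K ≥ 1, suc K ≤ 2 * K; this is the rounding loss allowed for in `assemble`.
      (≤-trans upper (*-monoˡ-≤ unit (≤-trans (+-monoˡ-≤ K K>0) (≤-reflexive (cong (K +_) (sym (+-identityʳ K)))))))
      (K-small K K>0 e>0 (≤-trans (≤-reflexive (regroup ℓ K (n * n * n))) lower))
      where
      e>0 : 0 < e
      e>0 = n≢0⇒n>0 λ e≡0 → <⇒≱ (*-mono-< K>0 (>-nonZero⁻¹ unit)) (≤-trans lower (≤-reflexive (cong (λ t → t * t) e≡0)))

    go : ∀ K → e * e ≤ suc K * unit → K * unit ≤ e * e → (E * E) ^ m ≤ constant ℓ m q * (n ^ ℓ * (n * n * n) ^ m)
    -- Here e² is at most one unit, and `assemble` applies with 1 in place of K, for which the bound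
    -- on K is trivial.
    go zero    upper _ = assemble ℓ m q E e 1 n E≤4e
      (≤-trans upper (*-monoˡ-≤ unit {1} {2 * 1} (s≤s z≤n)))
      (≤-trans (≤-reflexive (^-zeroˡ m))
        (*-mono-< (m^n>0 (4 * q) {{m*n≢0 4 q}} m) (*-mono-< {0} {2} (s≤s z≤n) (m^n>0 n ℓ))))
    go (suc K) upper lower = large (suc K) (s≤s z≤n) upper lower

  -- The exponent 3 / 2 + ℓ / k of n, multiplied by 2 k where k = m + m.
  clear-denominators : ∀ (m ℓ c n E k : ℕ) .{{_ : NonZero m}} .{{_ : NonZero c}} → k ≡ m + m →
    (E * E) ^ m ≤ c * (n ^ ℓ * (n * n * n) ^ m) → E ^ (2 * k) ≤ c ^ (2 * k) * n ^ (3 * k + ℓ * 2)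
  clear-denominators m ℓ c n E k refl bound = begin
    E ^ (2 * k)
      ≡⟨ exponents E ⟩
    (E * E) ^ m * (E * E) ^ m
      ≤⟨ *-mono-≤ bound bound ⟩
    c * (n ^ ℓ * (n * n * n) ^ m) * (c * (n ^ ℓ * (n * n * n) ^ m))
      ≡⟨ interchange c (n ^ ℓ) ((n * n * n) ^ m) ⟩
    c * c * (n ^ ℓ * n ^ ℓ * ((n * n * n) ^ m * (n * n * n) ^ m))
      ≤⟨ *-mono-≤ cc≤ (≤-reflexive (sym exponents′)) ⟩
    c ^ (2 * k) * n ^ (3 * k + ℓ * 2) ∎
    where
    open ≤-Reasoning

    interchange : ∀ c x y → c * (x * y) * (c * (x * y)) ≡ c * c * (x * x * (y * y))
    interchange = solve-∀

    square : ∀ x j → (x * x) ^ j ≡ x ^ (j + j)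
    square x j = trans (^-*-distrib x x j) (sym (^-distribˡ-+-* x j j))

    cube : ∀ x j → (x * x * x) ^ j ≡ x ^ (j + j + j)
    cube x j = trans (^-*-distrib (x * x) x j) (trans (cong (_* x ^ j) (square x j)) (sym (^-distribˡ-+-* x (j + j) j)))

    -- This generous estimate lets the integer c itself serve as the final constant, instead of a
    -- root of it.
    cc≤ : c * c ≤ c ^ (2 * k)
    cc≤ = begin
      c * c         ≡⟨ cong (c *_) (*-identityʳ c) ⟨
      c ^ 2         ≤⟨ ^-monoʳ-≤ c (*-monoʳ-≤ 2 {1} {k} (≤-trans (>-nonZero⁻¹ m) (m≤m+n m m))) ⟩
      c ^ (2 * k)   ∎

    2k : ∀ m → 2 * (m + m) ≡ (m + m) + (m + m)
    2k = solve-∀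

    3k+2ℓ : ∀ l m → 3 * (m + m) + l * 2 ≡ (l + l) + ((m + m + m) + (m + m + m))
    3k+2ℓ = solve-∀

    exponents : ∀ x → x ^ (2 * k) ≡ (x * x) ^ m * (x * x) ^ m
    exponents x = trans (cong (x ^_) (2k m))
      (trans (^-distribˡ-+-* x (m + m) (m + m)) (sym (cong₂ _*_ (square x m) (square x m))))

    exponents′ : n ^ (3 * k + ℓ * 2) ≡ n ^ ℓ * n ^ ℓ * ((n * n * n) ^ m * (n * n * n) ^ m)
    exponents′ = trans (cong (n ^_) (3k+2ℓ ℓ m)) (trans (^-distribˡ-+-* n (ℓ + ℓ) (m + m + m + (m + m + m)))
      (cong₂ _*_ (^-distribˡ-+-* n ℓ ℓ) (trans (^-distribˡ-+-* n (m + m + m) (m + m + m)) (sym (cong₂ _*_ (cube n m) (cube n m))))))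

  -- The maximum is either its default value 0 or attained in the list, so a graph free of F need
  -- not be exhibited beforehand; `P 0` covers the default.
  ex-induction : ∀ {m} (F : Graph m) n (P : ℕ → Set) → P 0 → (∀ (G : Graph n) → ¬ F ⊑ G → P ∣E G ∣) → P (ex n F)
  ex-induction F n P P0 step with argmax-sel (λ x → x) 0 (map ∣E_∣ (freeGraphs n F))
  ... | inj₁ ex≡0 = subst P (sym ex≡0) P0
  ... | inj₂ ex∈ with ∈-map⁻ ∣E_∣ ex∈
  ...   | G , G∈ , ex≡ = subst P (sym ex≡) (step G (proj₂ (∈-filter⁻ (λ H → ¬? (F ⊑? H)) {xs = allGraphs n} G∈)))

  torus-constant : ℕ → ℕ → ℕ
  torus-constant r r′ = constant (suc (suc r)) (suc (suc r′)) (events (suc (suc (suc r′ + suc r′))) (suc (suc r)))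

  torus-constant>0 : ∀ r r′ → 0 < torus-constant r r′
  torus-constant>0 r r′ = constant>0 (suc (suc r)) (suc (suc r′)) (events (suc (suc (suc r′ + suc r′))) (suc (suc r)))
    {{_}} {{>-nonZero (events>0 (suc (suc (suc r′ + suc r′))) (suc (suc r)))}}

  torus-bound : ∀ r r′ (4≤k : 4 ≤ suc (suc (suc r′ + suc r′))) n .{{_ : NonZero n}} →
    let E = ex n (torus (suc (suc (suc r′ + suc r′))) (suc (suc r)) 4≤k) in
    (E * E) ^ suc (suc r′) ≤ torus-constant r r′ * (n ^ suc (suc r) * (n * n * n) ^ suc (suc r′))
  torus-bound r r′ 4≤k n = ex-induction (torus (suc (suc (suc r′ + suc r′))) (suc (suc r)) 4≤k) n
    (λ E → (E * E) ^ suc (suc r′) ≤ torus-constant r r′ * (n ^ suc (suc r) * (n * n * n) ^ suc (suc r′)))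
    z≤n
    (λ G free → edge-count (suc (suc r)) (suc (suc r′)) (events (suc (suc (suc r′ + suc r′))) (suc (suc r))) ∣E G ∣ _ n
      {{_}} {{>-nonZero (events>0 (suc (suc (suc r′ + suc r′))) (suc (suc r)))}}
      (proj₂ (bipartition {n} {suc (suc (suc r′ + suc r′))} {suc (suc r)} G))
      (TorusFree.K-small r r′ G 4≤k free (proj₁ (bipartition {n} {suc (suc (suc r′ + suc r′))} {suc (suc r)} G))))

-- Transfer to reals given by upper bounds

module RealBounds where

  open Combinatorics
  open import Defs using (ex; torus; _≼_; _·_; ⟦_⟧; fromℕ; pow; log)
  open import Data.Integer.Base as ℤ using (+_; -[1+_]; +≤+)
  import Data.Integer.Properties as ℤ
  open import Data.Nat.Base as ℕ using (ℕ; zero; suc; _*_; _^_; _≤_; z≤n; s≤s; NonZero; >-nonZero)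
  open import Data.Nat.Divisibility using (_∣_; divides)
  open import Data.Nat.Properties
  open import Data.Nat.Tactic.RingSolver using (solve-∀)
  open import Data.Product.Base using (_×_; _,_; proj₁; proj₂; ∃)
  open import Data.Rational.Unnormalised.Base as ℚᵘ using (ℚᵘ; mkℚᵘ; 0ℚᵘ; ↥_; ↧ₙ_; *≤*)
  import Data.Rational.Unnormalised.Properties as ℚᵘ
  open import Relation.Binary.PropositionalEquality
  import Algebra.Definitions.RawSemiring ℚᵘ.+-*-rawSemiring as Power

  ↥-* : ∀ p q → ↥ (p ℚᵘ.* q) ≡ ↥ p ℤ.* ↥ q
  ↥-* (mkℚᵘ _ _) (mkℚᵘ _ _) = refl

  ↧ₙ-* : ∀ p q → ↧ₙ (p ℚᵘ.* q) ≡ ↧ₙ p * ↧ₙ q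
  ↧ₙ-* (mkℚᵘ _ _) (mkℚᵘ _ _) = refl

  ↥-^ : ∀ a b j → ↥ (mkℚᵘ (+ a) b Power.^ j) ≡ + (a ^ j)
  ↥-^ a b zero    = refl
  ↥-^ a b (suc j) = trans (↥-* (mkℚᵘ (+ a) b) (mkℚᵘ (+ a) b Power.^ j))
      (trans (cong (+ a ℤ.*_) (↥-^ a b j)) (sym (ℤ.pos-* a (a ^ j))))

  ↧ₙ-^ : ∀ a b j → ↧ₙ (mkℚᵘ (+ a) b Power.^ j) ≡ suc b ^ j
  ↧ₙ-^ a b zero    = refl
  ↧ₙ-^ a b (suc j) = trans (↧ₙ-* (mkℚᵘ (+ a) b) (mkℚᵘ (+ a) b Power.^ j)) (cong (suc b *_) (↧ₙ-^ a b j))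

  fromℕ≤⁻ : ∀ x p {a} → ↥ p ≡ + a → fromℕ x ℚᵘ.≤ p → x * ↧ₙ p ≤ a
  fromℕ≤⁻ x p@record{} {a} refl (*≤* le) = ℤ.drop‿+≤+
    (subst₂ ℤ._≤_ (sym (ℤ.pos-* x (↧ₙ p))) (ℤ.*-identityʳ (+ a)) le)

  fromℕ≤⁺ : ∀ x p {a} → ↥ p ≡ + a → x * ↧ₙ p ≤ a → fromℕ x ℚᵘ.≤ p
  fromℕ≤⁺ x p@record{} {a} refl le =
    *≤* (subst₂ ℤ._≤_ (ℤ.pos-* x (↧ₙ p)) (sym (ℤ.*-identityʳ (+ a))) (+≤+ le))

  -- Write b as a quotient a / (d + 1), multiply by the power j of its denominator, and take roots
  -- in the natural numbers.
  power-bound : ∀ E c X j .{{_ : NonZero j}} → E ^ j ≤ c ^ j * X → ∀ b → 0ℚᵘ ℚᵘ.≤ b →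
                fromℕ X ℚᵘ.≤ b Power.^ j → fromℕ E ℚᵘ.≤ fromℕ c ℚᵘ.* b
  power-bound E c X j Eʲ≤ (mkℚᵘ -[1+ _ ] _) (*≤* ()) _
  power-bound E c X j Eʲ≤ b@(mkℚᵘ (+ a) d) _ X≤ =
    fromℕ≤⁺ E (fromℕ c ℚᵘ.* b) (trans (↥-* (fromℕ c) b) (sym (ℤ.pos-* c a))) (^-cancelˡ-≤ j (begin
      (E * (1 * suc d)) ^ j        ≡⟨ cong (λ t → (E * t) ^ j) (*-identityˡ (suc d)) ⟩
      (E * suc d) ^ j              ≡⟨ ^-*-distrib E (suc d) j ⟩
      E ^ j * suc d ^ j            ≤⟨ *-monoˡ-≤ (suc d ^ j) Eʲ≤ ⟩
      c ^ j * X * suc d ^ j        ≡⟨ *-assoc (c ^ j) X _ ⟩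
      c ^ j * (X * suc d ^ j)      ≤⟨ *-monoʳ-≤ (c ^ j) (subst (λ t → X * t ≤ a ^ j) (↧ₙ-^ a d j)
                                      (fromℕ≤⁻ X (b Power.^ j) (↥-^ a d j) X≤)) ⟩
      c ^ j * a ^ j                ≡⟨ ^-*-distrib c a j ⟨
      (c * a) ^ j                  ∎))
    where open ≤-Reasoning

  -- From 2 ^ (d + 1) ≤ n ^ (d + 1) ≤ 2 ^ a it follows that d + 1 ≤ a. Both logarithmic factors are
  -- estimated from below in this way.
  log≥1 : ∀ n → 2 ≤ n → ∀ p → log n p → fromℕ 1 ℚᵘ.≤ p
  log≥1 n 2≤n (mkℚᵘ -[1+ _ ] _) (*≤* () , _)
  log≥1 n 2≤n p@(mkℚᵘ (+ a) d) (_ , le) = fromℕ≤⁺ 1 p refl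
    (subst (_≤ a) (sym (*-identityˡ (suc d))) (^-cancelʳ-≤ 2 (s≤s (s≤s z≤n)) (≤-trans (^-monoˡ-≤ (suc d) 2≤n) le)))

  -- An upper bound of a product of reals comes with upper bounds of the factors; this follows the
  -- chain through the three products in the theorem, with a′ and l for the two inner ones.
  product-bound : ∀ {E c b a l₁ l₂ a′ p} → fromℕ E ℚᵘ.≤ fromℕ c ℚᵘ.* b → 0ℚᵘ ℚᵘ.≤ b →
    fromℕ c ℚᵘ.≤ a → fromℕ 1 ℚᵘ.≤ l₁ → fromℕ 1 ℚᵘ.≤ l₂ → ∀ {l} → a ℚᵘ.* b ℚᵘ.≤ a′ → l₁ ℚᵘ.* l₂ ℚᵘ.≤ l →
    a′ ℚᵘ.* l ℚᵘ.≤ p → fromℕ E ℚᵘ.≤ p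
  product-bound {E} {c} {b} {a} {l₁} {l₂} {a′} {p} E≤ 0≤b c≤a 1≤l₁ 1≤l₂ {l} ab≤ ll≤ al≤ = begin
    fromℕ E             ≤⟨ E≤a′ ⟩
    a′                  ≡⟨ ℚᵘ.*-identityʳ-≡ a′ ⟨
    a′ ℚᵘ.* fromℕ 1     ≤⟨ ℚᵘ.*-monoʳ-≤-nonNeg a′ {{ℚᵘ.nonNegative (ℚᵘ.≤-trans (ℚᵘ.nonNegative⁻¹ (fromℕ E)) E≤a′)}} 1≤l ⟩
    a′ ℚᵘ.* l           ≤⟨ al≤ ⟩
    p                   ∎
    where
    open ℚᵘ.≤-Reasoning
    E≤a′ : fromℕ E ℚᵘ.≤ a′
    E≤a′ = ℚᵘ.≤-trans E≤ (ℚᵘ.≤-trans (ℚᵘ.*-monoˡ-≤-nonNeg b {{ℚᵘ.nonNegative 0≤b}} c≤a) ab≤)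
    1≤l : fromℕ 1 ℚᵘ.≤ l
    1≤l = ℚᵘ.≤-trans (ℚᵘ.*-mono-≤-nonNeg {fromℕ 1} {l₁} {fromℕ 1} {l₂} 1≤l₁ 1≤l₂) ll≤

  half : ∀ k → 2 ∣ k → 4 ≤ k → ∃ λ r → k ≡ suc (suc (suc r ℕ.+ suc r))
  half _ (divides zero refl) ()
  half _ (divides (suc zero) refl) (s≤s (s≤s ()))
  half _ (divides (suc (suc r)) refl) _ = r , double r
    where
    double : ∀ r → suc (suc r) * 2 ≡ suc (suc (suc r ℕ.+ suc r))
    double = solve-∀

  -- The unnormalised sum of 3 / 2 and ℓ / k computes to numerator 3 k + 2 ℓ over denominator 2 k as
  -- soon as k and ℓ are successors, which also selects the branch for nonnegative exponents.
  pow-bound⁻ : ∀ n k ℓ .{{_ : NonZero k}} .{{_ : NonZero ℓ}} b → pow n (+ 3 ℚᵘ./ 2 ℚᵘ.+ + ℓ ℚᵘ./ k) b →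
               0ℚᵘ ℚᵘ.≤ b × fromℕ (n ^ (3 * k ℕ.+ ℓ * 2)) ℚᵘ.≤ b Power.^ (2 * k)
  pow-bound⁻ n (suc k) (suc ℓ) b p = p

  ≼-intro : ∀ n k ℓ c E .{{_ : NonZero k}} .{{_ : NonZero ℓ}} → 2 ≤ n →
    E ^ (2 * k) ≤ c ^ (2 * k) * n ^ (3 * k ℕ.+ ℓ * 2) →
    fromℕ E ≼ ⟦ fromℕ c ⟧ · pow n (+ 3 ℚᵘ./ 2 ℚᵘ.+ + ℓ ℚᵘ./ k) · (log n · log n)
  ≼-intro n k ℓ c E 2≤n power p (a′ , l , (a , b , (_ , c≤a) , nᵉ≤b , ab≤) , (l₁ , l₂ , log₁ , log₂ , ll≤) , al≤) =
    let (0≤b , nᵉ≤b′) = pow-bound⁻ n k ℓ b nᵉ≤b in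
    product-bound {E} {c} {b} {a} {l₁} {l₂} {a′} {p}
      (power-bound E c (n ^ (3 * k ℕ.+ ℓ * 2)) (2 * k) {{m*n≢0 2 k}} power b 0≤b nᵉ≤b′)
      0≤b c≤a (log≥1 n 2≤n l₁ log₁) (log≥1 n 2≤n l₂ log₂) ab≤ ll≤ al≤

  torus-power-bound : ∀ r k (4≤k : 4 ≤ k) (half-k : ∃ λ r′ → k ≡ suc (suc (suc r′ ℕ.+ suc r′))) n → 2 ≤ n →
    let c = torus-constant r (proj₁ half-k) in
    ex n (torus k (suc (suc r)) 4≤k) ^ (2 * k) ≤ c ^ (2 * k) * n ^ (3 * k ℕ.+ suc (suc r) * 2)
  torus-power-bound r _ 4≤k (r′ , refl) n 2≤n =
    clear-denominators (suc (suc r′)) (suc (suc r)) (torus-constant r r′) n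
      (ex n (torus (suc (suc (suc r′ ℕ.+ suc r′))) (suc (suc r)) 4≤k)) (suc (suc (suc r′ ℕ.+ suc r′)))
      {{_}} {{>-nonZero (torus-constant>0 r r′)}} (cong suc (sym (+-suc (suc r′) (suc r′))))
      (torus-bound r r′ 4≤k n {{>-nonZero (≤-trans (s≤s z≤n) 2≤n)}})

open import Defs
open Combinatorics using (torus-constant)
open RealBounds
open import Data.Integer.Base using (+_)
open import Data.Nat.Base using (ℕ; suc; s≤s; z≤n; _≤_; NonZero)
open import Data.Nat.Divisibility using (_∣_)
open import Data.Product.Base using (Σ-syntax; _,_; proj₁)
open import Data.Rational.Unnormalised.Base using (ℚᵘ; _/_; _+_)

theorem1p5 : ∀ (k ℓ : ℕ) .{{_ : NonZero k}} → 2 ∣ k → (4≤k : 4 ≤ k) → 2 ≤ ℓ →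
    Σ[ C ∈ ℚᵘ ] Σ[ N ∈ ℕ ] ∀ (n : ℕ) → N ≤ n →
    fromℕ (ex n (torus k ℓ 4≤k)) ≼ ⟦ C ⟧ · pow n (+ 3 / 2 + + ℓ / k) · (log n · log n)
theorem1p5 k (suc (suc r)) 2∣k 4≤k (s≤s (s≤s z≤n)) =
  -- The threshold 2 for n is the point from which log n ≥ 1.
  fromℕ (torus-constant r (proj₁ (half k 2∣k 4≤k))) , 2 , λ n 2≤n →
    ≼-intro n k (suc (suc r)) (torus-constant r (proj₁ (half k 2∣k 4≤k))) (ex n (torus k (suc (suc r)) 4≤k)) 2≤n
      (torus-power-bound r k 4≤k (half k 2∣k 4≤k) n 2≤n)
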